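{- Let $m \equiv 3 \pmod 4$ and $n \equiv 1 \pmod 4$ be two distinct square-free positive integers, and let $K = \mathbb{Q}(\sqrt{ -m},\sqrt{n})$. For distinct primes $p, q, r$, the following hold: (I) If $m = p$ with $p \equiv 3 \pmod 8$, then $g(\mathcal{O}_K) = 3$. (II) If $m = pq$ with $p \equiv 3 \pmod 8$, $q \equiv 1 \pmod 8$ and $\left(\frac{p}{q}\right) = -1$, then $g(\mathcal{O}_K) = 3$. (III) If $m = pqr$ with $p \equiv q \equiv r \equiv 3 \pmod 8$ and $\left(\frac{p}{q}\right) = \left(\frac{q}{r}\right) = \left(\frac{r}{p}\right) = -1$, then $g(\mathcal{O}_K) = 3$.
   Context: For a number field $K$, $\mathcal{O}_K$ denotes its ring of integers. $g(\mathcal{O}_K)$ is the smallest positive integer $t$ such that every element of $\mathcal{O}_K$ is a sum of $t$ squares of elements of $\mathcal{O}_K$ (zero summands allowed). $\left(\frac{\cdot}{\cdot}\right)$ is the Legendre symbol. -}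

module Defs where

open import Algebra.Apartness.Bundles using (HeytingField; module HeytingCommutativeRing)
open import Algebra.Bundles using (module CommutativeRing; module Semiring)
open import Data.Fin.Base using (Fin; toℕ)
open import Data.Fin.Properties using (any?)
open import Data.Integer.Base as ℤ using (ℤ; +_; -[1+_])
import Data.Integer.Divisibility.Signed as ℤ
open import Data.Nat.Base as ℕ using (ℕ; suc; _≤_; _<_)
open import Data.Nat.Divisibility using (_∣_)
open import Data.Product.Base using (Σ-syntax; ∃-syntax; _×_)
open import Data.Sum.Base using (_⊎_)
open import Data.Vec.Functional using (Vector)
open import Level using (Level; _⊔_)
open import Relation.Binary.PropositionalEquality.Core using (_≡_)
open import Relation.Nullary.Decidable.Core using (yes; no)
open import Relation.Unary using (Pred)

import Algebra.Definitions.RawSemiring as RawSemiringDefinitions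

SquareFree : ℕ → Set
SquareFree n = ∀ d → d ℕ.* d ∣ n → d ≡ 1

-- The Legendre symbol (a / p); meaningful when p is an odd prime.
legendre : ℤ → ℕ → ℤ
legendre a p with (+ p) ℤ.∣? a
... | yes _ = + 0
... | no  _ with any? (λ (x : Fin p) → (+ p) ℤ.∣? ((+ toℕ x) ℤ.* (+ toℕ x) ℤ.- a))
...   | yes _ = + 1
...   | no  _ = -[1+ 0 ]

-- A HeytingField is a field in the constructive sense: # is a tight apartness
-- relation and x # y holds exactly when x - y is invertible. Classically # is
-- the negation of ≈ and this is the usual notion of a field.
module _ {c ℓ₁ ℓ₂ : Level} (K : HeytingField c ℓ₁ ℓ₂) where

  open HeytingField K using (Carrier; _≈_; _#_; _+_; _*_; -_; 0#; 1#; heytingCommutativeRing)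
  open CommutativeRing (HeytingCommutativeRing.commutativeRing heytingCommutativeRing)
    using (semiring)
  open RawSemiringDefinitions (Semiring.rawSemiring semiring) using (_^_; sum) renaming (_×_ to _×ᴷ_)

  fromℕ : ℕ → Carrier
  fromℕ n = n ×ᴷ 1#

  fromℤ : ℤ → Carrier
  fromℤ (+ n)    = fromℕ n
  fromℤ -[1+ n ] = - fromℕ (suc n)

  -- Nonzero integers are required to be apart from 0, i.e. invertible, so that
  -- K contains ℚ without any appeal to excluded middle.
  CharacteristicZero : Set ℓ₂
  CharacteristicZero = ∀ n → fromℕ (suc n) # 0#

  -- The subfield generated by S. In characteristic zero it is ℚ(S).
  data Adjoin {s : Level} (S : Pred Carrier s) : Pred Carrier (c ⊔ ℓ₁ ⊔ s) where
    gen  : ∀ {x} → S x → Adjoin S x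
    one  : Adjoin S 1#
    add  : ∀ {x y} → Adjoin S x → Adjoin S y → Adjoin S (x + y)
    neg  : ∀ {x} → Adjoin S x → Adjoin S (- x)
    mul  : ∀ {x y} → Adjoin S x → Adjoin S y → Adjoin S (x * y)
    inv  : ∀ {x y} → x * y ≈ 1# → Adjoin S x → Adjoin S y
    resp : ∀ {x y} → x ≈ y → Adjoin S x → Adjoin S y

  -- K = ℚ(√-m, √n). This determines K up to isomorphism when m is positive and
  -- m, n are square-free. The case n = 1 is included: then √n is 1 or -1 and
  -- K = ℚ(√-m).
  record Isℚ⟨√-_,√_⟩ (m n : ℕ) : Set (c ⊔ ℓ₁ ⊔ ℓ₂) where
    field
      characteristicZero : CharacteristicZero
      √-m                : Carrier
      √n                 : Carrier
      √-m-square         : √-m * √-m ≈ - fromℕ m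
      √n-square          : √n * √n ≈ fromℕ n
      generates          : ∀ x → Adjoin (λ y → y ≈ √-m ⊎ y ≈ √n) x

  -- Membership in the ring of integers: x is a root of the monic polynomial
  -- X^k + a_{k-1} X^{k-1} + ⋯ + a_0 with integer coefficients.
  𝒪 : Pred Carrier ℓ₁
  𝒪 x = ∃[ k ] Σ[ a ∈ Vector ℤ k ]
    x ^ k + sum (λ i → fromℤ (a i) * x ^ toℕ i) ≈ 0#

  SumOfSquares𝒪 : ℕ → Pred Carrier (c ⊔ ℓ₁)
  SumOfSquares𝒪 t x = Σ[ y ∈ Vector Carrier t ]
    (∀ i → 𝒪 (y i)) × x ≈ sum (λ i → y i * y i)

  AllSumsOfSquares𝒪 : ℕ → Set (c ⊔ ℓ₁)
  AllSumsOfSquares𝒪 t = ∀ x → 𝒪 x → SumOfSquares𝒪 t x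

  -- g(𝒪_K) = t, as a relation, since the existence of the minimum is part of
  -- what such an equation asserts.
  g𝒪-is : ℕ → Set (c ⊔ ℓ₁)
  g𝒪-is t = 0 < t × AllSumsOfSquares𝒪 t
    × (∀ s → 0 < s → AllSumsOfSquares𝒪 s → t ≤ s)

{-# OPTIONS --safe #-}
module Submission where

-- In all three cases m ≡ 3 (mod 8), and a² - m b² = -2 has a solution in odd
-- integers; then u, v = (a ± b √-m) / 2 are integral and u² + v² = -1.
-- Since 2 is unramified in K with residue fields 𝔽₂ or 𝔽₄, x⁴ ≡ x (mod 2) on
-- 𝒪. Hence x + c² is odd for c = (x + 1)², so x is a difference of two squares
-- minus c², and u² + v² = -1 makes this a sum of three squares. Two squares do
-- not suffice for 1 + 2 α, α = (1 + √-m) / 2: that would force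
-- α² + α ≡ 0 (mod 2), whereas α² + α ≡ 1.
-- The solution (a , b) comes from Legendre's descent: a nontrivial solution of
-- x² - N y² = 1 factors as e s² - d t² = 1 or 2 with d e = N, and congruences
-- modulo 8 and modulo the prime factors of N exclude all but one factorization.
-- The same descent applied to N = q and N = p r supplies the residue symbol of
-- -1 modulo q and the reciprocity law for p, r ≡ 3 (mod 8).

open import Defs
open import Algebra.Apartness.Bundles using (HeytingField)
open import Data.Integer.Base using (+_; -[1+_])
open import Data.Nat.DivMod using (_%_)
open import Data.Nat.Primality using (Prime)
open import Data.Product.Base using (_×_)
open import Level using (Level)
open import Relation.Binary.PropositionalEquality.Core using (_≡_; _≢_)

-- Equality in `K` is not decidable and `n = 1` is allowed, so 𝒪 gets neither an integral basis nor
-- a trace. Congruences modulo 2 are proved in the order ℤ[α, β], where β = (1 + √n) / 2, by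
-- induction on how an element is generated. The passage from this order to 𝒪 rests on x⁴ ≡ x making
-- the order reduced modulo 2: if x is integral and 2 k x lies in the order, some power of 2 k x is
-- divisible by 2 there, hence 2 k x is, and a factor 2 of the denominator cancels. So every
-- integral element has an odd denominator, which is harmless modulo 2. That an integer denominator
-- exists at all comes from ℚ(√-m), where the positive definite norm a² + m b² decides whether an
-- element vanishes. On the arithmetic side the descent needs a nontrivial solution of Pell's
-- equation. It comes from periodicity: reduction acts injectively on the finitely many indefinite
-- forms of the given discriminant, so the orbit of X² - N Y² closes up.

module Arithmetic where

  open import Data.Empty using (⊥)
  open import Data.Fin.Base as Fin using (Fin; fromℕ<; toℕ)
  import Data.Fin.Properties as Fin
  open import Data.Integer.Base as ℤ using (+_; -[1+_]; 0ℤ; 1ℤ; ℤ)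
  open import Data.Integer.DivMod using (_%ℕ_; _/ℕ_; a≡a%ℕn+[a/ℕn]*n; n%ℕd<d)
  import Data.Integer.Divisibility.Signed as ℤ
  import Data.Integer.Properties as ℤ
  open import Data.Integer.Tactic.RingSolver using (solve-∀)
  open import Data.List.Base using ([]; _++_; _∷_; applyUpTo; length; List)
  open import Data.List.Membership.Propositional using (_∈_)
  open import Data.List.Membership.Propositional.Properties using (∈-applyUpTo⁺; ∈-applyUpTo⁻; ∈-∃++)
  open import Data.List.Properties using (length-applyUpTo)
  open import Data.List.Relation.Binary.Permutation.Propositional using (_↭_; ↭-sym; ↭⇒↭ₛ)
  open import Data.List.Relation.Binary.Permutation.Propositional.Properties using (↭-length; ∈-resp-↭) renaming (shift to ↭-shift)
  open import Data.List.Relation.Binary.Permutation.Setoid.Properties using (Unique-resp-↭)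
  open import Data.List.Relation.Unary.All as All using ([]; _∷_; All)
  open import Data.List.Relation.Unary.AllPairs using ([]; _∷_)
  open import Data.List.Relation.Unary.Any using (here; there)
  open import Data.List.Relation.Unary.Unique.Propositional using (Unique)
  open import Data.List.Relation.Unary.Unique.Propositional.Properties using (applyUpTo⁺₁)
  open import Data.Nat.Base as ℕ using (_*_; _+_; _<_; _≤_; suc; zero; ℕ)
  open import Data.Nat.Coprimality using (1-coprimeTo; Coprime; coprime-+; coprime-/gcd; coprime-Bézout; coprime-divisor)
  open import Data.Nat.DivMod using (%-distribˡ-*; %-distribˡ-+; [m+kn]%n≡m%n; _%_; _/_; m%n%n≡m%n; m%n<n; m*n%n≡0; m/n*n≡m; m∣n⇒o%n%m≡o%m; m≡m%n+[m/n]*n)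
  open import Data.Nat.Divisibility using (>⇒∤; _∣_; _∤_; divides; m∣m*n; n∣m*n; ∣-antisym; ∣-refl; ∣-trans; ∣1⇒≡1; ∣m+n∣m⇒∣n; ∣m⇒∣m*n; ∣m∣n⇒∣m+n; ∣n⇒∣m*n)
  open import Data.Nat.GCD using (gcd; gcd[m,n]∣m; gcd[m,n]∣n; gcd[m,n]≢0; module Bézout)
  open import Data.Nat.Induction using (<-rec)
  open import Data.Nat.ListAction using (product)
  open import Data.Nat.ListAction.Properties using (product-↭)
  open import Data.Nat.Primality using (euclidsLemma; Prime; prime⇒irreducible; prime⇒nonTrivial; prime⇒nonZero; ¬prime[1])
  import Data.Nat.Properties as ℕ
  import Data.Nat.Tactic.RingSolver as ℕ-Solver
  open import Data.Product.Base using (_,_; _×_; proj₁; proj₂; Σ-syntax; ∃-syntax)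
  open import Data.Sum.Base using ([_,_]′; _⊎_; inj₁; inj₂)
  open import Data.Sum.Properties using (inj₁-injective; inj₂-injective)
  open import Function.Base using (_∘_; case_of_)
  open import Relation.Binary.PropositionalEquality
  open import Relation.Nullary using (contradiction; Dec; no; yes; ¬_)
  open import Relation.Nullary.Decidable using (False; toWitnessFalse)

  -- Pell's equation by periodicity of indefinite binary forms

  ∣i∣*∣i∣ : ∀ i → i ℤ.* i ≡ + (ℤ.∣ i ∣ * ℤ.∣ i ∣)
  ∣i∣*∣i∣ (+ n)    = sym (ℤ.pos-* n n)
  ∣i∣*∣i∣ -[1+ n ] = refl

  -- Conway's river. The triple (a , b , c) stands for the indefinite form
  -- (a+1) X² + 2 b X Y - (c+1) Y²; a step adds one basis vector to the other,
  -- keeping the outer coefficients of opposite sign.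
  module Pell (N : ℕ) (1<N : 1 < N) (nonsquare : ∀ x → x * x ≢ N) where

    State : Set
    State = ℕ × ℤ × ℕ

    -- Not the discriminant but the value of the form at (1 , 1), the sum of the two basis vectors;
    -- its sign decides which basis vector the sum replaces.
    disc : State → ℤ
    disc (a , b , c) = + suc a ℤ.+ (b ℤ.+ b) ℤ.- + suc c

    stepBy : ℤ → State → State
    -- A placeholder: `disc≢0` rules this branch out for valid states.
    stepBy (+ zero)  s           = s
    stepBy (+ suc k) (a , b , c) = k , b ℤ.- + suc c , c
    stepBy -[1+ k ]  (a , b , c) = a , b ℤ.+ + suc a , k

    step : State → State
    step s = stepBy (disc s) s

    -- The value at (1 , -1). After a step, the difference of the basis vectors is, up to sign, the
    -- vector that was replaced, so this sign tells which step was made.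
    codisc : State → ℤ
    codisc (a , b , c) = + suc a ℤ.- (b ℤ.+ b) ℤ.- + suc c

    backBy : ℤ → State → State
    backBy (+ zero)  s           = s
    backBy (+ suc k) (a , b , c) = k , b ℤ.+ + suc c , c
    backBy -[1+ k ]  (a , b , c) = a , b ℤ.- + suc a , k

    back : State → State
    back s = backBy (codisc s) s

    back-stepBy : ∀ d s → disc s ≡ d → d ≢ 0ℤ → back (stepBy d s) ≡ s
    back-stepBy (+ zero)  s           e d≢0 = contradiction refl d≢0
    back-stepBy (+ suc k) (a , b , c) e _   = trans
      (cong (λ d → backBy d (k , b ℤ.- + suc c , c)) (trans (cong (λ d → d ℤ.- _ ℤ.- + suc c) (sym e)) (shift (+ suc a) b (+ suc c))))
      (cong (λ b → a , b , c) (cancel b (+ suc c)))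
      where
      shift : ∀ a b c → a ℤ.+ (b ℤ.+ b) ℤ.- c ℤ.- ((b ℤ.- c) ℤ.+ (b ℤ.- c)) ℤ.- c ≡ a
      shift = solve-∀
      cancel : ∀ b c → b ℤ.- c ℤ.+ c ≡ b
      cancel = solve-∀
    back-stepBy -[1+ k ]  (a , b , c) e _   = trans
      (cong (λ d → backBy d (a , b ℤ.+ + suc a , k)) (trans (cong (λ d → + suc a ℤ.- ((b ℤ.+ + suc a) ℤ.+ (b ℤ.+ + suc a)) ℤ.+ d) (sym e)) (shift (+ suc a) b (+ suc c))))
      (cong (λ b → a , b , c) (cancel b (+ suc a)))
      where
      shift : ∀ a b c → a ℤ.- ((b ℤ.+ a) ℤ.+ (b ℤ.+ a)) ℤ.+ (a ℤ.+ (b ℤ.+ b) ℤ.- c) ≡ ℤ.- c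
      shift = solve-∀
      cancel : ∀ b a → b ℤ.+ a ℤ.- a ≡ b
      cancel = solve-∀

    -- A quarter of the discriminant of the form is `N`. Both summands being nonnegative, this
    -- bounds all three coefficients and leaves finitely many states.
    Valid : State → Set
    Valid (a , b , c) = b ℤ.* b ℤ.+ + suc a ℤ.* + suc c ≡ + N

    -- Multiplying the form by its first coefficient completes the square: (a + 1 + b)² = N + (a +
    -- 1) · `disc`, so a zero value would make `N` a square.
    disc≢0 : ∀ s → Valid s → disc s ≢ 0ℤ
    disc≢0 (a , b , c) v e = nonsquare ℤ.∣ + suc a ℤ.+ b ∣ (ℤ.+-injective (trans (sym (∣i∣*∣i∣ (+ suc a ℤ.+ b)))
      (trans (square (+ suc a) b (+ suc c)) (trans (cong (λ d → b ℤ.* b ℤ.+ + suc a ℤ.* + suc c ℤ.+ + suc a ℤ.* d) e)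
        (trans (cong (λ z → b ℤ.* b ℤ.+ + suc a ℤ.* + suc c ℤ.+ z) (ℤ.*-zeroʳ (+ suc a))) (trans (ℤ.+-identityʳ _) v))))))
      where
      square : ∀ a b c → (a ℤ.+ b) ℤ.* (a ℤ.+ b) ≡ b ℤ.* b ℤ.+ a ℤ.* c ℤ.+ a ℤ.* (a ℤ.+ (b ℤ.+ b) ℤ.- c)
      square = solve-∀

    back-step : ∀ s → Valid s → back (step s) ≡ s
    back-step s v = back-stepBy (disc s) s refl (disc≢0 s v)

    Valid-step : ∀ s → Valid s → Valid (step s)
    Valid-step s v = by (disc s) s refl v
      where
      pos-eq : ∀ a b c d → a ℤ.+ (b ℤ.+ b) ℤ.- c ≡ d → (b ℤ.- c) ℤ.* (b ℤ.- c) ℤ.+ d ℤ.* c ≡ b ℤ.* b ℤ.+ a ℤ.* c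
      pos-eq a b c d refl = identity a b c
        where
        identity : ∀ a b c → (b ℤ.- c) ℤ.* (b ℤ.- c) ℤ.+ (a ℤ.+ (b ℤ.+ b) ℤ.- c) ℤ.* c ≡ b ℤ.* b ℤ.+ a ℤ.* c
        identity = solve-∀
      neg-eq : ∀ a b c d → a ℤ.+ (b ℤ.+ b) ℤ.- c ≡ ℤ.- d → (b ℤ.+ a) ℤ.* (b ℤ.+ a) ℤ.+ a ℤ.* d ≡ b ℤ.* b ℤ.+ a ℤ.* c
      neg-eq a b c d e = trans (cong (λ d → (b ℤ.+ a) ℤ.* (b ℤ.+ a) ℤ.+ a ℤ.* d) (trans (sym (ℤ.neg-involutive d)) (cong (ℤ.-_) (sym e)))) (identity a b c)
        where
        identity : ∀ a b c → (b ℤ.+ a) ℤ.* (b ℤ.+ a) ℤ.+ a ℤ.* ℤ.- (a ℤ.+ (b ℤ.+ b) ℤ.- c) ≡ b ℤ.* b ℤ.+ a ℤ.* c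
        identity = solve-∀
      by : ∀ d s → disc s ≡ d → Valid s → Valid (stepBy d s)
      by (+ zero)  s           e v = v
      by (+ suc k) (a , b , c) e v = trans (pos-eq (+ suc a) b (+ suc c) (+ suc k) e) v
      by -[1+ k ]  (a , b , c) e v = trans (neg-eq (+ suc a) b (+ suc c) (+ suc k) e) v

    start : State
    start = 0 , 0ℤ , ℕ.pred N

    suc-pred-N : suc (ℕ.pred N) ≡ N
    suc-pred-N = ℕ.suc-pred N ⦃ ℕ.>-nonZero (ℕ.<-trans ℕ.z<s 1<N) ⦄

    Valid-start : Valid start
    Valid-start = cong +_ (trans (ℕ.+-identityʳ _) suc-pred-N)

    state : ℕ → State
    state zero    = start
    state (suc k) = step (state k)

    Valid-state : ∀ k → Valid (state k)
    Valid-state zero    = Valid-start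
    Valid-state (suc k) = Valid-step (state k) (Valid-state k)

    Valid-ℕ : ∀ a b c → Valid (a , b , c) → ℤ.∣ b ∣ * ℤ.∣ b ∣ + suc a * suc c ≡ N
    Valid-ℕ a b c v = ℤ.+-injective (trans (cong (ℤ._+ + (suc a * suc c)) (sym (∣i∣*∣i∣ b))) v)

    m≤m*m : ∀ m → m ≤ m * m
    m≤m*m zero    = ℕ.z≤n
    m≤m*m (suc m) = ℕ.m≤m*n (suc m) (suc m)

    encodeℤ : ∀ b → ℤ.∣ b ∣ < suc N → Fin (suc N) ⊎ Fin (suc N)
    encodeℤ (+ n)    p = inj₁ (fromℕ< p)
    encodeℤ -[1+ n ] p = inj₂ (fromℕ< p)

    encodeℤ-injective : ∀ b b′ p p′ → encodeℤ b p ≡ encodeℤ b′ p′ → b ≡ b′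
    encodeℤ-injective (+ n)    (+ n′)    p p′ e = cong +_ (Fin.fromℕ<-injective _ _ p p′ (inj₁-injective e))
    encodeℤ-injective -[1+ n ] -[1+ n′ ] p p′ e = cong -[1+_] (ℕ.suc-injective (Fin.fromℕ<-injective _ _ p p′ (inj₂-injective e)))

    size : ℕ
    size = N * (N * (suc N + suc N))

    encode : ∀ s → Valid s → Fin size
    encode (a , b , c) v = Fin.combine (fromℕ< a<N) (Fin.combine (fromℕ< c<N) (Fin.join (suc N) (suc N) (encodeℤ b b<1+N)))
      where
      eq : ℤ.∣ b ∣ * ℤ.∣ b ∣ + suc a * suc c ≡ N
      eq = Valid-ℕ a b c v
      a<N : a < N
      a<N = ℕ.≤-trans (ℕ.m≤m*n (suc a) (suc c)) (subst (suc a * suc c ≤_) eq (ℕ.m≤n+m _ _))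
      c<N : c < N
      c<N = ℕ.≤-trans (ℕ.m≤n*m (suc c) (suc a)) (subst (suc a * suc c ≤_) eq (ℕ.m≤n+m _ _))
      b<1+N : ℤ.∣ b ∣ < suc N
      b<1+N = ℕ.s≤s (ℕ.≤-trans (m≤m*m ℤ.∣ b ∣) (subst (ℤ.∣ b ∣ * ℤ.∣ b ∣ ≤_) eq (ℕ.m≤m+n _ _)))

    encode-injective : ∀ s s′ (v : Valid s) (v′ : Valid s′) → encode s v ≡ encode s′ v′ → s ≡ s′
    encode-injective (a , b , c) (a′ , b′ , c′) v v′ e with Fin.combine-injective {N} {N * (suc N + suc N)} _ _ _ _ e
    ... | ea , ebc with Fin.combine-injective {N} {suc N + suc N} _ _ _ _ ebc
    ...   | ec , eb = cong₂ _,_ (Fin.fromℕ<-injective _ _ _ _ ea) (cong₂ _,_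
      (encodeℤ-injective b b′ _ _ (trans (sym (Fin.splitAt-join (suc N) (suc N) _)) (trans (cong (Fin.splitAt (suc N)) eb) (Fin.splitAt-join (suc N) (suc N) _))))
      (Fin.fromℕ<-injective _ _ _ _ ec))

    -- `back` undoes `step` on valid states, so any repetition can be pulled back to the start: the
    -- orbit has no preperiod.
    rewind : ∀ i k → state i ≡ state (i + suc k) → state (suc k) ≡ start
    rewind zero    k e = sym e
    rewind (suc i) k e = rewind i k (trans (sym (back-step (state i) (Valid-state i))) (trans (cong back e) (back-step (state (i + suc k)) (Valid-state (i + suc k)))))

    returns : ∃[ k ] state (suc k) ≡ start
    returns with Fin.pigeonhole {size} {suc size} (ℕ.n<1+n size) (λ i → encode (state (toℕ i)) (Valid-state (toℕ i)))
    ... | i , j , i<j , e with ℕ.m≤n⇒∃[o]m+o≡n i<j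
    ...   | k , 1+i+k≡j = k , rewind (toℕ i) k (trans (encode-injective _ _ _ _ e) (cong state (sym (trans (ℕ.+-suc (toℕ i) k) 1+i+k≡j))))

    -- The values of X² - N Y² and of its polar form at the current basis
    -- (x₁ , y₁), (x₂ , y₂) are the coefficients of the current form.
    record Basis (s : State) : Set where
      field
        x₁ y₁ x₂ y₂ : ℕ
        eq₁₁ : + x₁ ℤ.* + x₁ ≡ + N ℤ.* (+ y₁ ℤ.* + y₁) ℤ.+ + suc (proj₁ s)
        eq₁₂ : + x₁ ℤ.* + x₂ ≡ + N ℤ.* (+ y₁ ℤ.* + y₂) ℤ.+ proj₁ (proj₂ s)
        eq₂₂ : + x₂ ℤ.* + x₂ ≡ + N ℤ.* (+ y₂ ℤ.* + y₂) ℤ.- + suc (proj₂ (proj₂ s))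
        y₂>0 : 0 < y₂
        y₁>0⊎b≥0 : 0 < y₁ ⊎ 0ℤ ℤ.≤ proj₁ (proj₂ s)

    open Basis

    -- The extra alternative excludes the trivial solution (1 , 0). As long as `y₁` stays 0 only
    -- negative steps occur, and each of them increases the middle coefficient; since that
    -- coefficient is 0 again on return to `start`, `y₁` must have become positive.
    Basis-step : ∀ d s → disc s ≡ d → d ≢ 0ℤ → Basis s →
      Σ[ B ∈ Basis (stepBy d s) ] (0 < y₁ B ⊎ 0ℤ ℤ.< proj₁ (proj₂ (stepBy d s)))
    Basis-step (+ zero)  s           e d≢0 B = contradiction refl d≢0
    Basis-step (+ suc k) (a , b , c) e _   B = record
      { x₁ = x₁ B + x₂ B ; y₁ = y₁ B + y₂ B ; x₂ = x₂ B ; y₂ = y₂ B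
      ; eq₁₁ = trans (expand (+ x₁ B) (+ x₂ B)) (trans (cong₂ ℤ._+_ (cong₂ ℤ._+_ (eq₁₁ B) (cong₂ ℤ._+_ (eq₁₂ B) (eq₁₂ B))) (eq₂₂ B))
          (trans (collect (+ N) (+ y₁ B) (+ y₂ B) (+ suc a) b (+ suc c)) (cong (λ d → + N ℤ.* ((+ y₁ B ℤ.+ + y₂ B) ℤ.* (+ y₁ B ℤ.+ + y₂ B)) ℤ.+ d) e)))
      ; eq₁₂ = trans (ℤ.*-distribʳ-+ (+ x₂ B) (+ x₁ B) (+ x₂ B)) (trans (cong₂ ℤ._+_ (eq₁₂ B) (eq₂₂ B)) (collect′ (+ N) (+ y₁ B) (+ y₂ B) b (+ suc c)))
      ; eq₂₂ = eq₂₂ B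
      ; y₂>0 = y₂>0 B
      ; y₁>0⊎b≥0 = inj₁ y>0
      } , inj₁ y>0
      where
      y>0 : 0 < y₁ B + y₂ B
      y>0 = ℕ.<-≤-trans (y₂>0 B) (ℕ.m≤n+m _ _)
      expand : ∀ x y → (x ℤ.+ y) ℤ.* (x ℤ.+ y) ≡ x ℤ.* x ℤ.+ (x ℤ.* y ℤ.+ x ℤ.* y) ℤ.+ y ℤ.* y
      expand = solve-∀
      collect : ∀ n y z a b c → n ℤ.* (y ℤ.* y) ℤ.+ a ℤ.+ (n ℤ.* (y ℤ.* z) ℤ.+ b ℤ.+ (n ℤ.* (y ℤ.* z) ℤ.+ b)) ℤ.+ (n ℤ.* (z ℤ.* z) ℤ.- c)
        ≡ n ℤ.* ((y ℤ.+ z) ℤ.* (y ℤ.+ z)) ℤ.+ (a ℤ.+ (b ℤ.+ b) ℤ.- c)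
      collect = solve-∀
      collect′ : ∀ n y z b c → n ℤ.* (y ℤ.* z) ℤ.+ b ℤ.+ (n ℤ.* (z ℤ.* z) ℤ.- c) ≡ n ℤ.* ((y ℤ.+ z) ℤ.* z) ℤ.+ (b ℤ.- c)
      collect′ = solve-∀
    Basis-step -[1+ k ]  (a , b , c) e _   B = record
      { x₁ = x₁ B ; y₁ = y₁ B ; x₂ = x₁ B + x₂ B ; y₂ = y₁ B + y₂ B
      ; eq₁₁ = eq₁₁ B
      ; eq₁₂ = trans (ℤ.*-distribˡ-+ (+ x₁ B) (+ x₁ B) (+ x₂ B)) (trans (cong₂ ℤ._+_ (eq₁₁ B) (eq₁₂ B)) (collect′ (+ N) (+ y₁ B) (+ y₂ B) (+ suc a) b))
      ; eq₂₂ = trans (expand (+ x₁ B) (+ x₂ B)) (trans (cong₂ ℤ._+_ (cong₂ ℤ._+_ (eq₁₁ B) (cong₂ ℤ._+_ (eq₁₂ B) (eq₁₂ B))) (eq₂₂ B))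
          (trans (collect (+ N) (+ y₁ B) (+ y₂ B) (+ suc a) b (+ suc c)) (cong (λ d → + N ℤ.* ((+ y₁ B ℤ.+ + y₂ B) ℤ.* (+ y₁ B ℤ.+ + y₂ B)) ℤ.+ d) e)))
      ; y₂>0 = ℕ.<-≤-trans (y₂>0 B) (ℕ.m≤n+m _ _)
      ; y₁>0⊎b≥0 = weaken strict
      } , strict
      where
      strict : 0 < y₁ B ⊎ 0ℤ ℤ.< b ℤ.+ + suc a
      strict with y₁>0⊎b≥0 B
      ... | inj₁ p = inj₁ p
      ... | inj₂ p = inj₂ (ℤ.+-mono-≤-< p (ℤ.+<+ ℕ.z<s))
      weaken : 0 < y₁ B ⊎ 0ℤ ℤ.< b ℤ.+ + suc a → 0 < y₁ B ⊎ 0ℤ ℤ.≤ b ℤ.+ + suc a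
      weaken (inj₁ p) = inj₁ p
      weaken (inj₂ p) = inj₂ (ℤ.<⇒≤ p)
      expand : ∀ x y → (x ℤ.+ y) ℤ.* (x ℤ.+ y) ≡ x ℤ.* x ℤ.+ (x ℤ.* y ℤ.+ x ℤ.* y) ℤ.+ y ℤ.* y
      expand = solve-∀
      collect : ∀ n y z a b c → n ℤ.* (y ℤ.* y) ℤ.+ a ℤ.+ (n ℤ.* (y ℤ.* z) ℤ.+ b ℤ.+ (n ℤ.* (y ℤ.* z) ℤ.+ b)) ℤ.+ (n ℤ.* (z ℤ.* z) ℤ.- c)
        ≡ n ℤ.* ((y ℤ.+ z) ℤ.* (y ℤ.+ z)) ℤ.+ (a ℤ.+ (b ℤ.+ b) ℤ.- c)
      collect = solve-∀
      collect′ : ∀ n y z a b → n ℤ.* (y ℤ.* y) ℤ.+ a ℤ.+ (n ℤ.* (y ℤ.* z) ℤ.+ b) ≡ n ℤ.* (y ℤ.* (y ℤ.+ z)) ℤ.+ (b ℤ.+ a)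
      collect′ = solve-∀

    Basis-start : Basis start
    Basis-start = record
      { x₁ = 1 ; y₁ = 0 ; x₂ = 0 ; y₂ = 1
      ; eq₁₁ = cong (ℤ._+ 1ℤ) (sym (ℤ.*-zeroʳ (+ N)))
      ; eq₁₂ = sym (trans (cong (ℤ._+ 0ℤ) (ℤ.*-zeroʳ (+ N))) refl)
      ; eq₂₂ = sym (trans (cong₂ ℤ._-_ (ℤ.*-identityʳ (+ N)) (cong +_ suc-pred-N)) (ℤ.+-inverseʳ (+ N)))
      ; y₂>0 = ℕ.z<s
      ; y₁>0⊎b≥0 = inj₂ ℤ.≤-refl
      }

    Basis-state : ∀ k → Basis (state k)
    Basis-state-suc : ∀ k → Σ[ B ∈ Basis (state (suc k)) ] (0 < y₁ B ⊎ 0ℤ ℤ.< proj₁ (proj₂ (state (suc k))))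

    Basis-state zero    = Basis-start
    Basis-state (suc k) = proj₁ (Basis-state-suc k)
    Basis-state-suc k = Basis-step (disc (state k)) (state k) refl (disc≢0 (state k) (Valid-state k)) (Basis-state k)

    solution : ∃[ x ] ∃[ y ] 0 < y × x * x ≡ N * (y * y) + 1
    solution = let (k , e) = returns in extract (subst (λ s → Σ[ B ∈ Basis s ] (0 < y₁ B ⊎ 0ℤ ℤ.< proj₁ (proj₂ s))) e (Basis-state-suc k))
      where
      extract : Σ[ B ∈ Basis start ] (0 < y₁ B ⊎ 0ℤ ℤ.< 0ℤ) → ∃[ x ] ∃[ y ] 0 < y × x * x ≡ N * (y * y) + 1
      extract (B , inj₂ (ℤ.+<+ ()))
      extract (B , inj₁ y>0) = x₁ B , y₁ B , y>0 , ℤ.+-injective (trans (ℤ.pos-* (x₁ B) (x₁ B)) (trans (eq₁₁ B)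
        (cong (ℤ._+ 1ℤ) (trans (cong (+ N ℤ.*_) (sym (ℤ.pos-* (y₁ B) (y₁ B)))) (sym (ℤ.pos-* N (y₁ B * y₁ B)))))))

  -- Legendre's descent on solutions of Pell's equation

  even-or-odd : ∀ n → (∃[ k ] n ≡ 2 * k) ⊎ (∃[ k ] n ≡ 1 + 2 * k)
  even-or-odd zero = inj₁ (0 , refl)
  even-or-odd (suc n) with even-or-odd n
  ... | inj₁ (k , e) = inj₂ (k , cong suc e)
  ... | inj₂ (k , e) = inj₁ (suc k , cong suc (trans e (sym (ℕ.+-suc k (k + 0)))))

  2m≢1+2n : ∀ m n → 2 * m ≢ 1 + 2 * n
  2m≢1+2n zero    n       ()
  2m≢1+2n (suc m) zero    e = contradiction (ℕ.suc-injective (trans (sym (ℕ.+-suc (suc m) (m + 0))) e)) λ ()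
  2m≢1+2n (suc m) (suc n) e = 2m≢1+2n m n (ℕ.suc-injective (ℕ.suc-injective (trans (sym (cong suc (ℕ.+-suc m (m + 0)))) (trans e (cong (λ k → suc (suc k)) (ℕ.+-suc n (n + 0)))))))

  -- With `d = gcd u y`, `q = u / d` and `r = y / d`, the equation becomes q v = r² d. Coprimality
  -- of `q` with `r` gives q ∣ d, that of `d` with `v` gives d ∣ q, so u = d².
  coprime-square : ∀ u v y → 0 < u → Coprime u v → u * v ≡ y * y → ∃[ a ] ∃[ b ] u ≡ a * a × v ≡ b * b
  coprime-square u v y 0<u cop e = d , r , trans (sym (m/n*n≡m (gcd[m,n]∣m u y))) (cong (_* d) q≡d) , v≡r²
    where
    d : ℕ
    d = gcd u y
    instance
      d-nonZero : ℕ.NonZero d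
      d-nonZero = ℕ.≢-nonZero (gcd[m,n]≢0 u y (inj₁ (ℕ.>⇒≢ 0<u)))
    q r : ℕ
    q = u / d
    r = y / d
    q⊥r : Coprime q r
    q⊥r = coprime-/gcd u y
    qv≡rrd : q * v ≡ r * (r * d)
    qv≡rrd = ℕ.*-cancelʳ-≡ (q * v) (r * (r * d)) d (trans (shuffle q v d)
      (trans (cong (_* v) (m/n*n≡m (gcd[m,n]∣m u y))) (trans e (trans (sym (cong₂ _*_ y≡rd y≡rd)) (shuffle′ r d)))))
      where
      y≡rd : r * d ≡ y
      y≡rd = m/n*n≡m (gcd[m,n]∣n u y)
      shuffle : ∀ q v d → q * v * d ≡ q * d * v
      shuffle = ℕ-Solver.solve-∀
      shuffle′ : ∀ r d → r * d * (r * d) ≡ r * (r * d) * d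
      shuffle′ = ℕ-Solver.solve-∀
    q∣d : q ∣ d
    q∣d = coprime-divisor q⊥r (coprime-divisor q⊥r (divides v (trans (sym qv≡rrd) (ℕ.*-comm q v))))
    d∣q : d ∣ q
    d∣q = coprime-divisor {n = v} (λ (i∣d , i∣v) → cop (∣-trans i∣d (gcd[m,n]∣m u y) , i∣v)) (divides (r * r) (trans (ℕ.*-comm v q) (trans qv≡rrd (sym (ℕ.*-assoc r r d)))))
    q≡d : q ≡ d
    q≡d = ∣-antisym q∣d d∣q
    v≡r² : v ≡ r * r
    v≡r² = ℕ.*-cancelˡ-≡ v (r * r) d (trans (cong (_* v) (sym q≡d)) (trans qv≡rrd (trans (sym (ℕ.*-assoc r r d)) (ℕ.*-comm (r * r) d))))

  -- A distribution of the listed primes over two factors, kept as data so that pattern matching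
  -- enumerates all factorizations. The products end in a factor 1, whence the terms `p * 1` below.
  data Split : List ℕ → ℕ → ℕ → Set where
    []    : Split [] 1 1
    left  : ∀ {p ps d e} → Split ps d e → Split (p ∷ ps) (p * d) e
    right : ∀ {p ps d e} → Split ps d e → Split (p ∷ ps) d (p * e)

  Split-product : ∀ {ps d e} → Split ps d e → d * e ≡ product ps
  Split-product [] = refl
  Split-product (left {p} {d = d} {e} s)  = trans (ℕ.*-assoc p d e) (cong (p *_) (Split-product s))
  Split-product (right {p} {d = d} {e} s) = trans (shuffle d p e) (cong (p *_) (Split-product s))
    where
    shuffle : ∀ d p e → d * (p * e) ≡ p * (d * e)
    shuffle = ℕ-Solver.solve-∀

  -- Each prime divides `u` or `v` and is moved to that side; once the list is exhausted, the
  -- cofactors are coprime with a square product.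
  coprime-split : ∀ {ps} → All Prime ps → ∀ u v y → 0 < u → Coprime u v → u * v ≡ product ps * (y * y) →
    ∃[ d ] ∃[ e ] ∃[ a ] ∃[ b ] Split ps d e × u ≡ d * (a * a) × v ≡ e * (b * b)
  coprime-split [] u v y 0<u cop e with coprime-square u v y 0<u cop (trans e (ℕ.*-identityˡ _))
  ... | a , b , ea , eb = 1 , 1 , a , b , [] , trans ea (sym (ℕ.*-identityˡ _)) , trans eb (sym (ℕ.*-identityˡ _))
  coprime-split {p ∷ ps} (p-prime ∷ primes) u v y 0<u cop e =
    cases (euclidsLemma u v p-prime (divides (product ps * (y * y)) (trans e (trans (ℕ.*-assoc p _ _) (ℕ.*-comm p _)))))
    where
    cases : p ∣ u ⊎ p ∣ v → ∃[ d ] ∃[ e ] ∃[ a ] ∃[ b ] Split (p ∷ ps) d e × u ≡ d * (a * a) × v ≡ e * (b * b)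
    cases (inj₁ (divides q refl)) =
      let (d , e′ , a , b , s , eu , ev) = coprime-split primes q v y
            (ℕ.n≢0⇒n>0 (λ { refl → ℕ.<-irrefl refl 0<u })) (λ (i∣q , i∣v) → cop (∣-trans i∣q (m∣m*n p) , i∣v))
            (ℕ.*-cancelˡ-≡ _ _ p ⦃ prime⇒nonZero p-prime ⦄ (trans (shuffle p q v) (trans e (ℕ.*-assoc p _ _))))
      in p * d , e′ , a , b , left s , trans (cong (_* p) eu) (trans (ℕ.*-comm _ p) (sym (ℕ.*-assoc p d (a * a)))) , ev
      where
      shuffle : ∀ p q v → p * (q * v) ≡ q * p * v
      shuffle = ℕ-Solver.solve-∀
    cases (inj₂ (divides q refl)) =
      let (d , e′ , a , b , s , eu , ev) = coprime-split primes u q y 0<u (λ (i∣u , i∣q) → cop (i∣u , ∣-trans i∣q (m∣m*n p)))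
            (ℕ.*-cancelˡ-≡ _ _ p ⦃ prime⇒nonZero p-prime ⦄ (trans (shuffle p u q) (trans e (ℕ.*-assoc p _ _))))
      in d , p * e′ , a , b , right s , eu , trans (cong (_* p) ev) (trans (ℕ.*-comm _ p) (sym (ℕ.*-assoc p e′ (b * b))))
      where
      shuffle : ∀ p u q → p * (u * q) ≡ u * (q * p)
      shuffle = ℕ-Solver.solve-∀

  record Equation (d e k : ℕ) : Set where
    constructor solved
    field
      s t      : ℕ
      equation : e * (s * s) ≡ d * (t * t) + k

  -- The value 1 arises from odd x, the value 2 from even x. The condition `e ≢ 1` removes s² - N t²
  -- = 1, which is Pell's equation again.
  Descended : List ℕ → Set
  Descended ps = ∃[ d ] ∃[ e ] Split ps d e × ((e ≢ 1 × Equation d e 1) ⊎ Equation d e 2)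

  module _ {ps : List ℕ} (primes : All Prime ps) {h : ℕ} (odd : product ps ≡ 1 + 2 * h) where

    private
      N : ℕ
      N = product ps

    -- Because `N` is odd, x and y have opposite parity. Then (x - 1)(x + 1) = N y² is split into
    -- coprime factors, after division by 4 if x is odd.
    descend : ∀ y → 0 < y → ∀ x → x * x ≡ N * (y * y) + 1 → Descended ps
    descend = <-rec _ go
      where
      go : ∀ y → (∀ {z} → z < y → 0 < z → ∀ x → x * x ≡ N * (z * z) + 1 → Descended ps) →
        0 < y → ∀ x → x * x ≡ N * (y * y) + 1 → Descended ps
      go y rec 0<y x eq with even-or-odd x | even-or-odd y
      ... | inj₁ (k , refl) | inj₁ (z , refl) = contradiction (trans (sym (reshape k)) (trans eq (reshape′ N z))) (2m≢1+2n (2 * (k * k)) (2 * N * (z * z)))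
        where
        reshape : ∀ k → 2 * k * (2 * k) ≡ 2 * (2 * (k * k))
        reshape = ℕ-Solver.solve-∀
        reshape′ : ∀ N z → N * (2 * z * (2 * z)) + 1 ≡ 1 + 2 * (2 * N * (z * z))
        reshape′ = ℕ-Solver.solve-∀
      ... | inj₂ (k , refl) | inj₂ (z , refl) = contradiction
        (trans (sym (trans (cong (λ N → N * _ + 1) odd) (reshape h z))) (trans (sym eq) (reshape′ k))) (2m≢1+2n (1 + h + 2 * z * (1 + z) * (1 + 2 * h)) (2 * (k * (1 + k))))
        where
        reshape : ∀ h z → (1 + 2 * h) * ((1 + 2 * z) * (1 + 2 * z)) + 1 ≡ 2 * (1 + h + 2 * z * (1 + z) * (1 + 2 * h))
        reshape = ℕ-Solver.solve-∀
        reshape′ : ∀ k → (1 + 2 * k) * (1 + 2 * k) ≡ 1 + 2 * (2 * (k * (1 + k)))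
        reshape′ = ℕ-Solver.solve-∀
      ... | inj₁ (zero , refl) | inj₂ (z , refl) = contradiction (trans eq (ℕ.+-comm _ 1)) λ ()
      -- Here x - 1 = 1 + 2 k and x + 1 are odd and differ by 2, hence are coprime.
      ... | inj₁ (suc k , refl) | inj₂ (z , refl) =
        let (d , e , t , s , split , eu , ev) = coprime-split primes (1 + 2 * k) (1 + 2 * k + 2) (1 + 2 * z) ℕ.z<s cop
              (ℕ.+-cancelʳ-≡ 1 _ _ (trans (reshape k) eq))
        in d , e , split , inj₂ (solved s t (trans (sym ev) (cong (_+ 2) eu)))
        where
        reshape : ∀ k → (1 + 2 * k) * (1 + 2 * k + 2) + 1 ≡ 2 * (1 + k) * (2 * (1 + k))
        reshape = ℕ-Solver.solve-∀
        cop : Coprime (1 + 2 * k) (1 + 2 * k + 2)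
        cop {i} (i∣u , i∣v) = ∣1⇒≡1 (∣m+n∣m⇒∣n (subst (i ∣_) (ℕ.+-comm 1 (2 * k)) i∣u) (∣m⇒∣m*n k (∣m+n∣m⇒∣n i∣v i∣u)))
      -- With x = 1 + 2 k and y = 2 z the equation becomes k (1 + k) = N z², a product of
      -- consecutive numbers.
      ... | inj₂ (k , refl) | inj₁ (z , refl) = 
        let (d , e , t , s , split , eu , ev) = coprime-split primes k (1 + k) z k>0 cop k[1+k]≡Nz²
            eq′ = trans (sym ev) (trans (ℕ.+-comm 1 k) (cong (_+ 1) eu))
        in finish d e t s split eu eq′
        where
        reshape : ∀ k → (1 + 2 * k) * (1 + 2 * k) ≡ 4 * (k * (1 + k)) + 1
        reshape = ℕ-Solver.solve-∀
        reshape′ : ∀ N z → N * (2 * z * (2 * z)) ≡ 4 * (N * (z * z))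
        reshape′ = ℕ-Solver.solve-∀
        k[1+k]≡Nz² : k * (1 + k) ≡ N * (z * z)
        k[1+k]≡Nz² = ℕ.*-cancelˡ-≡ _ _ 4 (trans (ℕ.+-cancelʳ-≡ 1 _ _ (trans (sym (reshape k)) eq)) (reshape′ N z))
        z>0 : 0 < z
        z>0 = ℕ.n≢0⇒n>0 (λ { refl → ℕ.<-irrefl refl 0<y })
        N>0 : 0 < N
        N>0 = subst (0 <_) (sym odd) ℕ.z<s
        k>0 : 0 < k
        k>0 = ℕ.n≢0⇒n>0 (λ { refl → ℕ.<-irrefl k[1+k]≡Nz² (ℕ.*-mono-< N>0 (ℕ.*-mono-< z>0 z>0)) })
        cop : Coprime k (1 + k)
        cop {i} (i∣k , i∣1+k) = coprime-+ (1-coprimeTo k) (subst (i ∣_) (ℕ.+-comm 1 k) i∣1+k , i∣k)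
        smaller : ∀ t → k ≡ N * (t * t) → t < z
        smaller t k≡Nt² = ℕ.≰⇒> (λ z≤t → ℕ.<⇒≱ (ℕ.m<m*n k (1 + k) ⦃ ℕ.>-nonZero k>0 ⦄ (ℕ.s≤s k>0))
          (subst₂ _≤_ (sym k[1+k]≡Nz²) (sym k≡Nt²) (ℕ.*-monoʳ-≤ N (ℕ.*-mono-≤ z≤t z≤t))))
        finish : ∀ d e t s → Split ps d e → k ≡ d * (t * t) → e * (s * s) ≡ d * (t * t) + 1 → Descended ps
        finish d e t s split eu eq′ with e ℕ.≟ 1
        ... | no  e≢1  = d , e , split , inj₁ (e≢1 , solved s t eq′)
        -- Now k = N t² and 1 + k = s², so (s , t) is a smaller nontrivial solution: z² = t² (1 + k)
        -- forces t < z.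
        ... | yes refl = rec (ℕ.<-≤-trans (smaller t k≡Nt²) (ℕ.m≤m+n z (z + 0))) t>0 s
            (trans (sym (ℕ.*-identityˡ _)) (trans eq′ (cong (λ d → d * (t * t) + 1) d≡N)))
          where
          d≡N : d ≡ N
          d≡N = trans (sym (ℕ.*-identityʳ d)) (Split-product split)
          k≡Nt² : k ≡ N * (t * t)
          k≡Nt² = trans eu (cong (_* (t * t)) d≡N)
          t>0 : 0 < t
          t>0 = ℕ.n≢0⇒n>0 (λ { refl → ℕ.<-irrefl (sym (trans k≡Nt² (ℕ.*-zeroʳ N))) k>0 })

    opaque
      descent : 1 < N → (∀ x → x * x ≢ N) → Descended ps
      descent 1<N nonsquare = let (x , y , y>0 , e) = Pell.solution N 1<N nonsquare in descend y y>0 x e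

  -- Congruences modulo 8

  Represented8 : ℕ → ℕ → ℕ → Set
  Represented8 δ ε k = ∃[ σ ] ∃[ τ ] (ε * (toℕ {8} σ * toℕ σ)) % 8 ≡ (δ * (toℕ {8} τ * toℕ τ) + k) % 8

  represented8? : ∀ δ ε k → Dec (Represented8 δ ε k)
  represented8? δ ε k = Fin.any? λ σ → Fin.any? λ τ → _ ℕ.≟ _

  square-term%8 : ∀ e s → (e * (s * s)) % 8 ≡ (e % 8 * ((s % 8) * (s % 8))) % 8
  square-term%8 e s = begin
    (e * (s * s)) % 8                            ≡⟨ %-distribˡ-* e (s * s) 8 ⟩
    (e % 8 * ((s * s) % 8)) % 8                  ≡⟨ cong (λ k → (e % 8 * k) % 8) (%-distribˡ-* s s 8) ⟩
    (e % 8 * (((s % 8) * (s % 8)) % 8)) % 8      ≡⟨ %-distribˡ-* (e % 8) (((s % 8) * (s % 8)) % 8) 8 ⟩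
    (e % 8 % 8 * (((s % 8) * (s % 8)) % 8 % 8)) % 8  ≡⟨ cong (λ k → (e % 8 % 8 * k) % 8) (m%n%n≡m%n ((s % 8) * (s % 8)) 8) ⟩
    (e % 8 % 8 * (((s % 8) * (s % 8)) % 8)) % 8  ≡⟨ %-distribˡ-* (e % 8) ((s % 8) * (s % 8)) 8 ⟨
    (e % 8 * ((s % 8) * (s % 8))) % 8            ∎
    where
    open ≡-Reasoning

  -- For closed `δ`, `ε`, `k` the implicit argument is found by evaluating the search over all 64
  -- pairs of residues.
  impossible8 : ∀ δ ε k {_ : False (represented8? δ ε k)} {d e} → d % 8 ≡ δ → e % 8 ≡ ε → ¬ Equation d e k
  impossible8 δ ε k {f} {d} {e} refl refl (solved s t eq) = toWitnessFalse f
    (fromℕ< (m%n<n s 8) , fromℕ< (m%n<n t 8) , (begin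
    (e % 8 * (toℕ σ * toℕ σ)) % 8                 ≡⟨ cong (λ x → (e % 8 * (x * x)) % 8) (Fin.toℕ-fromℕ< (m%n<n s 8)) ⟩
    (e % 8 * ((s % 8) * (s % 8))) % 8             ≡⟨ square-term%8 e s ⟨
    (e * (s * s)) % 8                             ≡⟨ cong (_% 8) eq ⟩
    (d * (t * t) + k) % 8                         ≡⟨ %-distribˡ-+ (d * (t * t)) k 8 ⟩
    ((d * (t * t)) % 8 + k % 8) % 8               ≡⟨ cong (λ x → (x + k % 8) % 8) (square-term%8 d t) ⟩
    ((d % 8 * ((t % 8) * (t % 8))) % 8 + k % 8) % 8  ≡⟨ %-distribˡ-+ (d % 8 * ((t % 8) * (t % 8))) k 8 ⟨
    (d % 8 * ((t % 8) * (t % 8)) + k) % 8         ≡⟨ cong (λ x → (d % 8 * (x * x) + k) % 8) (Fin.toℕ-fromℕ< (m%n<n t 8)) ⟨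
    (d % 8 * (toℕ τ * toℕ τ) + k) % 8             ∎))
    where
    open ≡-Reasoning
    σ τ : Fin 8
    σ = fromℕ< (m%n<n s 8)
    τ = fromℕ< (m%n<n t 8)

  *-%8 : ∀ m n {i j} → m % 8 ≡ i → n % 8 ≡ j → (m * n) % 8 ≡ (i * j) % 8
  *-%8 m n refl refl = %-distribˡ-* m n 8

  odd8 : ∀ {n} ρ → n % 8 ≡ 1 + 2 * ρ → ∃[ h ] n ≡ 1 + 2 * h
  odd8 {n} ρ e = ρ + 4 * (n / 8) , trans (m≡m%n+[m/n]*n n 8) (trans (cong (_+ n / 8 * 8) e) (shift ρ (n / 8)))
    where
    shift : ∀ ρ x → 1 + 2 * ρ + x * 8 ≡ 1 + 2 * (ρ + 4 * x)
    shift = ℕ-Solver.solve-∀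

  -- Quadratic residues

  -- Multiples of `q` count as residues, so cancellation below must ask that the cancelled factor be
  -- prime to `q`.
  record QR (q : ℕ) (a : ℤ) : Set where
    constructor root
    field
      x        : ℤ
      congruent : + q ℤ.∣ x ℤ.* x ℤ.- a

  +∣+ : ∀ {m n} → m ∣ n → + m ℤ.∣ + n
  +∣+ {m} (divides k e) = ℤ.divides (+ k) (trans (cong +_ e) (ℤ.pos-* k m))

  ∣-resp : ∀ {i x y} → x ≡ y → i ℤ.∣ x → i ℤ.∣ y
  ∣-resp refl d = d

  legendre⇒¬QR : ∀ a p → 0 < p → legendre a p ≡ -[1+ 0 ] → ¬ QR p a
  legendre⇒¬QR a p 0<p e (root x d) with (+ p) ℤ.∣? a
  ... | yes _ = contradiction e λ ()
  ... | no  _ with Fin.any? (λ (x : Fin p) → (+ p) ℤ.∣? ((+ toℕ x) ℤ.* (+ toℕ x) ℤ.- a))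
  ...   | yes _ = contradiction e λ ()
  ...   | no ¬∃ = ¬∃ (fromℕ< r<p , subst (λ r → + p ℤ.∣ + r ℤ.* + r ℤ.- a) (sym (Fin.toℕ-fromℕ< r<p)) reduced)
    where
    instance
      p-nonZero : ℕ.NonZero p
      p-nonZero = ℕ.>-nonZero 0<p
    r : ℕ
    r = x %ℕ p
    r<p : r < p
    r<p = n%ℕd<d x p
    k : ℤ
    k = x /ℕ p
    shift : ∀ r k p a → (r ℤ.+ k ℤ.* p) ℤ.* (r ℤ.+ k ℤ.* p) ℤ.- a ℤ.- (+ 2 ℤ.* r ℤ.* k ℤ.+ k ℤ.* k ℤ.* p) ℤ.* p ≡ r ℤ.* r ℤ.- a
    shift = solve-∀
    reduced : + p ℤ.∣ + r ℤ.* + r ℤ.- a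
    reduced = ∣-resp (shift (+ r) k (+ p) a)
      (ℤ.∣m∣n⇒∣m-n (∣-resp (cong (λ x → x ℤ.* x ℤ.- a) (a≡a%ℕn+[a/ℕn]*n x p)) d) (ℤ.∣n⇒∣m*n (+ 2 ℤ.* + r ℤ.* k ℤ.+ k ℤ.* k ℤ.* + p) ℤ.∣-refl))

  module _ {q d e k : ℕ} (eqn : Equation d e k) where

    open Equation eqn renaming (equation to eq)

    private
      eqℤ : + e ℤ.* (+ s ℤ.* + s) ≡ + d ℤ.* (+ t ℤ.* + t) ℤ.+ + k
      eqℤ = trans (cong (+ e ℤ.*_) (sym (ℤ.pos-* s s))) (trans (sym (ℤ.pos-* e (s * s))) (trans (cong +_ eq)
        (cong (ℤ._+ + k) (trans (ℤ.pos-* d (t * t)) (cong (+ d ℤ.*_) (ℤ.pos-* t t))))))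

    -- Multiplying the equation by `e` turns its left side into (e s)², and the term with `d`
    -- vanishes modulo `q`.
    ∣d⇒QR : q ∣ d → QR q (+ e ℤ.* + k)
    ∣d⇒QR q∣d = root (+ e ℤ.* + s) (∣-resp (trans (shift (+ e) (+ d ℤ.* (+ t ℤ.* + t)) (+ k)) (trans (cong (λ z → + e ℤ.* (z ℤ.- + k)) (sym eqℤ)) (square (+ e) (+ s) (+ k))))
      (ℤ.∣n⇒∣m*n (+ e) (ℤ.∣m⇒∣m*n (+ t ℤ.* + t) (+∣+ q∣d))))
      where
      shift : ∀ e x k → e ℤ.* x ≡ e ℤ.* (x ℤ.+ k ℤ.- k)
      shift = solve-∀
      square : ∀ e s k → e ℤ.* (e ℤ.* (s ℤ.* s) ℤ.- k) ≡ (e ℤ.* s) ℤ.* (e ℤ.* s) ℤ.- e ℤ.* k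
      square = solve-∀

    -- Multiplying by `d` instead gives 0 ≡ (d t)² + d k.
    ∣e⇒QR : q ∣ e → QR q (ℤ.- (+ d ℤ.* + k))
    ∣e⇒QR q∣e = root (+ d ℤ.* + t) (∣-resp (trans (cong (+ d ℤ.*_) eqℤ) (square (+ d) (+ t) (+ k)))
      (ℤ.∣n⇒∣m*n (+ d) (ℤ.∣m⇒∣m*n (+ s ℤ.* + s) (+∣+ q∣e))))
      where
      square : ∀ d t k → d ℤ.* (d ℤ.* (t ℤ.* t) ℤ.+ k) ≡ (d ℤ.* t) ℤ.* (d ℤ.* t) ℤ.- ℤ.- (d ℤ.* k)
      square = solve-∀

  inverse : ∀ {q} → Prime q → ∀ y → ¬ + q ℤ.∣ y → ∃[ z ] + q ℤ.∣ y ℤ.* z ℤ.- 1ℤ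
  inverse {q} q-prime y q∤y = case coprime-Bézout cop of λ
    { (Bézout.+- u v eq) → signed (+ u) (ℤ.divides (+ v) (solve₁ u v eq))
    ; (Bézout.-+ u v eq) → signed (ℤ.- + u) (ℤ.divides (ℤ.- + v) (solve₂ u v eq)) }
    where
    m : ℕ
    m = ℤ.∣ y ∣
    q∤m : ¬ + q ℤ.∣ + m
    q∤m d = q∤y (ℤ.∣-trans d ℤ.∣m∣∣m)
    cop : Coprime m q
    cop (i∣m , i∣q) with prime⇒irreducible q-prime i∣q
    ... | inj₁ i≡1 = i≡1
    ... | inj₂ refl = contradiction (+∣+ i∣m) q∤m
    solve₁ : ∀ u v → 1 + v * q ≡ u * m → + m ℤ.* + u ℤ.- 1ℤ ≡ + v ℤ.* + q
    solve₁ u v eq = trans (cong (ℤ._- 1ℤ) (trans (ℤ.*-comm (+ m) (+ u)) (trans (sym (ℤ.pos-* u m)) (trans (cong +_ (sym eq)) (cong (λ x → 1ℤ ℤ.+ x) (ℤ.pos-* v q)))))) (cancel (+ v ℤ.* + q))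
      where
      cancel : ∀ x → 1ℤ ℤ.+ x ℤ.- 1ℤ ≡ x
      cancel = solve-∀
    solve₂ : ∀ u v → 1 + u * m ≡ v * q → + m ℤ.* (ℤ.- + u) ℤ.- 1ℤ ≡ ℤ.- + v ℤ.* + q
    solve₂ u v eq = trans (reshape (+ m) (+ u)) (trans (cong ℤ.-_ (trans (cong (λ x → 1ℤ ℤ.+ x) (sym (ℤ.pos-* u m))) (trans (cong +_ eq) (ℤ.pos-* v q)))) (ℤ.neg-distribˡ-* (+ v) (+ q)))
      where
      reshape : ∀ m u → m ℤ.* (ℤ.- u) ℤ.- 1ℤ ≡ ℤ.- (1ℤ ℤ.+ u ℤ.* m)
      reshape = solve-∀
    signed : ∀ z → + q ℤ.∣ + m ℤ.* z ℤ.- 1ℤ → ∃[ z ] + q ℤ.∣ y ℤ.* z ℤ.- 1ℤ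
    signed z d with ℤ.+∣i∣≡i⊎+∣i∣≡-i y
    ... | inj₁ e = z , subst (λ m → + q ℤ.∣ m ℤ.* z ℤ.- 1ℤ) e d
    ... | inj₂ e = ℤ.- z , ∣-resp (trans (cong (λ m → m ℤ.* z ℤ.- 1ℤ) e) (flip y z)) d
      where
      flip : ∀ y z → ℤ.- y ℤ.* z ℤ.- 1ℤ ≡ y ℤ.* (ℤ.- z) ℤ.- 1ℤ
      flip = solve-∀

  -- If y² ≡ a and x² ≡ a b, then y is invertible and x / y is a root of `b`.
  QR-cancel : ∀ {q} → Prime q → ∀ a b → ¬ + q ℤ.∣ a → QR q a → QR q (a ℤ.* b) → QR q b
  QR-cancel {q} q-prime a b q∤a (root y q∣y²-a) (root x q∣x²-ab) =
    let (z , q∣yz-1) = inverse q-prime y q∤y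
    in root (x ℤ.* z) (∣-resp (combine x y z a b)
        (ℤ.∣m∣n⇒∣m+n (ℤ.∣n⇒∣m*n (z ℤ.* z) q∣x²-ab)
          (ℤ.∣n⇒∣m*n b (ℤ.∣m∣n⇒∣m-n (ℤ.∣m⇒∣m*n (y ℤ.* z ℤ.+ 1ℤ) q∣yz-1) (ℤ.∣n⇒∣m*n (z ℤ.* z) q∣y²-a)))))
    where
    q∤y : ¬ + q ℤ.∣ y
    q∤y q∣y = q∤a (∣-resp (recover (y ℤ.* y) a) (ℤ.∣m∣n⇒∣m-n (ℤ.∣n⇒∣m*n y q∣y) q∣y²-a))
      where
      recover : ∀ x a → x ℤ.- (x ℤ.- a) ≡ a
      recover = solve-∀
    combine : ∀ x y z a b → z ℤ.* z ℤ.* (x ℤ.* x ℤ.- a ℤ.* b) ℤ.+ b ℤ.* ((y ℤ.* z ℤ.- 1ℤ) ℤ.* (y ℤ.* z ℤ.+ 1ℤ) ℤ.- z ℤ.* z ℤ.* (y ℤ.* y ℤ.- a))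
      ≡ x ℤ.* z ℤ.* (x ℤ.* z) ℤ.- b
    combine = solve-∀

  -- Descent: an even root x < k of x² + 1 ≡ 0 gives x² + 1 = k l with l < k and
  -- again l ≡ 3 (mod 4).
  ∤x²+1 : ∀ k → k % 4 ≡ 3 → ∀ x → k ∤ x * x + 1
  ∤x²+1 = <-rec _ go
    where
    go : ∀ k → (∀ {l} → l < k → l % 4 ≡ 3 → ∀ x → l ∤ x * x + 1) → k % 4 ≡ 3 → ∀ x → k ∤ x * x + 1
    go k@(suc k′) rec k%4≡3 x k∣x²+1 = reduce (even-or-odd r)
      where
      r : ℕ
      r = x % k
      r<k : r < k
      r<k = m%n<n x k
      k∣r²+1 : k ∣ r * r + 1
      k∣r²+1 = ∣m+n∣m⇒∣n (subst (k ∣_) (trans (cong (λ x → x * x + 1) (m≡m%n+[m/n]*n x k)) (expand r (x / k) k)) k∣x²+1)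
        (n∣m*n (2 * r * (x / k) + x / k * (x / k) * k))
        where
        expand : ∀ r w k → (r + w * k) * (r + w * k) + 1 ≡ (2 * r * w + w * w * k) * k + (r * r + 1)
        expand = ℕ-Solver.solve-∀
      even-root : ∀ z → 2 * z < k → k ∤ (2 * z) * (2 * z) + 1
      even-root z 2z<k (divides l eq) = rec l<k l%4≡3 (2 * z) (divides k (trans eq (ℕ.*-comm l k)))
        where
        -- From 2 z ≤ k - 1 follows k l ≤ (k - 1)² + 1 < k².
        l<k : l < k
        l<k = ℕ.*-cancelʳ-< k l k (subst (_< k * k) eq
          (ℕ.≤-<-trans (ℕ.+-monoˡ-≤ 1 (ℕ.*-mono-≤ (ℕ.≤-pred 2z<k) (ℕ.≤-pred 2z<k))) (k′²+1<k² k′ k%4≡3)))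
          where
          square : ∀ k → suc k * suc k ≡ 1 + 2 * k + k * k
          square = ℕ-Solver.solve-∀
          k′²+1<k² : ∀ k′ → suc k′ % 4 ≡ 3 → k′ * k′ + 1 < suc k′ * suc k′
          k′²+1<k² (suc k′) _ = subst₂ _<_ (ℕ.+-comm 1 (suc k′ * suc k′)) (sym (square (suc k′)))
            (ℕ.+-monoˡ-< (suc k′ * suc k′) {1} {1 + 2 * suc k′} (ℕ.s≤s ℕ.z<s))
        l%4≡3 : l % 4 ≡ 3
        l%4≡3 = from (l % 4) (m%n<n l 4) (trans (sym (trans (%-distribˡ-* l k 4) (cong (λ y → (l % 4 * y) % 4) k%4≡3)))
          (trans (cong (_% 4) (trans (sym eq) (reshape z))) ([m+kn]%n≡m%n 1 (z * z) 4)))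
          where
          reshape : ∀ z → 2 * z * (2 * z) + 1 ≡ 1 + z * z * 4
          reshape = ℕ-Solver.solve-∀
          from : ∀ y → y < 4 → (y * 3) % 4 ≡ 1 → y ≡ 3
          from 3 _ _ = refl
          from (suc (suc (suc (suc y)))) (ℕ.s≤s (ℕ.s≤s (ℕ.s≤s (ℕ.s≤s ())))) _
      k-odd : ∃[ h ] k ≡ 1 + 2 * h
      k-odd = 1 + 2 * (k / 4) , trans (m≡m%n+[m/n]*n k 4) (trans (cong (_+ k / 4 * 4) k%4≡3) (shift (k / 4)))
        where
        shift : ∀ x → 3 + x * 4 ≡ 1 + 2 * (1 + 2 * x)
        shift = ℕ-Solver.solve-∀
      reduce : (∃[ z ] r ≡ 2 * z) ⊎ (∃[ z ] r ≡ 1 + 2 * z) → ⊥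
      reduce (inj₁ (z , e)) = even-root z (subst (_< k) e r<k) (subst (λ r → k ∣ r * r + 1) e k∣r²+1)
      -- If the remainder `r` is odd, k - r = 1 + o is again a root, and it is even because `k` is
      -- odd.
      reduce (inj₂ (z , e)) with ℕ.m≤n⇒∃[o]m+o≡n r<k | k-odd
      ... | o , 1+r+o≡k | h , k≡1+2h with even-or-odd (suc o)
      ...   | inj₁ (w , o≡2w) = even-root w (subst (_< k) o≡2w 1+o<k)
        (subst (λ o → k ∣ o * o + 1) o≡2w (∣m+n∣m⇒∣n (subst (k ∣_) (trans (cong (λ k → r * r + 1 + k * suc o) (sym r+[1+o]≡k)) (complete r (suc o)))
          (∣m∣n⇒∣m+n k∣r²+1 (m∣m*n (suc o)))) (subst (k ∣_) (cong (_* r) (sym r+[1+o]≡k)) (m∣m*n r))))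
        where
        r+[1+o]≡k : r + suc o ≡ k
        r+[1+o]≡k = trans (ℕ.+-suc r o) 1+r+o≡k
        1+o<k : suc o < k
        1+o<k = subst (suc o <_) r+[1+o]≡k (ℕ.m<n+m (suc o) (subst (0 <_) (sym e) ℕ.z<s))
        complete : ∀ r o → r * r + 1 + (r + o) * o ≡ (r + o) * r + (o * o + 1)
        complete = ℕ-Solver.solve-∀
      ...   | inj₂ (w , o≡1+2w) = contradiction
        (trans (sym (reshape z w)) (trans (cong₂ _+_ (sym e) (sym o≡1+2w)) (trans (trans (ℕ.+-suc r o) 1+r+o≡k) k≡1+2h))) (2m≢1+2n (1 + z + w) h)
        where
        reshape : ∀ z w → 1 + 2 * z + (1 + 2 * w) ≡ 2 * (1 + z + w)
        reshape = ℕ-Solver.solve-∀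

  ¬QR[-1] : ∀ {k} → k % 4 ≡ 3 → ¬ QR k -[1+ 0 ]
  ¬QR[-1] {k} k%4≡3 (root x d) = ∤x²+1 k k%4≡3 ℤ.∣ x ∣ (ℤ.∣⇒∣ᵤ (∣-resp (cong (ℤ._+ 1ℤ) (∣i∣*∣i∣ x)) d))

  -- Wilson's theorem and the residue symbol of 2 for primes 1 modulo 8

  product-applyUpTo-suc : ∀ (f : ℕ → ℕ) n → product (applyUpTo f (suc n)) ≡ product (applyUpTo f n) * f n
  product-applyUpTo-suc f zero    = ℕ.*-comm (f 0) 1
  product-applyUpTo-suc f (suc n) = trans (cong (f 0 *_) (product-applyUpTo-suc (λ i → f (suc i)) n)) (sym (ℕ.*-assoc (f 0) _ _))

  module Residues {q : ℕ} (q-prime : Prime q) where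

    infix 4 _≋_
    -- A record rather than bare divisibility of the difference, so that both sides can be inferred
    -- from the type.
    record _≋_ (x y : ℤ) : Set where
      constructor congruent
      field difference : + q ℤ.∣ x ℤ.- y
    open _≋_

    ≋-refl : ∀ {x} → x ≋ x
    ≋-refl {x} = congruent (ℤ.divides 0ℤ (ℤ.+-inverseʳ x))

    ≋-sym : ∀ {x y} → x ≋ y → y ≋ x
    ≋-sym {x} {y} d = congruent (∣-resp (flip x y) (ℤ.∣m⇒∣-m (difference d)))
      where
      flip : ∀ x y → ℤ.- (x ℤ.- y) ≡ y ℤ.- x
      flip = solve-∀

    ≋-trans : ∀ {x y z} → x ≋ y → y ≋ z → x ≋ z
    ≋-trans {x} {y} {z} d e = congruent (∣-resp (join x y z) (ℤ.∣m∣n⇒∣m+n (difference d) (difference e)))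
      where
      join : ∀ x y z → x ℤ.- y ℤ.+ (y ℤ.- z) ≡ x ℤ.- z
      join = solve-∀

    ≋-* : ∀ {x x′ y y′} → x ≋ x′ → y ≋ y′ → x ℤ.* y ≋ x′ ℤ.* y′
    ≋-* {x} {x′} {y} {y′} d e = congruent (∣-resp (combine x x′ y y′)
      (ℤ.∣m∣n⇒∣m+n (ℤ.∣m⇒∣m*n y (difference d)) (ℤ.∣n⇒∣m*n x′ (difference e))))
      where
      combine : ∀ x x′ y y′ → (x ℤ.- x′) ℤ.* y ℤ.+ x′ ℤ.* (y ℤ.- y′) ≡ x ℤ.* y ℤ.- x′ ℤ.* y′
      combine = solve-∀

    euclid : ∀ x y → + q ℤ.∣ x ℤ.* y → + q ℤ.∣ x ⊎ + q ℤ.∣ y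
    euclid x y d with euclidsLemma ℤ.∣ x ∣ ℤ.∣ y ∣ q-prime (subst (q ∣_) (ℤ.abs-* x y) (ℤ.∣⇒∣ᵤ d))
    ... | inj₁ e = inj₁ (ℤ.∣ᵤ⇒∣ e)
    ... | inj₂ e = inj₂ (ℤ.∣ᵤ⇒∣ e)

    q∤ : ∀ {x} → 0 < x → x < q → ¬ + q ℤ.∣ + x
    q∤ {suc x} _ x<q d = >⇒∤ x<q (ℤ.∣⇒∣ᵤ d)

    ≤-≋⇒≡ : ∀ {x y} → x ≤ y → y < q → + y ≋ + x → x ≡ y
    ≤-≋⇒≡ {x} {y} x≤y y<q d with ℕ.m≤n⇒∃[o]m+o≡n x≤y
    ... | zero  , refl = sym (ℕ.+-identityʳ x)
    ... | suc o , refl = contradiction (∣-resp (cancel (+ x) (+ suc o)) (difference d)) (q∤ ℕ.z<s (ℕ.≤-<-trans (ℕ.m≤n+m (suc o) x) y<q))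
      where
      cancel : ∀ x o → x ℤ.+ o ℤ.- x ≡ o
      cancel = solve-∀

    ≋⇒≡ : ∀ {x y} → x < q → y < q → + x ≋ + y → x ≡ y
    ≋⇒≡ {x} {y} x<q y<q d with ℕ.≤-total x y
    ... | inj₁ x≤y = ≤-≋⇒≡ x≤y y<q (≋-sym d)
    ... | inj₂ y≤x = sym (≤-≋⇒≡ y≤x x<q d)

    Unit : ℕ → Set
    Unit x = 0 < x × x < q

    ≋-cancel : ∀ {x y z} → Unit x → Unit y → Unit z → + x ℤ.* + y ≋ + x ℤ.* + z → y ≡ z
    ≋-cancel {x} {y} {z} (0<x , x<q) (_ , y<q) (_ , z<q) d =
      [ (λ q∣x → contradiction q∣x (q∤ 0<x x<q)) , (λ y≋z → ≋⇒≡ y<q z<q (congruent y≋z)) ]′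
        (euclid (+ x) (+ y ℤ.- + z) (∣-resp (factor (+ x) (+ y) (+ z)) (difference d)))
      where
      factor : ∀ x y z → x ℤ.* y ℤ.- x ℤ.* z ≡ x ℤ.* (y ℤ.- z)
      factor = solve-∀

    Paired : ℤ → List ℕ → Set
    Paired a L = ∀ {x} → x ∈ L → ∃[ y ] y ∈ L × y ≢ x × + x ℤ.* + y ≋ a

    -- Removing the head together with its partner contributes one factor `a`. The rest is still
    -- paired, because cancellation makes partners unique. The number `n` is only a bound for the
    -- recursion.
    pair-product : ∀ a n L → length L ≤ n → All Unit L → Unique L → Paired a L →
      ∃[ k ] length L ≡ 2 * k × + product L ≋ a ℤ.^ k
    pair-product a _ [] _ _ _ _ = 0 , refl , ≋-refl
    pair-product a (suc n) (x ∷ L) (ℕ.s≤s |L|≤n) (ux ∷ us) (x∉L ∷ L!) paired with paired (here refl)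
    ... | y , here y≡x , y≢x , _ = contradiction y≡x y≢x
    ... | y , there y∈L , y≢x , xy≋a with ∈-∃++ y∈L
    ...   | as , bs , refl = 
      let (k , |L′|≡2k , ΠL′≋aᵏ) = pair-product a n L′ (ℕ.≤-trans (ℕ.n≤1+n _) (subst (_≤ n) (↭-length perm) |L|≤n)) us′ L′! paired′
      in suc k , trans (cong suc (↭-length perm)) (trans (cong (λ n → 2 + n) |L′|≡2k) (sym (ℕ.*-suc 2 k))) ,
         subst (_≋ a ℤ.^ suc k) (sym split) (≋-* xy≋a ΠL′≋aᵏ)
      where
      L′ : List ℕ
      L′ = as ++ bs
      perm : as ++ y ∷ bs ↭ y ∷ L′
      perm = ↭-shift y as bs
      yL′! : Unique (y ∷ L′)
      yL′! = Unique-resp-↭ (setoid ℕ) (↭⇒↭ₛ perm) L!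
      L′! : Unique L′
      L′! with yL′!
      ... | _ ∷ u = u
      y∉L′ : All (y ≢_) L′
      y∉L′ with yL′!
      ... | u ∷ _ = u
      L′⊆L : ∀ {z} → z ∈ L′ → z ∈ as ++ y ∷ bs
      L′⊆L z∈L′ = ∈-resp-↭ (↭-sym perm) (there z∈L′)
      us′ : All Unit L′
      us′ = All.tabulate (λ z∈L′ → All.lookup us (L′⊆L z∈L′))
      uy : Unit y
      uy = All.lookup us y∈L
      split : + (x * product (as ++ y ∷ bs)) ≡ + x ℤ.* + y ℤ.* + product L′
      split = trans (ℤ.pos-* x _) (trans (cong (+ x ℤ.*_) (trans (cong +_ (product-↭ perm)) (ℤ.pos-* y (product L′)))) (sym (ℤ.*-assoc (+ x) (+ y) _)))
      paired′ : Paired a L′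
      paired′ {z} z∈L′ with paired (there (L′⊆L z∈L′))
      ... | w , here refl , _ , zx≋a = contradiction (≋-cancel ux uy (All.lookup us′ z∈L′)
            (≋-trans xy≋a (≋-sym (subst (_≋ a) (ℤ.*-comm (+ z) (+ x)) zx≋a)))) (All.lookup y∉L′ z∈L′)
      ... | w , there w∈L , w≢z , zw≋a with ∈-resp-↭ perm w∈L
      ...   | there w∈L′ = w , w∈L′ , w≢z , zw≋a
      ...   | here refl  = contradiction (≋-cancel uy ux (All.lookup us′ z∈L′)
            (≋-trans (subst (_≋ a) (ℤ.*-comm (+ x) (+ y)) xy≋a) (≋-sym (subst (_≋ a) (ℤ.*-comm (+ z) (+ y)) zw≋a)))) (All.lookup x∉L (L′⊆L z∈L′))

    opaque
      partner : ∀ a {x} → Unit x → ∃[ y ] y < q × + x ℤ.* + y ≋ a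
      partner a {x} (0<x , x<q) =
        let (z , q∣xz-1) = inverse q-prime (+ x) (q∤ 0<x x<q)
        in z ℤ.* a %ℕ q , n%ℕd<d (z ℤ.* a) q , congruent (∣-resp
          (trans (cong (λ u → a ℤ.* (+ x ℤ.* z ℤ.- 1ℤ) ℤ.- u)
              (sym (trans (cong (λ w → + x ℤ.* (w ℤ.- + (z ℤ.* a %ℕ q))) (a≡a%ℕn+[a/ℕn]*n (z ℤ.* a) q)) (simplify (+ x) (+ (z ℤ.* a %ℕ q)) ((z ℤ.* a) /ℕ q ℤ.* + q)))))
            (combine (+ x) z a (+ (z ℤ.* a %ℕ q))))
          (ℤ.∣m∣n⇒∣m-n (ℤ.∣n⇒∣m*n a q∣xz-1) (ℤ.∣n⇒∣m*n (+ x) (ℤ.∣n⇒∣m*n ((z ℤ.* a) /ℕ q) ℤ.∣-refl))))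
        where
        instance
          q-nonZero : ℕ.NonZero q
          q-nonZero = prime⇒nonZero q-prime
        simplify : ∀ x r k → x ℤ.* (r ℤ.+ k ℤ.- r) ≡ x ℤ.* k
        simplify = solve-∀
        combine : ∀ x z a y → a ℤ.* (x ℤ.* z ℤ.- 1ℤ) ℤ.- x ℤ.* (z ℤ.* a ℤ.- y) ≡ x ℤ.* y ℤ.- a
        combine = solve-∀

    -- Pair x with a / x on 1, ..., q - 1: an x that is its own partner would be a root of `a`, and
    -- a partner 0 would make 0 a root.
    ¬QR⇒product : ∀ {h} → q ≡ suc h → ∀ a → ¬ QR q a → ∃[ k ] h ≡ 2 * k × + product (applyUpTo suc h) ≋ a ℤ.^ k
    ¬QR⇒product {h} refl a ¬qr =
      let (k , e , d) = pair-product a _ (applyUpTo suc h) ℕ.≤-refl units unique paired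
      in k , trans (sym (length-applyUpTo suc h)) e , d
      where
      unit : ∀ {x} → x ∈ applyUpTo suc h → Unit x
      unit x∈ with ∈-applyUpTo⁻ suc x∈
      ... | i , i<h , refl = ℕ.z<s , ℕ.s≤s i<h
      units : All Unit (applyUpTo suc h)
      units = All.tabulate unit
      unique : Unique (applyUpTo suc h)
      unique = applyUpTo⁺₁ suc h (λ i<j _ e → ℕ.<⇒≢ i<j (ℕ.suc-injective e))
      paired : Paired a (applyUpTo suc h)
      paired {x} x∈ with partner a (unit x∈)
      ... | zero , _ , d = contradiction (root 0ℤ (∣-resp (cong (ℤ._- a) (ℤ.*-zeroʳ (+ x))) (difference d))) ¬qr
      ... | suc y , ℕ.s≤s y<h , d = suc y , ∈-applyUpTo⁺ suc y<h , (λ { refl → ¬qr (root (+ suc y) (difference d)) }) , d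

    -- The numbers 2, ..., q - 2 pair off with their inverses; what remains is 1 and q - 1 ≡ -1.
    wilson : ∀ {n} → q ≡ suc n → 1 < n → + product (applyUpTo suc n) ≋ -[1+ 0 ]
    wilson {suc zero}    refl (ℕ.s≤s ())
    wilson {suc (suc h)} refl _ =
      let (k , _ , d) = pair-product 1ℤ _ L ℕ.≤-refl (All.tabulate unit) unique paired
      in subst (_≋ -[1+ 0 ]) (sym (trans (cong +_ (trans (ℕ.*-identityˡ _) (product-applyUpTo-suc (λ n → 2 + n) h))) (ℤ.pos-* (product L) (2 + h))))
          (≋-* (≋-trans d (subst (_≋ 1ℤ) (sym (ℤ.^-zeroˡ k)) ≋-refl))
            (congruent (ℤ.divides 1ℤ (trans (cong +_ (ℕ.+-comm (2 + h) 1)) (sym (ℤ.*-identityˡ _))))))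
      where
      L : List ℕ
      L = applyUpTo (λ n → 2 + n) h
      unit : ∀ {x} → x ∈ L → Unit x
      unit x∈ with ∈-applyUpTo⁻ (λ n → 2 + n) x∈
      ... | i , i<h , refl = ℕ.z<s , ℕ.s≤s (ℕ.s≤s (ℕ.m≤n⇒m≤1+n i<h))
      unique : Unique L
      unique = applyUpTo⁺₁ (λ n → 2 + n) h (λ i<j _ e → ℕ.<⇒≢ i<j (ℕ.+-cancelˡ-≡ 2 _ _ e))
      paired : Paired 1ℤ L
      paired {x} x∈ with ∈-applyUpTo⁻ (λ n → 2 + n) x∈
      ... | i , i<h , refl with partner 1ℤ (unit x∈)
      ...   | zero , _ , d = contradiction (∣-resp (cong (λ z → ℤ.- (z ℤ.- 1ℤ)) (ℤ.*-zeroʳ (+ (2 + i)))) (ℤ.∣m⇒∣-m (difference d))) (q∤ ℕ.z<s (ℕ.s≤s ℕ.z<s))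
      ...   | suc zero , _ , d = contradiction (∣-resp (cong (ℤ._- 1ℤ) (ℤ.*-identityʳ (+ (2 + i)))) (difference d)) (q∤ ℕ.z<s (ℕ.s≤s (ℕ.m≤n⇒m≤1+n (ℕ.m≤n⇒m≤1+n i<h))))
      ...   | suc (suc y) , y<q , d with y ℕ.<? h
      ...     | yes y<h = 2 + y , ∈-applyUpTo⁺ (λ n → 2 + n) y<h , y≢i , d
        where
        y≢i : 2 + y ≢ 2 + i
        -- x² ≡ 1 with x = 2 + i would make `q` divide x - 1 or x + 1.
        y≢i refl = [ q∤ ℕ.z<s (ℕ.s≤s (ℕ.m≤n⇒m≤1+n (ℕ.m≤n⇒m≤1+n i<h))) , q∤ ℕ.z<s (ℕ.+-monoʳ-< 3 i<h) ]′
          (euclid (+ (1 + i)) (+ (3 + i)) (∣-resp (factor (+ i)) (difference d)))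
          where
          factor : ∀ i → (+ 2 ℤ.+ i) ℤ.* (+ 2 ℤ.+ i) ℤ.- 1ℤ ≡ (1ℤ ℤ.+ i) ℤ.* (+ 3 ℤ.+ i)
          factor = solve-∀
      -- The only candidate left is the partner q - 1 ≡ -1, which would force x ≡ -1.
      ...     | no  y≮h = contradiction q∣3+i (q∤ ℕ.z<s (ℕ.+-monoʳ-< 3 i<h))
        where
        y≡h : y ≡ h
        y≡h = ℕ.≤-antisym (ℕ.+-cancelˡ-≤ 3 y h y<q) (ℕ.≮⇒≥ y≮h)
        q∣3+i : + q ℤ.∣ + (3 + i)
        q∣3+i = ∣-resp (combine (+ i) (+ h)) (ℤ.∣m∣n⇒∣m-n (ℤ.∣n⇒∣m*n (+ (2 + i)) ℤ.∣-refl) (subst (λ y → + q ℤ.∣ + (2 + i) ℤ.* + (2 + y) ℤ.- 1ℤ) y≡h (difference d)))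
          where
          combine : ∀ i h → (+ 2 ℤ.+ i) ℤ.* (+ 3 ℤ.+ h) ℤ.- ((+ 2 ℤ.+ i) ℤ.* (+ 2 ℤ.+ h) ℤ.- 1ℤ) ≡ + 3 ℤ.+ i
          combine = solve-∀

    -- If i² ≡ -1 were solved by a nonresidue i, pairing x with i / x would give
    -- (q - 1)! ≡ i^((q-1)/2) ≡ 1, against Wilson; and i ≡ x² makes ((1 - i) x)² ≡ 2.
    QR[-1]⇒¬¬QR[2] : q % 8 ≡ 1 → QR q -[1+ 0 ] → ¬ ¬ QR q (+ 2)
    QR[-1]⇒¬¬QR[2] q%8≡1 (root i i²≋-1) ¬qr2 = contra (q / 8) (trans (m≡m%n+[m/n]*n q 8) (cong (_+ q / 8 * 8) q%8≡1))
      where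
      ¬qri : ¬ QR q i
      ¬qri (root x x²≋i) = ¬qr2 (root ((1ℤ ℤ.- i) ℤ.* x) (∣-resp (combine i x)
        (ℤ.∣m∣n⇒∣m+n (ℤ.∣n⇒∣m*n ((1ℤ ℤ.- i) ℤ.* (1ℤ ℤ.- i)) x²≋i) (ℤ.∣m⇒∣m*n (i ℤ.- + 2) i²≋-1))))
        where
        combine : ∀ i x → (1ℤ ℤ.- i) ℤ.* (1ℤ ℤ.- i) ℤ.* (x ℤ.* x ℤ.- i) ℤ.+ (i ℤ.* i ℤ.- -[1+ 0 ]) ℤ.* (i ℤ.- + 2)
          ≡ (1ℤ ℤ.- i) ℤ.* x ℤ.* ((1ℤ ℤ.- i) ℤ.* x) ℤ.- + 2
        combine = solve-∀
      i²≋-1′ : i ℤ.* i ≋ -[1+ 0 ]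
      i²≋-1′ = congruent i²≋-1
      i⁴ᵏ≋1 : ∀ k → i ℤ.^ (4 * k) ≋ 1ℤ
      i⁴ᵏ≋1 zero    = ≋-refl
      i⁴ᵏ≋1 (suc k) = subst (λ e → i ℤ.^ e ≋ 1ℤ) (sym (ℕ.*-suc 4 k))
        (subst (_≋ 1ℤ) (sym (assoc i (i ℤ.^ (4 * k)))) (≋-* (≋-* i²≋-1′ i²≋-1′) (i⁴ᵏ≋1 k)))
        where
        assoc : ∀ i z → i ℤ.* (i ℤ.* (i ℤ.* (i ℤ.* z))) ≡ i ℤ.* i ℤ.* (i ℤ.* i) ℤ.* z
        assoc = solve-∀
      contra : ∀ c → q ≡ 1 + c * 8 → ⊥
      contra zero    q≡1    = ¬prime[1] (subst Prime q≡1 q-prime)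
      contra (suc c) q≡9+8c = go (suc c * 8) q≡9+8c (ℕ.s≤s (ℕ.s≤s ℕ.z≤n)) refl
        where
        reshape : ∀ c → c * 8 ≡ 2 * (4 * c)
        reshape = ℕ-Solver.solve-∀
        go : ∀ n → q ≡ suc n → 1 < n → n ≡ suc c * 8 → ⊥
        go n q≡1+n 1<n n≡8c =
          let (k , e , d) = ¬QR⇒product q≡1+n i ¬qri
              k≡4c = ℕ.*-cancelˡ-≡ k (4 * suc c) 2 (trans (sym e) (trans n≡8c (reshape (suc c))))
              1≋iᵏ = ≋-sym (subst (λ k → i ℤ.^ k ≋ 1ℤ) (sym k≡4c) (i⁴ᵏ≋1 (suc c)))
              iᵏ≋-1 = ≋-trans (≋-sym d) (wilson q≡1+n 1<n)
          -- The exponent (q - 1) / 2 is a multiple of 4 as q ≡ 1 modulo 8, so 1 ≡ -1 and `q` would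
          -- divide 2.
          in q∤ {2} ℕ.z<s (subst (2 <_) (sym q≡1+n) (ℕ.s≤s 1<n)) (difference (≋-trans 1≋iᵏ iᵏ≋-1))

  -- The equation m s² = t² + 2 in the three cases

  prime>1 : ∀ {p} → Prime p → 1 < p
  prime>1 p-prime = ℕ.nonTrivial⇒n>1 _ ⦃ prime⇒nonTrivial p-prime ⦄

  prime∣prime : ∀ {p q} → Prime p → Prime q → p ∣ q → p ≡ q
  prime∣prime p-prime q-prime p∣q with prime⇒irreducible q-prime p∣q
  ... | inj₁ refl = contradiction p-prime ¬prime[1]
  ... | inj₂ p≡q  = p≡q

  prime-nonsquare : ∀ {p} → Prime p → ∀ x → x * x ≢ p
  prime-nonsquare p-prime x refl with prime⇒irreducible p-prime {x} (m∣m*n {x} x)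
  ... | inj₁ refl = ¬prime[1] p-prime
  ... | inj₂ x≡x² = ¬prime[1] (subst Prime (trans (sym x≡x²) x≡1) p-prime)
    where
    instance
      x-nonZero : ℕ.NonZero x
      x-nonZero = ℕ.m*n≢0⇒m≢0 x ⦃ prime⇒nonZero p-prime ⦄
    x≡1 : x ≡ 1
    x≡1 = ℕ.*-cancelˡ-≡ x 1 x (trans (sym x≡x²) (sym (ℕ.*-identityʳ x)))

  semiprime-nonsquare : ∀ {p q} → Prime p → Prime q → p ≢ q → ∀ x → x * x ≢ p * q
  semiprime-nonsquare {p} {q} p-prime q-prime p≢q x e with [ (λ d → d) , (λ d → d) ]′ (euclidsLemma x x p-prime (subst (p ∣_) (sym e) (m∣m*n q)))
  ... | divides w refl = p≢q (prime∣prime p-prime q-prime (divides (w * w)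
    (ℕ.*-cancelˡ-≡ q (w * w * p) p ⦃ prime⇒nonZero p-prime ⦄ (trans (sym e) (reshape w p)))))
    where
    reshape : ∀ w p → w * p * (w * p) ≡ p * (w * w * p)
    reshape = ℕ-Solver.solve-∀

  nonsquare-3mod8 : ∀ {n} → n % 8 ≡ 3 → ∀ x → x * x ≢ n
  nonsquare-3mod8 {n} n%8≡3 x e = impossible8 0 1 3 {d = n / 8 * 8} {e = 1} (m*n%n≡0 (n / 8) 8) refl (solved x 1
    (trans (ℕ.*-identityˡ (x * x)) (trans e (trans (m≡m%n+[m/n]*n n 8) (trans (cong (_+ n / 8 * 8) n%8≡3)
      (trans (ℕ.+-comm 3 (n / 8 * 8)) (cong (_+ 3) (sym (ℕ.*-identityʳ (n / 8 * 8))))))))))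

  %8⇒%4 : ∀ {n k} → n % 8 ≡ k → n % 4 ≡ k % 4
  %8⇒%4 {n} refl = sym (m∣n⇒o%n%m≡o%m 4 8 n (divides 2 refl))

  ∤-small : ∀ {q n} → 0 < n → n < q → ¬ + q ℤ.∣ + n
  ∤-small {n = suc n} _ n<q d = >⇒∤ n<q (ℤ.∣⇒∣ᵤ d)

  ∤-prime : ∀ {p q} → Prime p → Prime q → p ≢ q → ¬ + p ℤ.∣ + q
  ∤-prime p-prime q-prime p≢q d = p≢q (prime∣prime p-prime q-prime (ℤ.∣⇒∣ᵤ d))

  ∤-1 : ∀ {q} → 1 < q → ¬ + q ℤ.∣ -[1+ 0 ]
  ∤-1 1<q d = ∤-small ℕ.z<s 1<q (ℤ.∣m⇒∣-m d)

  Equation-resp : ∀ {d d′ e e′ k} → d ≡ d′ → e ≡ e′ → Equation d e k → Equation d′ e′ k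
  Equation-resp refl refl eq = eq

  descent′ : ∀ {ps} → All Prime ps → ∀ ρ → product ps % 8 ≡ 1 + 2 * ρ → 1 < product ps → (∀ x → x * x ≢ product ps) → Descended ps
  descent′ {ps} primes ρ e = let (h , odd) = odd8 {product ps} ρ e in descent primes {h} odd

  p*1*k≡p*k : ∀ p (k : ℤ) → + (p * 1) ℤ.* k ≡ + p ℤ.* k
  p*1*k≡p*k p k = cong (λ p → + p ℤ.* k) (ℕ.*-identityʳ p)

  -- Modulo 8 neither p s² = t² + 1 nor s² = p t² + 2 is solvable.
  case-I : ∀ {p} → Prime p → p % 8 ≡ 3 → Equation 1 p 2
  case-I {p} p-prime p%8≡3 with descent′ (p-prime ∷ []) 1 p*1%8≡3 (subst (1 <_) (sym (ℕ.*-identityʳ p)) (prime>1 p-prime)) (nonsquare-3mod8 p*1%8≡3)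
    where
    p*1%8≡3 : (p * 1) % 8 ≡ 3
    p*1%8≡3 = *-%8 p 1 p%8≡3 refl
  ... | _ , _ , left  [] , inj₁ (e≢1 , _) = contradiction refl e≢1
  ... | _ , _ , right [] , inj₁ (_ , eq)  = contradiction eq (impossible8 1 3 1 refl (*-%8 p 1 p%8≡3 refl))
  ... | _ , _ , left  [] , inj₂ eq = contradiction eq (impossible8 3 1 2 (*-%8 p 1 p%8≡3 refl) refl)
  ... | _ , _ , right [] , inj₂ eq = Equation-resp refl (ℕ.*-identityʳ p) eq

  -- The solution of p s² = t² + 2 makes -2 a residue; were 2 one as well, -1 would be.
  ¬QR[2] : ∀ {p} → Prime p → p % 8 ≡ 3 → ¬ QR p (+ 2)
  ¬QR[2] {p} p-prime p%8≡3 qr2 = ¬QR[-1] (%8⇒%4 {p} p%8≡3)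
    (QR-cancel p-prime (+ 2) -[1+ 0 ] (∤-small ℕ.z<s 2<p) qr2 (∣e⇒QR (case-I p-prime p%8≡3) ∣-refl))
    where
    2<p : 2 < p
    2<p = ℕ.≤∧≢⇒< (prime>1 p-prime) (λ { refl → contradiction p%8≡3 λ () })

  -- The only outcome that survives modulo 8 is q s² = t² + 1, which exhibits the root.
  QR[-1] : ∀ {q} → Prime q → q % 8 ≡ 1 → QR q -[1+ 0 ]
  QR[-1] {q} q-prime q%8≡1 with descent′ (q-prime ∷ []) 0 (*-%8 q 1 q%8≡1 refl) (subst (1 <_) (sym (ℕ.*-identityʳ q)) (prime>1 q-prime))
    (λ x e → prime-nonsquare q-prime x (trans e (ℕ.*-identityʳ q)))
  ... | _ , _ , left  [] , inj₁ (e≢1 , _) = contradiction refl e≢1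
  ... | _ , _ , right [] , inj₁ (_ , eq)  = ∣e⇒QR eq (m∣m*n 1)
  ... | _ , _ , left  [] , inj₂ eq = contradiction eq (impossible8 1 1 2 (*-%8 q 1 q%8≡1 refl) refl)
  ... | _ , _ , right [] , inj₂ eq = contradiction eq (impossible8 1 1 2 refl (*-%8 q 1 q%8≡1 refl))

  opaque
    -- For N = p r the value 2 is impossible modulo 8, and p r s² = t² + 1 would make -1 a residue
    -- modulo p. In what remains p and r stand on different sides, and one is a residue modulo the
    -- other.
    reciprocity : ∀ {p r} → Prime p → Prime r → p ≢ r → p % 8 ≡ 3 → r % 8 ≡ 3 → QR r (+ p) ⊎ QR p (+ r)
    reciprocity {p} {r} p-prime r-prime p≢r p%8≡3 r%8≡3 with descent′ (p-prime ∷ r-prime ∷ []) 0 pr%8≡1 (subst (1 <_) (sym pr) (ℕ.*-mono-< (prime>1 p-prime) (prime>1 r-prime)))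
      (λ x e → semiprime-nonsquare p-prime r-prime p≢r x (trans e pr))
      where
      pr : p * (r * 1) ≡ p * r
      pr = cong (p *_) (ℕ.*-identityʳ r)
      pr%8≡1 : (p * (r * 1)) % 8 ≡ 1
      pr%8≡1 = *-%8 p (r * 1) p%8≡3 (*-%8 r 1 r%8≡3 refl)
    ... | _ , _ , left  (left  []) , inj₁ (e≢1 , _) = contradiction refl e≢1
    ... | _ , _ , left  (right []) , inj₁ (_ , eq)  = inj₂ (subst (QR p) (trans (p*1*k≡p*k r 1ℤ) (ℤ.*-identityʳ (+ r))) (∣d⇒QR eq (m∣m*n 1)))
    ... | _ , _ , right (left  []) , inj₁ (_ , eq)  = inj₁ (subst (QR r) (trans (p*1*k≡p*k p 1ℤ) (ℤ.*-identityʳ (+ p))) (∣d⇒QR eq (m∣m*n 1)))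
    ... | _ , _ , right (right []) , inj₁ (_ , eq)  = contradiction (∣e⇒QR eq (m∣m*n {p} (r * 1))) (¬QR[-1] {p} (%8⇒%4 {p} p%8≡3))
    ... | _ , _ , left  (left  []) , inj₂ eq = contradiction eq (impossible8 1 1 2 (*-%8 p (r * 1) p%8≡3 (*-%8 r 1 r%8≡3 refl)) refl)
    ... | _ , _ , left  (right []) , inj₂ eq = contradiction eq (impossible8 3 3 2 (*-%8 p 1 p%8≡3 refl) (*-%8 r 1 r%8≡3 refl))
    ... | _ , _ , right (left  []) , inj₂ eq = contradiction eq (impossible8 3 3 2 (*-%8 r 1 r%8≡3 refl) (*-%8 p 1 p%8≡3 refl))
    ... | _ , _ , right (right []) , inj₂ eq = contradiction eq (impossible8 1 1 2 refl (*-%8 p (r * 1) p%8≡3 (*-%8 r 1 r%8≡3 refl)))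

  case-II : ∀ {p q} → Prime p → Prime q → p ≢ q → p % 8 ≡ 3 → q % 8 ≡ 1 → ¬ QR q (+ p) → Equation 1 (p * q) 2
  case-II {p} {q} p-prime q-prime p≢q p%8≡3 q%8≡1 ¬qr with descent′ (p-prime ∷ q-prime ∷ []) 1 pq%8≡3 (subst (1 <_) (sym pq) (ℕ.*-mono-< (prime>1 p-prime) (prime>1 q-prime)))
    (nonsquare-3mod8 pq%8≡3)
    where
    pq : p * (q * 1) ≡ p * q
    pq = cong (p *_) (ℕ.*-identityʳ q)
    pq%8≡3 : (p * (q * 1)) % 8 ≡ 3
    pq%8≡3 = *-%8 p (q * 1) p%8≡3 (*-%8 q 1 q%8≡1 refl)
  ... | _ , _ , left  (left  []) , inj₁ (e≢1 , _) = contradiction refl e≢1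
  ... | _ , _ , left  (right []) , inj₁ (_ , eq)  = contradiction
    (QR-cancel q-prime -[1+ 0 ] (+ p) (∤-1 (prime>1 q-prime)) (QR[-1] q-prime q%8≡1)
      (subst (QR q) (trans (cong ℤ.-_ (trans (p*1*k≡p*k p 1ℤ) (ℤ.*-identityʳ (+ p)))) (sym (ℤ.-1*i≡-i (+ p)))) (∣e⇒QR eq (m∣m*n 1)))) ¬qr
  ... | _ , _ , right (left  []) , inj₁ (_ , eq)  = contradiction (subst (QR q) (trans (p*1*k≡p*k p 1ℤ) (ℤ.*-identityʳ (+ p))) (∣d⇒QR eq (m∣m*n 1))) ¬qr
  ... | _ , _ , right (right []) , inj₁ (_ , eq)  = contradiction eq (impossible8 1 3 1 refl (*-%8 p (q * 1) p%8≡3 (*-%8 q 1 q%8≡1 refl)))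
  ... | _ , _ , left  (left  []) , inj₂ eq = contradiction eq (impossible8 3 1 2 (*-%8 p (q * 1) p%8≡3 (*-%8 q 1 q%8≡1 refl)) refl)
  ... | _ , _ , left  (right []) , inj₂ eq = contradiction eq (impossible8 3 1 2 (*-%8 p 1 p%8≡3 refl) (*-%8 q 1 q%8≡1 refl))
  -- p s² = q t² + 2 is solvable modulo 8, so the residue symbol of 2 modulo q has to exclude it: 2
  -- p is a residue, hence p would be. A doubly negated root of 2 suffices for this contradiction.
  ... | _ , _ , right (left  []) , inj₂ eq = contradiction
    (λ qr2 → ¬qr (QR-cancel q-prime (+ 2) (+ p) (∤-small ℕ.z<s 2<q) qr2
      (subst (QR q) (trans (p*1*k≡p*k p (+ 2)) (ℤ.*-comm (+ p) (+ 2))) (∣d⇒QR eq (m∣m*n 1)))))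
    (Residues.QR[-1]⇒¬¬QR[2] q-prime q%8≡1 (QR[-1] q-prime q%8≡1))
    where
    2<q : 2 < q
    2<q = ℕ.≤∧≢⇒< (prime>1 q-prime) (λ { refl → contradiction q%8≡1 λ () })
  ... | _ , _ , right (right []) , inj₂ eq = Equation-resp refl (cong (p *_) (ℕ.*-identityʳ q)) eq

  module _ {p r : ℕ} (p-prime : Prime p) (r-prime : Prime r) (p≢r : p ≢ r) (p%8≡3 : p % 8 ≡ 3) (r%8≡3 : r % 8 ≡ 3) (¬qr : ¬ QR p (+ r)) where

    -- As r is not a residue modulo p, reciprocity makes p one modulo r, and multiplying by a
    -- residue preserves nonresidues.
    ¬QR-* : ∀ b → ¬ QR r b → ¬ QR r (+ p ℤ.* b)
    ¬QR-* b ¬qrb qrpb with reciprocity p-prime r-prime p≢r p%8≡3 r%8≡3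
    ... | inj₁ qr = ¬qrb (QR-cancel r-prime (+ p) b (∤-prime r-prime p-prime (p≢r ∘ sym)) qr qrpb)
    ... | inj₂ qr = ¬qr qr

  -- By reciprocity the cyclic hypothesis makes p a residue modulo r, q modulo p and r modulo q. For
  -- the value 1, `e` with one or three primes fails modulo 8, and e = p q would make residue times
  -- nonresidue a residue modulo r. For the value 2, `e` with no or two primes fails modulo 8, and e
  -- = p would make 2 p a residue modulo r. The other choices follow by cyclic symmetry.
  case-III : ∀ {p q r} → Prime p → Prime q → Prime r → p ≢ q → q ≢ r → r ≢ p → p % 8 ≡ 3 → q % 8 ≡ 3 → r % 8 ≡ 3 →
    ¬ QR q (+ p) → ¬ QR r (+ q) → ¬ QR p (+ r) → Equation 1 (p * q * r) 2
  case-III {p} {q} {r} p-prime q-prime r-prime p≢q q≢r r≢p p%8 q%8 r%8 ¬qp ¬rq ¬pr =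
    let (d , e , split , eq) = descent′ (p-prime ∷ q-prime ∷ r-prime ∷ []) 1 pqr%8≡3
          (subst (1 <_) (sym pqr) (ℕ.*-mono-< (ℕ.*-mono-< (prime>1 p-prime) (prime>1 q-prime)) (prime>1 r-prime)))
          (nonsquare-3mod8 pqr%8≡3)
    in cases split eq
    where
    pqr : p * (q * (r * 1)) ≡ p * q * r
    pqr = trans (cong (λ r → p * (q * r)) (ℕ.*-identityʳ r)) (sym (ℕ.*-assoc p q r))
    %₁ : ∀ n → n % 8 ≡ 3 → (n * 1) % 8 ≡ 3
    %₁ n n%8 = *-%8 n 1 n%8 refl
    %₂ : ∀ m n → m % 8 ≡ 3 → n % 8 ≡ 3 → (m * (n * 1)) % 8 ≡ 1
    %₂ m n m%8 n%8 = *-%8 m (n * 1) m%8 (%₁ n n%8)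
    pqr%8≡3 : (p * (q * (r * 1))) % 8 ≡ 3
    pqr%8≡3 = *-%8 p (q * (r * 1)) p%8 (%₂ q r q%8 r%8)
    ¬r[p·] : ∀ b → ¬ QR r b → ¬ QR r (+ p ℤ.* b)
    ¬r[p·] = ¬QR-* p-prime r-prime (r≢p ∘ sym) p%8 r%8 ¬pr
    ¬p[q·] : ∀ b → ¬ QR p b → ¬ QR p (+ q ℤ.* b)
    ¬p[q·] = ¬QR-* q-prime p-prime (p≢q ∘ sym) q%8 p%8 ¬qp
    ¬q[r·] : ∀ b → ¬ QR q b → ¬ QR q (+ r ℤ.* b)
    ¬q[r·] = ¬QR-* r-prime q-prime (q≢r ∘ sym) r%8 q%8 ¬rq
    two : ∀ m n → + (m * (n * 1)) ℤ.* 1ℤ ≡ + m ℤ.* + n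
    two m n = trans (ℤ.*-identityʳ _) (trans (cong (λ n → + (m * n)) (ℕ.*-identityʳ n)) (ℤ.pos-* m n))
    cases : ∀ {d e} → Split (p ∷ q ∷ r ∷ []) d e → (e ≢ 1 × Equation d e 1) ⊎ Equation d e 2 → Equation 1 (p * q * r) 2
    cases (left  (left  (left  []))) (inj₁ (e≢1 , _)) = contradiction refl e≢1
    cases (right (left  (left  []))) (inj₁ (_ , eq)) = contradiction eq (impossible8 1 3 1 (%₂ q r q%8 r%8) (%₁ p p%8))
    cases (left  (right (left  []))) (inj₁ (_ , eq)) = contradiction eq (impossible8 1 3 1 (%₂ p r p%8 r%8) (%₁ q q%8))
    cases (left  (left  (right []))) (inj₁ (_ , eq)) = contradiction eq (impossible8 1 3 1 (%₂ p q p%8 q%8) (%₁ r r%8))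
    cases (right (right (left  []))) (inj₁ (_ , eq)) = contradiction (subst (QR r) (two p q) (∣d⇒QR eq (m∣m*n 1))) (¬r[p·] (+ q) ¬rq)
    cases (left  (right (right []))) (inj₁ (_ , eq)) = contradiction (subst (QR p) (two q r) (∣d⇒QR eq (m∣m*n 1))) (¬p[q·] (+ r) ¬pr)
    cases (right (left  (right []))) (inj₁ (_ , eq)) = contradiction (subst (QR q) (trans (two p r) (ℤ.*-comm (+ p) (+ r))) (∣d⇒QR eq (m∣m*n 1))) (¬q[r·] (+ p) ¬qp)
    cases (right (right (right []))) (inj₁ (_ , eq)) = contradiction eq (impossible8 1 3 1 refl pqr%8≡3)
    cases (left  (left  (left  []))) (inj₂ eq) = contradiction eq (impossible8 3 1 2 pqr%8≡3 refl)
    cases (right (left  (left  []))) (inj₂ eq) = contradiction (subst (QR r) (p*1*k≡p*k p (+ 2)) (∣d⇒QR eq (∣-trans (m∣m*n 1) (n∣m*n q)))) (¬r[p·] (+ 2) (¬QR[2] r-prime r%8))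
    cases (left  (right (left  []))) (inj₂ eq) = contradiction (subst (QR p) (p*1*k≡p*k q (+ 2)) (∣d⇒QR eq (m∣m*n (r * 1)))) (¬p[q·] (+ 2) (¬QR[2] p-prime p%8))
    cases (left  (left  (right []))) (inj₂ eq) = contradiction (subst (QR q) (p*1*k≡p*k r (+ 2)) (∣d⇒QR eq (∣-trans (m∣m*n 1) (n∣m*n p)))) (¬q[r·] (+ 2) (¬QR[2] q-prime q%8))
    cases (right (right (left  []))) (inj₂ eq) = contradiction eq (impossible8 3 1 2 (%₁ r r%8) (%₂ p q p%8 q%8))
    cases (left  (right (right []))) (inj₂ eq) = contradiction eq (impossible8 3 1 2 (%₁ p p%8) (%₂ q r q%8 r%8))
    cases (right (left  (right []))) (inj₂ eq) = contradiction eq (impossible8 3 1 2 (%₁ q q%8) (%₂ p r p%8 r%8))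
    cases (right (right (right []))) (inj₂ eq) = Equation-resp refl pqr eq

  -- If `s` or `t` were even, its factor 4 could be moved into the coefficient, where the equation
  -- fails modulo 8.
  odd-solution : ∀ {m} → m % 8 ≡ 3 → Equation 1 m 2 →
    ∃[ a ] ∃[ b ] (1 + 2 * a) * (1 + 2 * a) + 2 ≡ m * ((1 + 2 * b) * (1 + 2 * b))
  odd-solution {m} m%8≡3 (solved s t eq) with even-or-odd s | even-or-odd t
  ... | inj₁ (b , refl) | _ = contradiction (solved b t (trans (reshape m b) eq)) (impossible8 1 4 2 {d = 1} {e = m * 4} refl (*-%8 m 4 m%8≡3 refl))
    where
    reshape : ∀ m b → m * 4 * (b * b) ≡ m * (2 * b * (2 * b))
    reshape = ℕ-Solver.solve-∀
  ... | inj₂ (b , refl) | inj₁ (a , refl) = contradiction (solved (1 + 2 * b) a (trans eq (reshape a))) (impossible8 4 3 2 {d = 4} {e = m} refl m%8≡3)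
    where
    reshape : ∀ a → 1 * (2 * a * (2 * a)) + 2 ≡ 4 * (a * a) + 2
    reshape = ℕ-Solver.solve-∀
  ... | inj₂ (b , refl) | inj₂ (a , refl) = a , b , trans (cong (_+ 2) (sym (ℕ.*-identityˡ ((1 + 2 * a) * (1 + 2 * a))))) (sym eq)

module NumberFields where

  open Arithmetic using (even-or-odd; ∣i∣*∣i∣)
  open import Algebra.Apartness.Bundles using (HeytingField; module HeytingCommutativeRing)
  open import Algebra.Bundles using (CommutativeRing; module CommutativeRing; module Semiring)
  import Algebra.Definitions.RawSemiring as RawSemiringDefinitions
  import Algebra.Properties.Ring
  import Algebra.Properties.Semiring.Mult
  import Algebra.Properties.Semiring.Sum
  import Algebra.Solver.Ring
  open import Algebra.Solver.Ring.AlmostCommutativeRing using (_-Raw-AlmostCommutative⟶_; fromCommutativeRing)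
  open import Data.Empty using (⊥)
  open import Data.Fin.Base as Fin using (Fin; punchIn; suc; toℕ; zero)
  import Data.Fin.Properties as Fin
  open import Data.Integer.Base as ℤ using (+_; -[1+_]; 0ℤ; 1ℤ; ℤ)
  import Data.Integer.Properties as ℤ
  open import Data.Integer.Tactic.RingSolver using (solve-∀)
  import Data.Maybe.Base as Maybe
  open import Data.Maybe.Base as Maybe using (Maybe)
  open import Data.Nat.Base as ℕ using (suc; zero; ℕ)
  open import Data.Nat.Induction using (<-rec)
  import Data.Nat.Properties as ℕ
  import Data.Nat.Tactic.RingSolver as ℕ-Solver
  open import Data.Product.Base using (_,_; _×_; proj₁; proj₂; Σ-syntax; ∃-syntax)
  import Data.Sign.Base as Sign
  open import Data.Sum.Base using (_⊎_; inj₁; inj₂)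
  open import Data.Vec.Functional using ([]; _∷_; Vector)
  open import Function.Base using (_∘_)
  open import Level using (_⊔_; Level)
  open import Relation.Binary.PropositionalEquality.Core as ≡ using (_≡_; _≢_)
  import Relation.Binary.Reasoning.Setoid
  open import Relation.Nullary using (contradiction; no; yes; ¬_)
  open import Relation.Nullary.Decidable using (dec⇒maybe)

  -- The integers inside the field, as coefficients for the ring solver

  module Integers {c ℓ₁ ℓ₂ : Level} (K : HeytingField c ℓ₁ ℓ₂) where

    open HeytingField K public using (heytingCommutativeRing; #-irrefl; #⇒invertible)
    commRing : CommutativeRing c ℓ₁
    commRing = HeytingCommutativeRing.commutativeRing heytingCommutativeRing
    open CommutativeRing commRing public hiding (zero)
    open RawSemiringDefinitions (Semiring.rawSemiring semiring) public using (_^_; sum) renaming (_×_ to _×ᴷ_)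
    open Algebra.Properties.Semiring.Mult semiring using (×-homo-+; ×1-homo-*)
    open Algebra.Properties.Ring ring public using (-0#≈0#; -‿involutive; -‿distribˡ-*; -‿distribʳ-*; -‿+-comm)
    open Relation.Binary.Reasoning.Setoid setoid public

    ι : ℤ → Carrier
    ι = fromℤ K

    ι-neg : ∀ i → ι (ℤ.- i) ≈ - ι i
    ι-neg (+ zero)  = sym -0#≈0#
    ι-neg (+ suc n) = refl
    ι-neg -[1+ n ]  = sym (-‿involutive _)

    ι-⊖ : ∀ m n → ι (m ℤ.⊖ n) ≈ fromℕ K m + - fromℕ K n
    ι-⊖ zero    zero    = sym (-‿inverseʳ 0#)
    ι-⊖ zero    (suc n) = sym (+-identityˡ _)
    ι-⊖ (suc m) zero    = sym (trans (+-congˡ -0#≈0#) (+-identityʳ _))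
    ι-⊖ (suc m) (suc n) = begin
      ι (suc m ℤ.⊖ suc n)      ≡⟨ ≡.cong ι (ℤ.[1+m]⊖[1+n]≡m⊖n m n) ⟩
      ι (m ℤ.⊖ n)              ≈⟨ ι-⊖ m n ⟩
      M + - N                  ≈⟨ +-congʳ (+-identityʳ M) ⟨
      (M + 0#) + - N           ≈⟨ +-congʳ (+-congˡ (-‿inverseʳ 1#)) ⟨
      (M + (1# + - 1#)) + - N  ≈⟨ +-congʳ (+-assoc M 1# (- 1#)) ⟨
      ((M + 1#) + - 1#) + - N  ≈⟨ +-congʳ (+-congʳ (+-comm M 1#)) ⟩
      ((1# + M) + - 1#) + - N  ≈⟨ +-assoc _ _ _ ⟩
      (1# + M) + (- 1# + - N)  ≈⟨ +-congˡ (-‿+-comm 1# N) ⟩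
      (1# + M) + - (1# + N)    ∎
      where M = fromℕ K m
            N = fromℕ K n

    ι-+ : ∀ i j → ι (i ℤ.+ j) ≈ ι i + ι j
    ι-+ (+ m)    (+ n)    = ×-homo-+ 1# m n
    ι-+ (+ m)    -[1+ n ] = ι-⊖ m (suc n)
    ι-+ -[1+ m ] (+ n)    = trans (ι-⊖ n (suc m)) (+-comm _ _)
    ι-+ -[1+ m ] -[1+ n ] = begin
      - fromℕ K (suc (suc (m ℕ.+ n)))  ≡⟨ ≡.cong (λ k → - fromℕ K (suc k)) (ℕ.+-suc m n) ⟨
      - fromℕ K (suc m ℕ.+ suc n)      ≈⟨ -‿cong (×-homo-+ 1# (suc m) (suc n)) ⟩
      - (fromℕ K (suc m) + fromℕ K (suc n)) ≈⟨ -‿+-comm _ _ ⟨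
      - fromℕ K (suc m) + - fromℕ K (suc n) ∎

    ι-+◃ : ∀ n → ι (Sign.+ ℤ.◃ n) ≈ fromℕ K n
    ι-+◃ zero    = refl
    ι-+◃ (suc n) = refl

    ι--◃ : ∀ n → ι (Sign.- ℤ.◃ n) ≈ - fromℕ K n
    ι--◃ zero    = sym -0#≈0#
    ι--◃ (suc n) = refl

    ι-* : ∀ i j → ι (i ℤ.* j) ≈ ι i * ι j
    ι-* (+ m)    (+ n)    = trans (ι-+◃ (m ℕ.* n)) (×1-homo-* m n)
    ι-* (+ m)    -[1+ n ] = trans (ι--◃ (m ℕ.* suc n)) (trans (-‿cong (×1-homo-* m (suc n))) (-‿distribʳ-* _ _))
    ι-* -[1+ m ] (+ n)    = trans (ι--◃ (suc m ℕ.* n)) (trans (-‿cong (×1-homo-* (suc m) n)) (-‿distribˡ-* _ _))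
    ι-* -[1+ m ] -[1+ n ] = trans (×1-homo-* (suc m) (suc n)) (sym (begin
      - M * - N    ≈⟨ -‿distribˡ-* M (- N) ⟨
      - (M * - N)  ≈⟨ -‿cong (-‿distribʳ-* M N) ⟨
      - - (M * N)  ≈⟨ -‿involutive _ ⟩
      M * N        ∎))
      where M = fromℕ K (suc m)
            N = fromℕ K (suc n)

    ι-1 : ι 1ℤ ≈ 1#
    ι-1 = +-identityʳ 1#

    -- Taking coefficients in ℤ gives the solver a decidable equality, which the field lacks, and
    -- lets it compute with numerals.
    morphism : CommutativeRing.rawRing ℤ.+-*-commutativeRing -Raw-AlmostCommutative⟶ fromCommutativeRing commRing
    morphism = record
      { ⟦_⟧ = ι ; +-homo = ι-+ ; *-homo = ι-* ; -‿homo = ι-neg ; 0-homo = refl ; 1-homo = ι-1 }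

    ι-≟ : ∀ i j → Maybe (ι i ≈ ι j)
    ι-≟ i j = Maybe.map (λ { ≡.refl → refl }) (dec⇒maybe (i ℤ.≟ j))

    open Algebra.Solver.Ring (CommutativeRing.rawRing ℤ.+-*-commutativeRing) (fromCommutativeRing commRing) morphism ι-≟ public
      using (solve; _:=_; _:+_; _:*_; :-_; _:-_; con)

  -- Integrality and finitely generated modules

  module Integral {c ℓ₁ ℓ₂ : Level} (K : HeytingField c ℓ₁ ℓ₂) where

    open Integers K
    open Algebra.Properties.Semiring.Sum semiring using (sum-cong-≋; sum-remove; ∑-distrib-+; *-distribˡ-sum; sum-replicate-zero)

    -- Poly x t d y: y is the value at x of an integer polynomial of degree at
    -- most d whose coefficient of degree d is t, in Horner form.
    data Poly (x : Carrier) : ℤ → ℕ → Carrier → Set (c ⊔ ℓ₁) where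
      lead   : ∀ {t y} → y ≈ ι t → Poly x t 0 y
      horner : ∀ {t d y y′} a → Poly x t d y′ → y ≈ ι a + x * y′ → Poly x t (suc d) y

    module _ {x : Carrier} where

      Poly-resp : ∀ {t d y z} → y ≈ z → Poly x t d y → Poly x t d z
      Poly-resp y≈z (lead p)       = lead (trans (sym y≈z) p)
      Poly-resp y≈z (horner a q p) = horner a q (trans (sym y≈z) p)

      Poly-+ : ∀ {t s d y z} → Poly x t d y → Poly x s d z → Poly x (t ℤ.+ s) d (y + z)
      Poly-+ {t} {s} (lead p) (lead q) = lead (trans (+-cong p q) (sym (ι-+ t s)))
      Poly-+ (horner {y′ = y′} a p₁ p) (horner {y′ = z′} b q₁ q) = horner (a ℤ.+ b) (Poly-+ p₁ q₁)
        (trans (+-cong p q) (trans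
          (solve 5 (λ a b x y z → (a :+ x :* y) :+ (b :+ x :* z) := (a :+ b) :+ x :* (y :+ z)) refl (ι a) (ι b) x y′ z′)
          (+-congʳ (sym (ι-+ a b)))))

      Poly-scale : ∀ {t d y} a → Poly x t d y → Poly x (a ℤ.* t) d (ι a * y)
      Poly-scale a (lead p)       = lead (trans (*-congˡ p) (sym (ι-* a _)))
      Poly-scale a (horner {y′ = y′} b q p) = horner (a ℤ.* b) (Poly-scale a q) (trans (*-congˡ p) (trans
          (solve 4 (λ a b x y → a :* (b :+ x :* y) := a :* b :+ x :* (a :* y)) refl (ι a) (ι b) x y′)
          (+-congʳ (sym (ι-* a b)))))

      -- Index 0 for the top coefficient records a degree strictly below the bound; `eliminate`
      -- separates off-diagonal from diagonal entries in this way.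
      Poly-raise : ∀ {t d y} → Poly x t d y → Poly x 0ℤ (suc d) y
      Poly-raise {t} (lead p) = horner t (lead refl) (trans p (sym (trans (+-congˡ (zeroʳ x)) (+-identityʳ _))))
      Poly-raise (horner a q p) = horner a (Poly-raise q) p

      Poly-raise-by : ∀ {t d y} k → Poly x t d y → Poly x 0ℤ (suc (k ℕ.+ d)) y
      Poly-raise-by zero    p = Poly-raise p
      Poly-raise-by (suc k) p = Poly-raise (Poly-raise-by k p)

      Poly-* : ∀ {t s d e y z} → Poly x t d y → Poly x s e z → Poly x (t ℤ.* s) (d ℕ.+ e) (y * z)
      Poly-* {t = t} (lead p) q = Poly-resp (*-congʳ (sym p)) (Poly-scale t q)
      Poly-* {t = t} {s} {z = z} (horner {d = d} {y′ = y′} a p₁ p) q = Poly-resp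
        (trans (+-congʳ (+-identityˡ _)) (trans
          (solve 4 (λ a x y z → x :* (y :* z) :+ a :* z := (a :+ x :* y) :* z) refl (ι a) x y′ z) (*-congʳ (sym p))))
        (≡.subst (λ r → Poly x r _ _) (ℤ.+-identityʳ (t ℤ.* s))
          (Poly-+ (horner 0ℤ (Poly-* p₁ q) refl) (Poly-raise-by d (Poly-scale a q))))

      sum⇒Poly : ∀ t d (a : Vector ℤ d) → Poly x t d (ι t * x ^ d + sum (λ i → ι (a i) * x ^ toℕ i))
      sum⇒Poly t zero    a = lead (trans (+-identityʳ _) (*-identityʳ _))
      sum⇒Poly t (suc d) a = horner (a zero) (sum⇒Poly t d (a ∘ suc)) (begin
        ι t * (x * x ^ d) + (ι (a zero) * 1# + sum (λ i → ι (a (suc i)) * (x * x ^ toℕ i)))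
          ≈⟨ +-congˡ (+-cong (*-identityʳ _) (sum-cong-≋ (λ i → solve 3 (λ a x y → a :* (x :* y) :=
               x :* (a :* y)) refl (ι (a (suc i))) x (x ^ toℕ i)))) ⟩
        ι t * (x * x ^ d) + (ι (a zero) + sum (λ i → x * (ι (a (suc i)) * x ^ toℕ i)))
          ≈⟨ +-congˡ (+-congˡ (*-distribˡ-sum x (λ i → ι (a (suc i)) * x ^ toℕ i))) ⟨
        ι t * (x * x ^ d) + (ι (a zero) + x * S)
          ≈⟨ solve 5 (λ t x y a s → t :* (x :* y) :+ (a :+ x :* s) :=
               a :+ x :* (t :* y :+ s)) refl (ι t) x (x ^ d) (ι (a zero)) S ⟩
        ι (a zero) + x * (ι t * x ^ d + S) ∎)
        where S = sum (λ i → ι (a (suc i)) * x ^ toℕ i)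

      Poly⇒sum : ∀ {t d y} → Poly x t d y → Σ[ a ∈ Vector ℤ d ] y ≈ ι t * x ^ d + sum (λ i → ι (a i) * x ^ toℕ i)
      Poly⇒sum (lead p) = [] , trans p (sym (trans (+-identityʳ _) (*-identityʳ _)))
      Poly⇒sum {t} {suc d} {y} (horner {y′ = y′} b q p) with Poly⇒sum q
      ... | a , e = (b ∷ a) , (begin
        y                                  ≈⟨ p ⟩
        ι b + x * y′                       ≈⟨ +-congˡ (*-congˡ e) ⟩
        ι b + x * (ι t * x ^ d + S)
          ≈⟨ solve 5 (λ t x y a s → t :* (x :* y) :+ (a :+ x :* s) := a :+ x :* (t :* y :+ s)) refl (ι t) x (x ^ d) (ι b) S ⟨
        ι t * (x * x ^ d) + (ι b + x * S)
          ≈⟨ +-congˡ (+-congˡ (*-distribˡ-sum x (λ i → ι (a i) * x ^ toℕ i))) ⟩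
        ι t * (x * x ^ d) + (ι b + sum (λ i → x * (ι (a i) * x ^ toℕ i)))
          ≈⟨ +-congˡ (+-cong (*-identityʳ _) (sum-cong-≋ (λ i → solve 3 (λ a x y → a :* (x :* y) :=
               x :* (a :* y)) refl (ι (a i)) x (x ^ toℕ i)))) ⟨
        ι t * (x * x ^ d) + (ι b * 1# + sum (λ i → ι (a i) * (x * x ^ toℕ i))) ∎)
        where S = sum (λ i → ι (a i) * x ^ toℕ i)

      Poly⇒𝒪 : ∀ {d} → Poly x 1ℤ d 0# → 𝒪 K x
      Poly⇒𝒪 {d} p with Poly⇒sum p
      ... | a , e = d , a , trans (+-congʳ (sym (trans (*-congʳ ι-1) (*-identityˡ _)))) (sym e)

      𝒪⇒Poly : 𝒪 K x → ∃[ d ] Poly x 1ℤ d 0#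
      𝒪⇒Poly (d , a , e) = d , Poly-resp (trans (+-congʳ (trans (*-congʳ ι-1) (*-identityˡ _))) e) (sum⇒Poly 1ℤ d a)

      -- A determinant-free form of the determinant trick: eliminating one unknown
      -- by cross-multiplication keeps the diagonal monic of the common degree and
      -- the other entries of smaller degree.
      eliminate : ∀ n d (P : Fin (suc n) → Fin (suc n) → Carrier) (v : Fin (suc n) → Carrier) →
        (∀ i → Poly x 1ℤ d (P i i)) → (∀ i j → i ≢ j → Poly x 0ℤ d (P i j)) →
        (∀ i → sum (λ j → P i j * v j) ≈ 0#) →
        ∃[ e ] ∃[ y ] Poly x 1ℤ e y × y * v zero ≈ 0#
      eliminate zero    d P v diag off eq = d , P zero zero , diag zero , trans (sym (+-identityʳ _)) (eq zero)
      eliminate (suc n) d P v diag off eq = eliminate n (d ℕ.+ d) Q (v ∘ σ)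
        (λ i → Poly-minus (Poly-* (diag k) (diag (σ i))) (Poly-* (off (σ i) k (Fin.punchInᵢ≢i k i)) (off k (σ i) (Fin.punchInᵢ≢i k i ∘ ≡.sym))))
        (λ i j i≢j → Poly-minus (Poly-* (diag k) (off (σ i) (σ j) (i≢j ∘ Fin.punchIn-injective k i j))) (Poly-* (off (σ i) k (Fin.punchInᵢ≢i k i)) (off k (σ j) (Fin.punchInᵢ≢i k j ∘ ≡.sym))))
        rows
        where
        -- Eliminating the unknown with index 1 keeps index 0 in place, since `punchIn` at 1 fixes
        -- `zero`; so `v zero` survives to the end.
        k : Fin (suc (suc n))
        k = suc zero
        σ : Fin (suc n) → Fin (suc (suc n))
        σ = punchIn k
        -- The 2 × 2 minors with pivot `P k k`. Products of off-diagonal entries have top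
        -- coefficient 0, so the new diagonal is monic of the doubled degree.
        Q : Fin (suc n) → Fin (suc n) → Carrier
        Q i j = P k k * P (σ i) (σ j) + ι -[1+ 0 ] * (P (σ i) k * P k (σ j))
        Poly-minus : ∀ {t s e y z} → Poly x t e y → Poly x s e z → Poly x (t ℤ.+ -[1+ 0 ] ℤ.* s) e (y + ι -[1+ 0 ] * z)
        Poly-minus p q = Poly-+ p (Poly-scale -[1+ 0 ] q)
        rest : Fin (suc (suc n)) → Carrier
        rest i = sum (λ j → P i (σ j) * v (σ j))
        split : ∀ i → P i k * v k + rest i ≈ 0#
        split i = trans (sym (sum-remove {i = k} (λ j → P i j * v j))) (eq i)
        rows : ∀ i → sum (λ j → Q i j * v (σ j)) ≈ 0#
        rows i = begin
          sum (λ j → Q i j * v (σ j))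
            ≈⟨ sum-cong-≋ (λ j → solve 5 (λ a b c d v → (a :* b :+ con -[1+ 0 ] :* (c :* d)) :* v :=
                 a :* (b :* v) :+ (:- c) :* (d :* v)) refl
                 (P k k) (P (σ i) (σ j)) (P (σ i) k) (P k (σ j)) (v (σ j))) ⟩
          sum (λ j → P k k * (P (σ i) (σ j) * v (σ j)) + (- P (σ i) k) * (P k (σ j) * v (σ j)))
            ≈⟨ ∑-distrib-+ (λ j → P k k * (P (σ i) (σ j) * v (σ j))) (λ j → (- P (σ i) k) * (P k (σ j) * v (σ j))) ⟩
          sum (λ j → P k k * (P (σ i) (σ j) * v (σ j))) + sum (λ j → (- P (σ i) k) * (P k (σ j) * v (σ j)))
            ≈⟨ +-cong (*-distribˡ-sum (P k k) (λ j → P (σ i) (σ j) * v (σ j))) (*-distribˡ-sum (- P (σ i) k) (λ j → P k (σ j) * v (σ j))) ⟨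
          P k k * rest (σ i) + (- P (σ i) k) * rest k
            ≈⟨ solve 5 (λ a b r s v → a :* r :+ (:- b) :* s := a :* (b :* v :+ r) :- b :* (a :* v :+ s)) refl
                 (P k k) (P (σ i) k) (rest (σ i)) (rest k) (v k) ⟩
          P k k * (P (σ i) k * v k + rest (σ i)) - P (σ i) k * (P k k * v k + rest k)
            ≈⟨ +-cong (*-congˡ (split (σ i))) (-‿cong (*-congˡ (split k))) ⟩
          P k k * 0# - P (σ i) k * 0#
            ≈⟨ solve 2 (λ a b → a :* con 0ℤ :- b :* con 0ℤ := con 0ℤ) refl (P k k) (P (σ i) k) ⟩
          0# ∎

    δ : ∀ {n} → Fin n → Fin n → ℤ
    δ i j with i Fin.≟ j
    ... | yes _ = 1ℤ
    ... | no  _ = 0ℤ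

    δ-diag : ∀ {n} (i : Fin n) → δ i i ≡ 1ℤ
    δ-diag i with i Fin.≟ i
    ... | yes _   = ≡.refl
    ... | no  i≢i = contradiction ≡.refl i≢i

    δ-off : ∀ {n} {i j : Fin n} → i ≢ j → δ i j ≡ 0ℤ
    δ-off {i = i} {j} i≢j with i Fin.≟ j
    ... | yes i≡j = contradiction i≡j i≢j
    ... | no  _   = ≡.refl

    sum-δ : ∀ {n} (v : Fin n → Carrier) i → sum (λ j → ι (δ i j) * v j) ≈ v i
    sum-δ {suc n} v i = begin
      sum (λ j → ι (δ i j) * v j)
        ≈⟨ sum-remove {i = i} (λ j → ι (δ i j) * v j) ⟩
      ι (δ i i) * v i + sum (λ j → ι (δ i (punchIn i j)) * v (punchIn i j))
        ≈⟨ +-cong (trans (*-congʳ (trans (reflexive (≡.cong ι (δ-diag i))) ι-1)) (*-identityˡ (v i)))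
             (trans (sum-cong-≋ (λ j → trans (*-congʳ (reflexive (≡.cong ι (δ-off (Fin.punchInᵢ≢i i j ∘ ≡.sym))))) (zeroˡ _))) (sum-replicate-zero n)) ⟩
      v i + 0#
        ≈⟨ +-identityʳ (v i) ⟩
      v i ∎

    data Span {n} (v : Fin n → Carrier) : Carrier → Set (c ⊔ ℓ₁) where
      gen  : ∀ i → Span v (v i)
      zero : Span v 0#
      add  : ∀ {y z} → Span v y → Span v z → Span v (y + z)
      neg  : ∀ {y} → Span v y → Span v (- y)
      resp : ∀ {y z} → y ≈ z → Span v y → Span v z

    module _ {n} {v : Fin n → Carrier} where

      Span-ℕ : ∀ k {y} → Span v y → Span v (fromℕ K k * y)
      Span-ℕ zero    p = resp (sym (zeroˡ _)) zero
      Span-ℕ (suc k) p = resp (sym (trans (distribʳ _ _ _) (+-congʳ (*-identityˡ _)))) (add p (Span-ℕ k p))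

      Span-ℤ : ∀ a {y} → Span v y → Span v (ι a * y)
      Span-ℤ (+ k)    p = Span-ℕ k p
      Span-ℤ -[1+ k ] p = resp (-‿distribˡ-* _ _) (neg (Span-ℕ (suc k) p))

      Span-sum : ∀ {k} (f : Fin k → Carrier) → (∀ i → Span v (f i)) → Span v (sum f)
      Span-sum {zero}  f p = zero
      Span-sum {suc k} f p = add (p zero) (Span-sum (f ∘ suc) (p ∘ suc))

      coefficients : ∀ {y} → Span v y → ∃[ a ] y ≈ sum (λ i → ι (a i) * v i)
      coefficients (gen i) = δ i , sym (sum-δ v i)
      coefficients zero = (λ _ → 0ℤ) , sym (trans (sum-cong-≋ (λ i → zeroˡ (v i))) (sum-replicate-zero n))
      coefficients (add p q) with coefficients p | coefficients q
      ... | a , e | b , f = (λ i → a i ℤ.+ b i) , trans (+-cong e f) (trans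
        (sym (∑-distrib-+ (λ i → ι (a i) * v i) (λ i → ι (b i) * v i)))
        (sum-cong-≋ (λ i → trans (sym (distribʳ (v i) _ _)) (*-congʳ (sym (ι-+ (a i) (b i)))))))
      coefficients (neg {y} p) with coefficients p
      ... | a , e = (λ i → -[1+ 0 ] ℤ.* a i) , (begin
        - y                                        ≈⟨ solve 1 (λ y → :- y := con -[1+ 0 ] :* y) refl y ⟩
        ι -[1+ 0 ] * y                             ≈⟨ *-congˡ e ⟩
        ι -[1+ 0 ] * sum (λ i → ι (a i) * v i)     ≈⟨ *-distribˡ-sum (ι -[1+ 0 ]) (λ i → ι (a i) * v i) ⟩
        sum (λ i → ι -[1+ 0 ] * (ι (a i) * v i))
          ≈⟨ sum-cong-≋ (λ i → trans (sym (*-assoc _ _ _)) (*-congʳ (sym (ι-* -[1+ 0 ] (a i))))) ⟩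
        sum (λ i → ι (-[1+ 0 ] ℤ.* a i) * v i)     ∎)
      coefficients (resp y≈z p) with coefficients p
      ... | a , e = a , trans (sym y≈z) e

      Stable : Carrier → Set (c ⊔ ℓ₁)
      Stable x = ∀ i → Span v (x * v i)

      Stable-Span : ∀ {x} → Stable x → ∀ {y} → Span v y → Span v (x * y)
      Stable-Span s (gen i)    = s i
      Stable-Span s zero       = resp (sym (zeroʳ _)) zero
      Stable-Span s (add p q)  = resp (sym (distribˡ _ _ _)) (add (Stable-Span s p) (Stable-Span s q))
      Stable-Span s (neg p)    = resp (-‿distribʳ-* _ _) (neg (Stable-Span s p))
      Stable-Span s (resp e p) = resp (*-congˡ e) (Stable-Span s p)

      Stable-+ : ∀ {x y} → Stable x → Stable y → Stable (x + y)
      Stable-+ s t i = resp (sym (distribʳ _ _ _)) (add (s i) (t i))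

      Stable-* : ∀ {x y} → Stable x → Stable y → Stable (x * y)
      Stable-* s t i = resp (sym (*-assoc _ _ _)) (Stable-Span s (t i))

    -- If A is the matrix of multiplication by `x` on the generators, x · 1 - A annihilates `v`.
    -- Elimination leaves a monic polynomial value times `v zero`, that is, times 1.
    Stable⇒𝒪 : ∀ {n} {v : Fin (suc n) → Carrier} {x} → v zero ≈ 1# → Stable {v = v} x → 𝒪 K x
    Stable⇒𝒪 {n} {v} {x} v₀≈1 s = 
      let (e , y , py , yv₀≈0) = eliminate n 1 P v (λ i → entry i i (δ-diag i)) (λ i j i≢j → entry i j (δ-off i≢j)) rows
      in Poly⇒𝒪 (Poly-resp (trans (sym (*-identityʳ y)) (trans (*-congˡ (sym v₀≈1)) yv₀≈0)) py)
      where
      a : Fin (suc n) → Fin (suc n) → ℤ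
      a i = proj₁ (coefficients (s i))
      P : Fin (suc n) → Fin (suc n) → Carrier
      P i j = ι (ℤ.- a i j) + x * ι (δ i j)
      entry : ∀ i j {t} → δ i j ≡ t → Poly x t 1 (P i j)
      entry i j δ≡t = horner (ℤ.- a i j) (lead (reflexive (≡.cong ι δ≡t))) refl
      rows : ∀ i → sum (λ j → P i j * v j) ≈ 0#
      rows i = begin
        sum (λ j → P i j * v j)
          ≈⟨ sum-cong-≋ (λ j → trans (*-congʳ (+-congʳ (ι-neg (a i j))))
               (solve 4 (λ a x d v → ((:- a) :+ x :* d) :* v := con -[1+ 0 ] :* (a :* v) :+ x :* (d :* v)) refl (ι (a i j)) x (ι (δ i j)) (v j))) ⟩
        sum (λ j → ι -[1+ 0 ] * (ι (a i j) * v j) + x * (ι (δ i j) * v j))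
          ≈⟨ ∑-distrib-+ (λ j → ι -[1+ 0 ] * (ι (a i j) * v j)) (λ j → x * (ι (δ i j) * v j)) ⟩
        sum (λ j → ι -[1+ 0 ] * (ι (a i j) * v j)) + sum (λ j → x * (ι (δ i j) * v j))
          ≈⟨ +-cong (*-distribˡ-sum (ι -[1+ 0 ]) (λ j → ι (a i j) * v j)) (*-distribˡ-sum x (λ j → ι (δ i j) * v j)) ⟨
        ι -[1+ 0 ] * sum (λ j → ι (a i j) * v j) + x * sum (λ j → ι (δ i j) * v j)
          ≈⟨ +-cong (*-congˡ (sym (proj₂ (coefficients (s i))))) (*-congˡ (sum-δ v i)) ⟩
        ι -[1+ 0 ] * (x * v i) + x * v i
          ≈⟨ solve 1 (λ y → con -[1+ 0 ] :* y :+ y := con 0ℤ) refl (x * v i) ⟩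
        0# ∎

  module IntegralClosure {c ℓ₁ ℓ₂ : Level} (K : HeytingField c ℓ₁ ℓ₂) where

    open Integers K
    open Integral K public
    open Algebra.Properties.Semiring.Sum semiring using (sum-cong-≋; *-distribʳ-sum)

    -- Below the top the next power is again a generator; at the top the monic equation reduces x^d.
    -- The factor `w` stands for a power of the other element, so the lemma serves both factors of a
    -- monomial.
    ^-suc-Span : ∀ {n} {v : Fin n → Carrier} {x} d (a : Vector ℤ d) →
      x ^ d + sum (λ i → ι (a i) * x ^ toℕ i) ≈ 0# →
      ∀ w → (∀ (i : Fin d) → Span v (x ^ toℕ i * w)) → ∀ (i : Fin d) → Span v (x * (x ^ toℕ i * w))
    ^-suc-Span {v = v} {x} d a e w p i with suc (toℕ i) ℕ.<? d
    ... | yes i+1<d = resp (trans (*-congʳ (reflexive (≡.cong (x ^_) (Fin.toℕ-fromℕ< i+1<d)))) (*-assoc _ _ _)) (p (Fin.fromℕ< i+1<d))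
    ... | no  i+1≮d = resp (trans (*-congʳ (reflexive (≡.cong (x ^_) (≡.sym i+1≡d)))) (*-assoc _ _ _)) top
      where
      i+1≡d : suc (toℕ i) ≡ d
      i+1≡d = ℕ.≤-antisym (Fin.toℕ<n i) (ℕ.≮⇒≥ i+1≮d)
      S : Carrier
      S = sum (λ i → ι (a i) * x ^ toℕ i)
      top : Span v (x ^ d * w)
      top = resp (begin
        - sum (λ i → ι (a i) * (x ^ toℕ i * w))
          ≈⟨ -‿cong (trans (sum-cong-≋ (λ i → sym (*-assoc (ι (a i)) (x ^ toℕ i) w))) (sym (*-distribʳ-sum w (λ i → ι (a i) * x ^ toℕ i)))) ⟩
        - (S * w)
          ≈⟨ solve 3 (λ s y w → :- (s :* w) := y :* w :- (y :+ s) :* w) refl S (x ^ d) w ⟩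
        x ^ d * w - (x ^ d + S) * w
          ≈⟨ +-congˡ (-‿cong (trans (*-congʳ e) (zeroˡ w))) ⟩
        x ^ d * w - 0#
          ≈⟨ trans (+-congˡ -0#≈0#) (+-identityʳ _) ⟩
        x ^ d * w ∎) (neg (Span-sum _ (λ i → Span-ℤ (a i) (p i))))

    module _ {x y : Carrier} {N M : ℕ} (a : Vector ℤ (suc N)) (b : Vector ℤ (suc M))
      (ex : x ^ suc N + sum (λ i → ι (a i) * x ^ toℕ i) ≈ 0#)
      (ey : y ^ suc M + sum (λ i → ι (b i) * y ^ toℕ i) ≈ 0#) where

      monomial : Fin (suc N ℕ.* suc M) → Carrier
      monomial k = let (i , j) = Fin.remQuot {suc N} (suc M) k in x ^ toℕ i * y ^ toℕ j

      monomial-Span : ∀ (i : Fin (suc N)) (j : Fin (suc M)) → Span monomial (x ^ toℕ i * y ^ toℕ j)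
      monomial-Span i j = resp (reflexive (≡.cong (λ (i , j) → x ^ toℕ i * y ^ toℕ j) (Fin.remQuot-combine i j))) (gen (Fin.combine i j))

      monomial-Stableˡ : Stable {v = monomial} x
      monomial-Stableˡ k = let (i , j) = Fin.remQuot {suc N} (suc M) k in
        ^-suc-Span (suc N) a ex (y ^ toℕ j) (λ i → monomial-Span i j) i

      monomial-Stableʳ : Stable {v = monomial} y
      monomial-Stableʳ k = let (i , j) = Fin.remQuot {suc N} (suc M) k in
        resp (*-congˡ (*-comm _ _)) (^-suc-Span (suc M) b ey (x ^ toℕ i) (λ j → resp (*-comm _ _) (monomial-Span i j)) j)

      monomial-zero : monomial zero ≈ 1#
      monomial-zero = *-identityʳ 1#

    𝒪-+ : ∀ {x y} → 𝒪 K x → 𝒪 K y → 𝒪 K (x + y)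
    -- A monic equation of degree 0 says 1 ≈ 0 and does not mention the element, so it serves for
    -- the sum as well.
    𝒪-+ (zero , a , e) q = zero , [] , e
    𝒪-+ (suc N , a , e) (zero , b , f) = zero , [] , f
    𝒪-+ (suc N , a , e) (suc M , b , f) = Stable⇒𝒪 (monomial-zero a b e f) (Stable-+ (monomial-Stableˡ a b e f) (monomial-Stableʳ a b e f))

    𝒪-* : ∀ {x y} → 𝒪 K x → 𝒪 K y → 𝒪 K (x * y)
    𝒪-* (zero , a , e) q = zero , [] , e
    𝒪-* (suc N , a , e) (zero , b , f) = zero , [] , f
    𝒪-* (suc N , a , e) (suc M , b , f) = Stable⇒𝒪 (monomial-zero a b e f) (Stable-* (monomial-Stableˡ a b e f) (monomial-Stableʳ a b e f))

    𝒪-ℤ : ∀ a → 𝒪 K (ι a)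
    𝒪-ℤ a = Poly⇒𝒪 (horner (ℤ.- a) (lead refl) (begin
      0#                      ≈⟨ solve 1 (λ a → con 0ℤ := (:- a) :+ a :* con 1ℤ) refl (ι a) ⟩
      - ι a + ι a * ι 1ℤ      ≈⟨ +-congʳ (ι-neg a) ⟨
      ι (ℤ.- a) + ι a * ι 1ℤ  ∎))

    𝒪-resp : ∀ {x y} → x ≈ y → 𝒪 K x → 𝒪 K y
    𝒪-resp x≈y p = Poly⇒𝒪 (Poly-base x≈y (proj₂ (𝒪⇒Poly p)))
      where
      Poly-base : ∀ {x y t d z} → x ≈ y → Poly x t d z → Poly y t d z
      Poly-base x≈y (lead p)       = lead p
      Poly-base x≈y (horner a q p) = horner a (Poly-base x≈y q) (trans p (+-congˡ (*-congʳ x≈y)))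

    𝒪-neg : ∀ {x} → 𝒪 K x → 𝒪 K (- x)
    𝒪-neg p = 𝒪-resp (solve 1 (λ x → con -[1+ 0 ] :* x := :- x) refl _) (𝒪-* (𝒪-ℤ -[1+ 0 ]) p)

    𝒪-quadratic : ∀ {x} a → x * x ≈ x + ι a → 𝒪 K x
    𝒪-quadratic {x} a e = Poly⇒𝒪 (horner (ℤ.- a) (horner -[1+ 0 ] (lead refl) refl) (begin
      0#                      ≈⟨ -‿inverseʳ (x * x) ⟨
      x * x - x * x           ≈⟨ +-congˡ (-‿cong e) ⟩
      x * x - (x + ι a)
        ≈⟨ solve 2 (λ x a → x :* x :- (x :+ a) := (:- a) :+ x :* (con -[1+ 0 ] :+ x :* con 1ℤ)) refl x (ι a) ⟩
      - ι a + x * (ι -[1+ 0 ] + x * ι 1ℤ) ≈⟨ +-congʳ (ι-neg a) ⟨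
      ι (ℤ.- a) + x * (ι -[1+ 0 ] + x * ι 1ℤ) ∎))

  -- Cancelling integers in characteristic zero

  module CharacteristicZeroField {c ℓ₁ ℓ₂ : Level} (K : HeytingField c ℓ₁ ℓ₂) (charZero : CharacteristicZero K) where

    open Integers K
    open IntegralClosure K public

    reciprocal : ∀ n → ∃[ r ] r * ι (+ suc n) ≈ 1#
    reciprocal n = let (r , rn≈1 , _) = #⇒invertible (charZero n) in
      r , trans (*-congˡ (sym (trans (+-congˡ -0#≈0#) (+-identityʳ _)))) rn≈1

    ι-cancel : ∀ n {x} → ι (+ suc n) * x ≈ 0# → x ≈ 0#
    ι-cancel n {x} e = let (r , rn≈1) = reciprocal n in begin
      x                      ≈⟨ *-identityˡ x ⟨
      1# * x                 ≈⟨ *-congʳ rn≈1 ⟨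
      (r * ι (+ suc n)) * x  ≈⟨ *-assoc _ _ _ ⟩
      r * (ι (+ suc n) * x)  ≈⟨ *-congˡ e ⟩
      r * 0#                 ≈⟨ zeroʳ r ⟩
      0#                     ∎

    ι-cancel-≈ : ∀ n {x y} → ι (+ suc n) * x ≈ ι (+ suc n) * y → x ≈ y
    ι-cancel-≈ n {x} {y} e = begin
      x            ≈⟨ solve 2 (λ x y → x := (x :- y) :+ y) refl x y ⟩
      (x - y) + y  ≈⟨ +-congʳ (ι-cancel n (begin
        ι (+ suc n) * (x - y)              ≈⟨ solve 3 (λ k x y → k :* (x :- y) := k :* x :- k :* y) refl (ι (+ suc n)) x y ⟩
        ι (+ suc n) * x - ι (+ suc n) * y  ≈⟨ +-congʳ e ⟩
        ι (+ suc n) * y - ι (+ suc n) * y  ≈⟨ -‿inverseʳ _ ⟩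
        0#                                 ∎)) ⟩
      0# + y       ≈⟨ +-identityˡ y ⟩
      y            ∎

    1≉0 : ¬ 1# ≈ 0#
    1≉0 e = #-irrefl (trans (+-identityʳ 1#) e) (charZero 0)

    ι-injective : ∀ {i} → ι i ≈ 0# → i ≡ 0ℤ
    ι-injective {+ zero}  e = ≡.refl
    ι-injective {+ suc n} e = contradiction e (λ e → #-irrefl e (charZero n))
    ι-injective { -[1+ n ]} e = contradiction (trans (sym (-‿involutive _)) (trans (-‿cong e) -0#≈0#)) (λ e → #-irrefl e (charZero n))

    half : Carrier
    half = proj₁ (reciprocal 1)

    half-2 : half * ι (+ 2) ≈ 1#
    half-2 = proj₂ (reciprocal 1)

    -- Multiplied by 2^d, a monic equation of degree d for 1/2 has leading term 1 and all other
    -- terms even, so an odd integer would vanish.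
    ½∉𝒪 : ∀ {w} → 𝒪 K w → ¬ ι (+ 2) * w ≈ 1#
    ½∉𝒪 {w} w∈𝒪 2w≈1 = let (d , p) = 𝒪⇒Poly w∈𝒪 ; (b , e) = clear p in
      odd≢0 b (ι-injective (trans (ι-+ 1ℤ (+ 2 ℤ.* b)) (trans (+-congˡ (ι-* (+ 2) b)) (trans (sym e) (zeroʳ _)))))
      where
      clear : ∀ {t d y} → Poly w t d y → Σ[ b ∈ ℤ ] ι (+ 2) ^ d * y ≈ ι t + ι (+ 2) * ι b
      clear {t} (lead p) = 0ℤ , trans (*-identityˡ _) (trans p (solve 1 (λ t → t := t :+ con (+ 2) :* con 0ℤ) refl (ι t)))
      clear {t} {suc d} {y} (horner {y′ = y′} a q p) with clear q
      ... | b , e = (+ 2) ℤ.^ d ℤ.* a ℤ.+ b , (begin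
        (ι (+ 2) * T) * y                   ≈⟨ *-congˡ p ⟩
        (ι (+ 2) * T) * (ι a + w * y′)
          ≈⟨ solve 4 (λ T a w y → (con (+ 2) :* T) :* (a :+ w :* y) :=
               con (+ 2) :* (T :* a) :+ (con (+ 2) :* w) :* (T :* y)) refl T (ι a) w y′ ⟩
        ι (+ 2) * (T * ι a) + (ι (+ 2) * w) * (T * y′)  ≈⟨ +-cong (*-congˡ (*-congʳ (ι-^ d))) (*-cong 2w≈1 e) ⟩
        ι (+ 2) * (ι ((+ 2) ℤ.^ d) * ι a) + 1# * (ι t + ι (+ 2) * ι b)
          ≈⟨ +-cong (*-congˡ (sym (ι-* ((+ 2) ℤ.^ d) a))) (*-identityˡ _) ⟩
        ι (+ 2) * ι ((+ 2) ℤ.^ d ℤ.* a) + (ι t + ι (+ 2) * ι b)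
          ≈⟨ solve 3 (λ u t b → con (+ 2) :* u :+ (t :+ con (+ 2) :* b) :=
               t :+ con (+ 2) :* (u :+ b)) refl (ι ((+ 2) ℤ.^ d ℤ.* a)) (ι t) (ι b) ⟩
        ι t + ι (+ 2) * (ι ((+ 2) ℤ.^ d ℤ.* a) + ι b) ≈⟨ +-congˡ (*-congˡ (sym (ι-+ ((+ 2) ℤ.^ d ℤ.* a) b))) ⟩
        ι t + ι (+ 2) * ι ((+ 2) ℤ.^ d ℤ.* a ℤ.+ b) ∎)
        where
        T : Carrier
        T = ι (+ 2) ^ d
        ι-^ : ∀ d → ι (+ 2) ^ d ≈ ι ((+ 2) ℤ.^ d)
        ι-^ zero    = sym ι-1
        ι-^ (suc d) = trans (*-congˡ (ι-^ d)) (sym (ι-* (+ 2) ((+ 2) ℤ.^ d)))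
      odd≢0 : ∀ b → 1ℤ ℤ.+ + 2 ℤ.* b ≢ 0ℤ
      odd≢0 (+ zero) ()
      odd≢0 (+ suc b) ()
      odd≢0 -[1+ zero ] ()
      odd≢0 -[1+ suc b ] ()

  -- α and β stand for (1 + √-m) / 2 and (1 + √n) / 2.
  module Order {c ℓ₁ ℓ₂ : Level} (K : HeytingField c ℓ₁ ℓ₂) (charZero : CharacteristicZero K)
    (α β : HeytingField.Carrier K) (a b : ℤ)
    (α-eq : HeytingField._≈_ K (HeytingField._*_ K α α) (HeytingField._+_ K α (fromℤ K a)))
    (β-eq : HeytingField._≈_ K (HeytingField._*_ K β β) (HeytingField._+_ K β (fromℤ K b)))
    where

    -- The order ℤ[α, β], its reduction modulo 2 and its odd index

    open Integers K
    open CharacteristicZeroField K charZero public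

    -- Generated as a ring, without coordinates in 1, α, β, α β: for `n = 1` these are linearly
    -- dependent.
    data R : Carrier → Set (c ⊔ ℓ₁) where
      R-1    : R 1#
      R-α    : R α
      R-β    : R β
      R-+    : ∀ {x y} → R x → R y → R (x + y)
      R-*    : ∀ {x y} → R x → R y → R (x * y)
      R-neg  : ∀ {x} → R x → R (- x)
      R-resp : ∀ {x y} → x ≈ y → R x → R y

    R-ℕ : ∀ n → R (fromℕ K n)
    R-ℕ zero    = R-resp (-‿inverseʳ 1#) (R-+ R-1 (R-neg R-1))
    R-ℕ (suc n) = R-+ R-1 (R-ℕ n)

    R-ℤ : ∀ i → R (ι i)
    R-ℤ (+ n)    = R-ℕ n
    R-ℤ -[1+ n ] = R-neg (R-ℕ (suc n))

    R⊆𝒪 : ∀ {x} → R x → 𝒪 K x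
    R⊆𝒪 R-1          = 𝒪-resp ι-1 (𝒪-ℤ 1ℤ)
    R⊆𝒪 R-α          = 𝒪-quadratic a α-eq
    R⊆𝒪 R-β          = 𝒪-quadratic b β-eq
    R⊆𝒪 (R-+ p q)    = 𝒪-+ (R⊆𝒪 p) (R⊆𝒪 q)
    R⊆𝒪 (R-* p q)    = 𝒪-* (R⊆𝒪 p) (R⊆𝒪 q)
    R⊆𝒪 (R-neg p)    = 𝒪-neg (R⊆𝒪 p)
    R⊆𝒪 (R-resp e p) = 𝒪-resp e (R⊆𝒪 p)

    triangular : ∀ i → ∃[ k ] i ℤ.* i ℤ.+ i ≡ + 2 ℤ.* k
    triangular (+ n) = let (k , e) = tri n in + k , ≡.trans (≡.cong (ℤ._+ + n) (≡.sym (ℤ.pos-* n n))) (≡.trans (≡.cong +_ e) (ℤ.pos-* 2 k))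
      where
      tri : ∀ n → ∃[ k ] n ℕ.* n ℕ.+ n ≡ 2 ℕ.* k
      tri zero = 0 , ≡.refl
      tri (suc n) = let (k , e) = tri n in k ℕ.+ suc n , ≡.trans (step n) (≡.trans (≡.cong (ℕ._+ 2 ℕ.* suc n) e) (≡.sym (ℕ.*-distribˡ-+ 2 k (suc n))))
        where
        step : ∀ n → suc n ℕ.* suc n ℕ.+ suc n ≡ (n ℕ.* n ℕ.+ n) ℕ.+ 2 ℕ.* suc n
        step = ℕ-Solver.solve-∀
    triangular -[1+ n ] = let (k , e) = triangular (+ n) in k ,
      ≡.trans (shift (+ n)) e
      where
      shift : ∀ i → ℤ.- (1ℤ ℤ.+ i) ℤ.* ℤ.- (1ℤ ℤ.+ i) ℤ.+ ℤ.- (1ℤ ℤ.+ i) ≡ i ℤ.* i ℤ.+ i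
      shift = solve-∀

    -- The residue fields of R at 2 are 𝔽₂ or 𝔽₄.
    quadratic-fourth-power : ∀ {x} i → R x → x * x ≈ x + ι i →
      ∃[ w ] R w × (x * x) * (x * x) ≈ x + ι (+ 2) * w
    quadratic-fourth-power {x} i x∈R e = let (k , i²+i≡2k) = triangular i in
      ι i * x + ι k , R-+ (R-* (R-ℤ i) x∈R) (R-ℤ k) , (begin
      (x * x) * (x * x)                    ≈⟨ *-cong e e ⟩
      (x + ι i) * (x + ι i)
        ≈⟨ solve 2 (λ x i → (x :+ i) :* (x :+ i) := x :* x :+ con (+ 2) :* (i :* x) :+ i :* i) refl x (ι i) ⟩
      x * x + ι (+ 2) * (ι i * x) + ι i * ι i  ≈⟨ +-congʳ (+-congʳ e) ⟩
      x + ι i + ι (+ 2) * (ι i * x) + ι i * ι i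
        ≈⟨ solve 2 (λ x i → x :+ i :+ con (+ 2) :* (i :* x) :+ i :* i :=
             x :+ con (+ 2) :* (i :* x) :+ (i :* i :+ i)) refl x (ι i) ⟩
      x + ι (+ 2) * (ι i * x) + (ι i * ι i + ι i)
        ≈⟨ +-congˡ (trans (+-congʳ (sym (ι-* i i))) (trans (sym (ι-+ (i ℤ.* i) i)) (trans (reflexive (≡.cong ι i²+i≡2k)) (ι-* (+ 2) k)))) ⟩
      x + ι (+ 2) * (ι i * x) + ι (+ 2) * ι k
        ≈⟨ solve 3 (λ x i k → x :+ con (+ 2) :* (i :* x) :+ con (+ 2) :* k :=
             x :+ con (+ 2) :* (i :* x :+ k)) refl x (ι i) (ι k) ⟩
      x + ι (+ 2) * (ι i * x + ι k) ∎)

    -- Modulo 2 the fourth power is the square of Frobenius, a ring endomorphism, so it is the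
    -- identity once it fixes the generators.
    R-fourth-power : ∀ {x} → R x → ∃[ w ] R w × (x * x) * (x * x) ≈ x + ι (+ 2) * w
    R-fourth-power R-1 = ι 0ℤ , R-ℤ 0ℤ , trans (trans (*-cong (*-identityˡ 1#) (*-identityˡ 1#)) (*-identityˡ 1#)) (sym (trans (+-congˡ (zeroʳ _)) (+-identityʳ 1#)))
    R-fourth-power R-α = quadratic-fourth-power a R-α α-eq
    R-fourth-power R-β = quadratic-fourth-power b R-β β-eq
    R-fourth-power (R-+ {x} {y} p q) with R-fourth-power p | R-fourth-power q
    ... | u , u∈R , e | v , v∈R , f = u + v + (ι (+ 2) * (x * x + y * y) + ι (+ 3) * (x * y)) * (x * y) ,
      R-+ (R-+ u∈R v∈R) (R-* (R-+ (R-* (R-ℤ (+ 2)) (R-+ (R-* p p) (R-* q q))) (R-* (R-ℤ (+ 3)) (R-* p q))) (R-* p q)) , (begin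
      ((x + y) * (x + y)) * ((x + y) * (x + y))
        ≈⟨ solve 2 (λ x y → ((x :+ y) :* (x :+ y)) :* ((x :+ y) :* (x :+ y)) :=
             (x :* x) :* (x :* x) :+ (y :* y) :* (y :* y) :+ con (+ 2) :* ((con (+ 2) :* (x :* x :+ y :* y) :+ con (+ 3) :* (x :* y)) :* (x :* y))) refl x y ⟩
      (x * x) * (x * x) + (y * y) * (y * y) + ι (+ 2) * ((ι (+ 2) * (x * x + y * y) + ι (+ 3) * (x * y)) * (x * y))
        ≈⟨ +-congʳ (+-cong e f) ⟩
      (x + ι (+ 2) * u) + (y + ι (+ 2) * v) + ι (+ 2) * ((ι (+ 2) * (x * x + y * y) + ι (+ 3) * (x * y)) * (x * y))
        ≈⟨ solve 5 (λ x y u v z → (x :+ con (+ 2) :* u) :+ (y :+ con (+ 2) :* v) :+ con (+ 2) :* z :=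
             x :+ y :+ con (+ 2) :* (u :+ v :+ z)) refl x y u v _ ⟩
      x + y + ι (+ 2) * (u + v + (ι (+ 2) * (x * x + y * y) + ι (+ 3) * (x * y)) * (x * y)) ∎)
    R-fourth-power (R-* {x} {y} p q) with R-fourth-power p | R-fourth-power q
    ... | u , u∈R , e | v , v∈R , f = x * v + u * y + ι (+ 2) * (u * v) ,
      R-+ (R-+ (R-* p v∈R) (R-* u∈R q)) (R-* (R-ℤ (+ 2)) (R-* u∈R v∈R)) , (begin
      ((x * y) * (x * y)) * ((x * y) * (x * y))
        ≈⟨ solve 2 (λ x y → ((x :* y) :* (x :* y)) :* ((x :* y) :* (x :* y)) :=
             ((x :* x) :* (x :* x)) :* ((y :* y) :* (y :* y))) refl x y ⟩
      ((x * x) * (x * x)) * ((y * y) * (y * y))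
        ≈⟨ *-cong e f ⟩
      (x + ι (+ 2) * u) * (y + ι (+ 2) * v)
        ≈⟨ solve 4 (λ x y u v → (x :+ con (+ 2) :* u) :* (y :+ con (+ 2) :* v) :=
             x :* y :+ con (+ 2) :* (x :* v :+ u :* y :+ con (+ 2) :* (u :* v))) refl x y u v ⟩
      x * y + ι (+ 2) * (x * v + u * y + ι (+ 2) * (u * v)) ∎)
    R-fourth-power (R-neg {x} p) with R-fourth-power p
    ... | u , u∈R , e = x + u , R-+ p u∈R , (begin
      (- x * - x) * (- x * - x)  ≈⟨ solve 1 (λ x → ((:- x) :* (:- x)) :* ((:- x) :* (:- x)) := (x :* x) :* (x :* x)) refl x ⟩
      (x * x) * (x * x)          ≈⟨ e ⟩
      x + ι (+ 2) * u            ≈⟨ solve 2 (λ x u → x :+ con (+ 2) :* u := (:- x) :+ con (+ 2) :* (x :+ u)) refl x u ⟩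
      - x + ι (+ 2) * (x + u)    ∎)
    R-fourth-power (R-resp x≈y p) with R-fourth-power p
    ... | u , u∈R , e = u , u∈R , trans (*-cong (*-cong (sym x≈y) (sym x≈y)) (*-cong (sym x≈y) (sym x≈y))) (trans e (+-congʳ x≈y))

    2R : Carrier → Set (c ⊔ ℓ₁)
    2R x = ∃[ w ] R w × x ≈ ι (+ 2) * w

    2R-* : ∀ {x y} → R x → 2R y → 2R (x * y)
    2R-* {x} {y} p (w , w∈R , e) = x * w , R-* p w∈R , trans (*-congˡ e) (solve 2 (λ x w → x :* (con (+ 2) :* w) := con (+ 2) :* (x :* w)) refl x w)

    R-^ : ∀ {x} n → R x → R (x ^ n)
    R-^ zero    p = R-1
    R-^ (suc n) p = R-* p (R-^ n p)

    -- Iterating x ≡ x⁴ gives x ≡ x · x^(3 n), a multiple of x^n.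
    2R-reduced : ∀ {x} n → R x → 2R (x ^ n) → 2R x
    2R-reduced {x} n p q = 
      let (w , w∈R , e) = lower n ; (u , u∈R , f) = raise n q
      in u - w , R-+ u∈R (R-neg w∈R) , (begin
        x                                ≈⟨ solve 2 (λ x w → x := (x :+ con (+ 2) :* w) :- con (+ 2) :* w) refl x w ⟩
        (x + ι (+ 2) * w) - ι (+ 2) * w  ≈⟨ +-congʳ e ⟨
        x * cube n - ι (+ 2) * w         ≈⟨ +-congʳ f ⟩
        ι (+ 2) * u - ι (+ 2) * w
          ≈⟨ solve 2 (λ u w → con (+ 2) :* u :- con (+ 2) :* w := con (+ 2) :* (u :- w)) refl u w ⟩
        ι (+ 2) * (u - w)                ∎)
      where
      cube : ℕ → Carrier
      cube zero    = 1#
      cube (suc k) = (x * x * x) * cube k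
      R-cube : ∀ k → R (cube k)
      R-cube zero    = R-1
      R-cube (suc k) = R-* (R-* (R-* p p) p) (R-cube k)
      lower : ∀ k → ∃[ w ] R w × x * cube k ≈ x + ι (+ 2) * w
      lower zero    = ι 0ℤ , R-ℤ 0ℤ , trans (*-identityʳ x) (solve 1 (λ x → x := x :+ con (+ 2) :* con 0ℤ) refl x)
      lower (suc k) = 
        let (w , w∈R , e) = lower k ; (u , u∈R , f) = R-fourth-power p
        in u + x * x * x * w , R-+ u∈R (R-* (R-* (R-* p p) p) w∈R) , (begin
          x * ((x * x * x) * cube k)
            ≈⟨ solve 2 (λ x c → x :* ((x :* x :* x) :* c) := (x :* x :* x) :* (x :* c)) refl x (cube k) ⟩
          (x * x * x) * (x * cube k)       ≈⟨ *-congˡ e ⟩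
          (x * x * x) * (x + ι (+ 2) * w)
            ≈⟨ solve 2 (λ x w → (x :* x :* x) :* (x :+ con (+ 2) :* w) :=
                 (x :* x) :* (x :* x) :+ con (+ 2) :* (x :* x :* x :* w)) refl x w ⟩
          (x * x) * (x * x) + ι (+ 2) * (x * x * x * w) ≈⟨ +-congʳ f ⟩
          x + ι (+ 2) * u + ι (+ 2) * (x * x * x * w)
            ≈⟨ solve 3 (λ x u w → x :+ con (+ 2) :* u :+ con (+ 2) :* w :=
                 x :+ con (+ 2) :* (u :+ w)) refl x u (x * x * x * w) ⟩
          x + ι (+ 2) * (u + x * x * x * w) ∎)
      2R-resp : ∀ {y z} → y ≈ z → 2R y → 2R z
      2R-resp y≈z (w , w∈R , e) = w , w∈R , trans (sym y≈z) e
      cube-^ : ∀ k → cube k ≈ (x ^ k * x ^ k) * x ^ k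
      cube-^ zero    = sym (trans (*-identityʳ _) (*-identityʳ _))
      cube-^ (suc k) = trans (*-congˡ (cube-^ k)) (solve 2 (λ x y → (x :* x :* x) :* ((y :* y) :* y) := ((x :* y) :* (x :* y)) :* (x :* y)) refl x (x ^ k))
      raise : ∀ n → 2R (x ^ n) → 2R (x * cube n)
      raise n q = 2R-resp (*-congˡ (sym (cube-^ n))) (2R-* p (2R-* (R-* (R-^ n p) (R-^ n p)) q))

    -- Multiplying by (2 k)^d homogenizes the polynomial in z = 2 k x; every term below the top
    -- keeps a factor 2 k.
    clear-denominators : ∀ {x z t d y} k → R z → ι (+ 2) * k * x ≈ z → R k → Poly x t d y →
      ∃[ w ] R w × (ι (+ 2) * k) ^ d * y ≈ ι t * z ^ d + ι (+ 2) * w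
    clear-denominators {t = t} k z∈R e k∈R (lead p) = ι 0ℤ , R-ℤ 0ℤ , trans (*-identityˡ _) (trans p
      (sym (trans (+-cong (*-identityʳ _) (zeroʳ _)) (+-identityʳ _))))
    clear-denominators {x} {z} {t} {suc d} {y} k z∈R e k∈R (horner {y′ = y′} a q p) with clear-denominators k z∈R e k∈R q
    ... | w , w∈R , f = k * T * ι a + z * w ,
      R-+ (R-* (R-* k∈R (R-^ d (R-* (R-ℤ (+ 2)) k∈R))) (R-ℤ a)) (R-* z∈R w∈R) , (begin
        (ι (+ 2) * k) * T * y                ≈⟨ *-congˡ p ⟩
        (ι (+ 2) * k) * T * (ι a + x * y′)
          ≈⟨ solve 5 (λ k T a x y → (con (+ 2) :* k) :* T :* (a :+ x :* y) :=
               con (+ 2) :* (k :* T :* a) :+ (con (+ 2) :* k :* x) :* (T :* y)) refl k T (ι a) x y′ ⟩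
        ι (+ 2) * (k * T * ι a) + (ι (+ 2) * k * x) * (T * y′) ≈⟨ +-congˡ (*-cong e f) ⟩
        ι (+ 2) * (k * T * ι a) + z * (ι t * z ^ d + ι (+ 2) * w)
          ≈⟨ solve 5 (λ u z t y w → con (+ 2) :* u :+ z :* (t :* y :+ con (+ 2) :* w) :=
               t :* (z :* y) :+ con (+ 2) :* (u :+ z :* w)) refl (k * T * ι a) z (ι t) (z ^ d) w ⟩
        ι t * (z * z ^ d) + ι (+ 2) * (k * T * ι a + z * w) ∎)
      where
      T : Carrier
      T = (ι (+ 2) * k) ^ d

    -- The monic equation of `x` puts a power of z = 2 k x into 2R; by reducedness z itself lies
    -- there, and 2 cancels.
    halve : ∀ {x k} → 𝒪 K x → R k → R (ι (+ 2) * k * x) → R (k * x)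
    halve {x} {k} x∈𝒪 k∈R z∈R =
      let (d , p) = 𝒪⇒Poly x∈𝒪
          (w , w∈R , e) = clear-denominators k z∈R refl k∈R p
          (u , u∈R , f) = 2R-reduced d z∈R (- w , R-neg w∈R , (begin
            z ^ d                              ≈⟨ *-identityˡ _ ⟨
            1# * z ^ d                         ≈⟨ *-congʳ ι-1 ⟨
            ι 1ℤ * z ^ d
              ≈⟨ solve 2 (λ y w → y := (y :+ con (+ 2) :* w) :+ con (+ 2) :* (:- w)) refl (ι 1ℤ * z ^ d) w ⟩
            (ι 1ℤ * z ^ d + ι (+ 2) * w) + ι (+ 2) * (- w) ≈⟨ +-congʳ (trans (sym e) (zeroʳ _)) ⟩
            0# + ι (+ 2) * (- w)               ≈⟨ +-identityˡ _ ⟩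
            ι (+ 2) * (- w)                    ∎))
      in R-resp (sym (ι-cancel-≈ 1 (trans (sym (*-assoc _ _ _)) f))) u∈R
      where
      z : Carrier
      z = ι (+ 2) * k * x

    odd-denominator : ∀ {x} → 𝒪 K x → ∀ D → 0 ℕ.< D → R (fromℕ K D * x) → ∃[ e ] R (ι (+ 1 ℤ.+ + 2 ℤ.* + e) * x)
    odd-denominator {x} x∈𝒪 = <-rec _ go
      where
      go : ∀ D → (∀ {D′} → D′ ℕ.< D → 0 ℕ.< D′ → R (fromℕ K D′ * x) → ∃[ e ] R (ι (+ 1 ℤ.+ + 2 ℤ.* + e) * x)) →
        0 ℕ.< D → R (fromℕ K D * x) → ∃[ e ] R (ι (+ 1 ℤ.+ + 2 ℤ.* + e) * x)
      go D rec 0<D Dx∈R with even-or-odd D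
      ... | inj₂ (e , ≡.refl) = e , R-resp (*-congʳ (reflexive (≡.cong (λ k → ι (+ 1 ℤ.+ k)) (ℤ.pos-* 2 e)))) Dx∈R
      ... | inj₁ (suc k , ≡.refl) = rec (ℕ.m<m+n (suc k) ℕ.z<s) ℕ.z<s
        (halve x∈𝒪 (R-ℕ (suc k)) (R-resp (*-congʳ (trans (reflexive (≡.cong ι (ℤ.pos-* 2 (suc k)))) (ι-* (+ 2) (+ suc k)))) Dx∈R))

    module _ (denominator : ∀ x → ∃[ D ] 0 ℕ.< D × R (fromℕ K D * x)) where

      -- With r = (1 + 2 e) x in the order, x = r - 2 e x is congruent to `r` modulo 2 𝒪, and the
      -- congruence for `r` carries over.
      𝒪-fourth-power : ∀ {x} → 𝒪 K x → ∃[ w ] 𝒪 K w × (x * x) * (x * x) ≈ x + ι (+ 2) * w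
      𝒪-fourth-power {x} x∈𝒪 =
        let (D , 0<D , Dx∈R) = denominator x
            (e , r∈R) = odd-denominator x∈𝒪 D 0<D Dx∈R
            E = ι (+ e)
            r = ι (+ 1 ℤ.+ + 2 ℤ.* + e) * x
            y = E * x
            (w , w∈R , f) = R-fourth-power r∈R
            r∈𝒪 = R⊆𝒪 r∈R
            y∈𝒪 = 𝒪-* (𝒪-ℤ (+ e)) x∈𝒪
            x≈ : x ≈ r - ι (+ 2) * y
            x≈ = begin
              x  ≈⟨ solve 2 (λ e x → x := (con (+ 1) :+ con (+ 2) :* e) :* x :- con (+ 2) :* (e :* x)) refl E x ⟩
              (ι (+ 1) + ι (+ 2) * E) * x - ι (+ 2) * y
                ≈⟨ +-congʳ (*-congʳ (trans (+-congˡ (sym (ι-* (+ 2) (+ e)))) (sym (ι-+ (+ 1) (+ 2 ℤ.* + e))))) ⟩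
              r - ι (+ 2) * y  ∎
            -- Binomial coefficients: (r - 2 y)⁴ = r⁴ + 2 y h.
            h = (- ι (+ 4)) * (r * (r * r)) + ι (+ 12) * (r * (r * y)) - ι (+ 16) * (r * (y * y)) + ι (+ 8) * (y * (y * y))
            h∈𝒪 = 𝒪-+ (𝒪-+ (𝒪-+ (𝒪-* (𝒪-neg (𝒪-ℤ (+ 4))) (𝒪-* r∈𝒪 (𝒪-* r∈𝒪 r∈𝒪))) (𝒪-* (𝒪-ℤ (+ 12)) (𝒪-* r∈𝒪 (𝒪-* r∈𝒪 y∈𝒪)))) (𝒪-neg (𝒪-* (𝒪-ℤ (+ 16)) (𝒪-* r∈𝒪 (𝒪-* y∈𝒪 y∈𝒪))))) (𝒪-* (𝒪-ℤ (+ 8)) (𝒪-* y∈𝒪 (𝒪-* y∈𝒪 y∈𝒪)))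
        in w + y + y * h , 𝒪-+ (𝒪-+ (R⊆𝒪 w∈R) y∈𝒪) (𝒪-* y∈𝒪 h∈𝒪) , (begin
          (x * x) * (x * x) ≈⟨ *-cong (*-cong x≈ x≈) (*-cong x≈ x≈) ⟩
          ((r - ι (+ 2) * y) * (r - ι (+ 2) * y)) * ((r - ι (+ 2) * y) * (r - ι (+ 2) * y))
            ≈⟨ solve 2 (λ r y → ((r :- con (+ 2) :* y) :* (r :- con (+ 2) :* y)) :* ((r :- con (+ 2) :* y) :* (r :- con (+ 2) :* y)) :=
                 (r :* r) :* (r :* r) :+ con (+ 2) :* (y :* ((:- con (+ 4)) :* (r :* (r :* r)) :+ con (+ 12) :* (r :* (r :* y)) :- con (+ 16) :* (r :* (y :* y)) :+ con (+ 8) :* (y :* (y :* y))))) refl r y ⟩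
          (r * r) * (r * r) + ι (+ 2) * (y * h) ≈⟨ +-congʳ f ⟩
          r + ι (+ 2) * w + ι (+ 2) * (y * h)
            ≈⟨ solve 4 (λ r y w z → r :+ con (+ 2) :* w :+ con (+ 2) :* z :=
                 (r :- con (+ 2) :* y) :+ con (+ 2) :* (w :+ y :+ z)) refl r y w (y * h) ⟩
          (r - ι (+ 2) * y) + ι (+ 2) * (w + y + y * h) ≈⟨ +-congʳ x≈ ⟨
          x + ι (+ 2) * (w + y + y * h) ∎)

  -- Explicit denominators in ℚ(√-m, √n)

  module Fractions {c ℓ₁ ℓ₂ : Level} (K : HeytingField c ℓ₁ ℓ₂) (charZero : CharacteristicZero K)
    (m′ n : ℕ) (s t : HeytingField.Carrier K)
    (s²≈ : HeytingField._≈_ K (HeytingField._*_ K s s) (HeytingField.-_ K (fromℕ K (suc m′))))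
    (t²≈ : HeytingField._≈_ K (HeytingField._*_ K t t) (fromℕ K n))
    where

    open Integers K
    open CharacteristicZeroField K charZero public

    private
      m : ℕ
      m = suc m′

    -- ℚ(s), with explicit denominators
    E : Carrier → Set ℓ₁
    E x = ∃[ D ] ∃[ a ] ∃[ b ] ι (+ suc D) * x ≈ ι a + ι b * s

    E-resp : ∀ {x y} → x ≈ y → E x → E y
    E-resp x≈y (D , a , b , e) = D , a , b , trans (*-congˡ (sym x≈y)) e

    E-ℤ : ∀ i → E (ι i)
    E-ℤ i = 0 , i , 0ℤ , solve 2 (λ i s → con (+ 1) :* i := i :+ con 0ℤ :* s) refl (ι i) s

    E-s : E s
    E-s = 0 , 0ℤ , + 1 , solve 1 (λ s → con (+ 1) :* s := con 0ℤ :+ con (+ 1) :* s) refl s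

    E-+ : ∀ {x y} → E x → E y → E (x + y)
    E-+ {x} {y} (D , a , b , e) (D′ , a′ , b′ , e′) =
      -- Denominators are stored as predecessors; the successor of the first entry computes to
      -- `suc D * suc D′`.
      D′ ℕ.+ D ℕ.* suc D′ , + suc D′ ℤ.* a ℤ.+ + suc D ℤ.* a′ , + suc D′ ℤ.* b ℤ.+ + suc D ℤ.* b′ , (begin
      ι (+ suc D ℤ.* + suc D′) * (x + y)  ≈⟨ *-congʳ (ι-* (+ suc D) (+ suc D′)) ⟩
      d * d′ * (x + y)
        ≈⟨ solve 4 (λ d d′ x y → d :* d′ :* (x :+ y) := d′ :* (d :* x) :+ d :* (d′ :* y)) refl d d′ x y ⟩
      d′ * (d * x) + d * (d′ * y)         ≈⟨ +-cong (*-congˡ e) (*-congˡ e′) ⟩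
      d′ * (ι a + ι b * s) + d * (ι a′ + ι b′ * s)
        ≈⟨ solve 7 (λ d d′ a b a′ b′ s → d′ :* (a :+ b :* s) :+ d :* (a′ :+ b′ :* s) :=
             (d′ :* a :+ d :* a′) :+ (d′ :* b :+ d :* b′) :* s) refl d d′ (ι a) (ι b) (ι a′) (ι b′) s ⟩
      (d′ * ι a + d * ι a′) + (d′ * ι b + d * ι b′) * s  ≈⟨ +-cong (push a a′) (*-congʳ (push b b′)) ⟨
      ι (+ suc D′ ℤ.* a ℤ.+ + suc D ℤ.* a′) + ι (+ suc D′ ℤ.* b ℤ.+ + suc D ℤ.* b′) * s ∎)
      where
      d d′ : Carrier
      d  = ι (+ suc D)
      d′ = ι (+ suc D′)
      push : ∀ i j → ι (+ suc D′ ℤ.* i ℤ.+ + suc D ℤ.* j) ≈ d′ * ι i + d * ι j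
      push i j = trans (ι-+ (+ suc D′ ℤ.* i) (+ suc D ℤ.* j)) (+-cong (ι-* (+ suc D′) i) (ι-* (+ suc D) j))

    E-* : ∀ {x y} → E x → E y → E (x * y)
    E-* {x} {y} (D , a , b , e) (D′ , a′ , b′ , e′) =
      D′ ℕ.+ D ℕ.* suc D′ , a ℤ.* a′ ℤ.+ ℤ.- + m ℤ.* (b ℤ.* b′) , a ℤ.* b′ ℤ.+ b ℤ.* a′ , (begin
      ι (+ suc D ℤ.* + suc D′) * (x * y)  ≈⟨ *-congʳ (ι-* (+ suc D) (+ suc D′)) ⟩
      d * d′ * (x * y)
        ≈⟨ solve 4 (λ d d′ x y → d :* d′ :* (x :* y) := (d :* x) :* (d′ :* y)) refl d d′ x y ⟩
      (d * x) * (d′ * y)                  ≈⟨ *-cong e e′ ⟩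
      (ι a + ι b * s) * (ι a′ + ι b′ * s)
        ≈⟨ solve 5 (λ a b a′ b′ s → (a :+ b :* s) :* (a′ :+ b′ :* s) :=
             (a :* a′ :+ (s :* s) :* (b :* b′)) :+ (a :* b′ :+ b :* a′) :* s) refl (ι a) (ι b) (ι a′) (ι b′) s ⟩
      (ι a * ι a′ + (s * s) * (ι b * ι b′)) + (ι a * ι b′ + ι b * ι a′) * s  ≈⟨ +-congʳ (+-congˡ (*-congʳ s²≈)) ⟩
      (ι a * ι a′ + ι (ℤ.- + m) * (ι b * ι b′)) + (ι a * ι b′ + ι b * ι a′) * s
        ≈⟨ +-cong (trans (ι-+ (a ℤ.* a′) (ℤ.- + m ℤ.* (b ℤ.* b′))) (+-cong (ι-* a a′) (trans (ι-* (ℤ.- + m) (b ℤ.* b′)) (*-congˡ (ι-* b b′)))))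
                  (*-congʳ (trans (ι-+ (a ℤ.* b′) (b ℤ.* a′)) (+-cong (ι-* a b′) (ι-* b a′)))) ⟨
      ι (a ℤ.* a′ ℤ.+ ℤ.- + m ℤ.* (b ℤ.* b′)) + ι (a ℤ.* b′ ℤ.+ b ℤ.* a′) * s ∎)
      where
      d d′ : Carrier
      d  = ι (+ suc D)
      d′ = ι (+ suc D′)

    E-reciprocal : ∀ k → E (proj₁ (reciprocal k))
    E-reciprocal k = k , + 1 , 0ℤ , trans (*-comm _ _) (trans (proj₂ (reciprocal k)) (trans (sym ι-1)
      (solve 1 (λ s → con (+ 1) := con (+ 1) :+ con 0ℤ :* s) refl s)))

    E-neg : ∀ {x} → E x → E (- x)
    E-neg {x} p = E-resp (solve 1 (λ x → con -[1+ 0 ] :* x := :- x) refl x) (E-* (E-ℤ -[1+ 0 ]) p)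

    norm : ℤ → ℤ → ℕ
    norm a b = ℤ.∣ a ∣ ℕ.* ℤ.∣ a ∣ ℕ.+ m ℕ.* (ℤ.∣ b ∣ ℕ.* ℤ.∣ b ∣)

    norm-ℤ : ∀ a b → + norm a b ≡ a ℤ.* a ℤ.+ + m ℤ.* (b ℤ.* b)
    norm-ℤ a b = ≡.cong₂ ℤ._+_ (≡.sym (∣i∣*∣i∣ a)) (≡.trans (ℤ.pos-* m (ℤ.∣ b ∣ ℕ.* ℤ.∣ b ∣)) (≡.cong (+ m ℤ.*_) (≡.sym (∣i∣*∣i∣ b))))

    norm-conjugate : ∀ a b → (ι a + ι b * s) * (ι a - ι b * s) ≈ fromℕ K (norm a b)
    norm-conjugate a b = begin
      (ι a + ι b * s) * (ι a - ι b * s)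
        ≈⟨ solve 3 (λ a b s → (a :+ b :* s) :* (a :- b :* s) := a :* a :+ (:- (s :* s)) :* (b :* b)) refl (ι a) (ι b) s ⟩
      ι a * ι a + - (s * s) * (ι b * ι b) ≈⟨ +-congˡ (*-congʳ (trans (-‿cong s²≈) (-‿involutive _))) ⟩
      ι a * ι a + ι (+ m) * (ι b * ι b)  ≈⟨ +-cong (ι-* a a) (trans (ι-* (+ m) (b ℤ.* b)) (*-congˡ (ι-* b b))) ⟨
      ι (a ℤ.* a) + ι (+ m ℤ.* (b ℤ.* b)) ≈⟨ ι-+ (a ℤ.* a) (+ m ℤ.* (b ℤ.* b)) ⟨
      ι (a ℤ.* a ℤ.+ + m ℤ.* (b ℤ.* b))  ≡⟨ ≡.cong ι (norm-ℤ a b) ⟨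
      fromℕ K (norm a b)                 ∎

    norm-zero : ∀ a b → norm a b ≡ 0 → a ≡ 0ℤ × b ≡ 0ℤ
    norm-zero a b e = square-zero a (ℕ.m+n≡0⇒m≡0 _ e) , square-zero b (ℕ.m+n≡0⇒m≡0 _ (ℕ.m+n≡0⇒n≡0 (ℤ.∣ a ∣ ℕ.* ℤ.∣ a ∣) e))
      where
      square-zero : ∀ i → ℤ.∣ i ∣ ℕ.* ℤ.∣ i ∣ ≡ 0 → i ≡ 0ℤ
      square-zero (+ zero) _ = ≡.refl

    -- Decidable although equality in `K` is not: the norm a² + m b² is a natural number, zero only
    -- for a = b = 0 because m > 0, and otherwise the conjugate yields the inverse.
    E-zero-or-invertible : ∀ {x} → E x → x ≈ 0# ⊎ (∃[ y ] E y × x * y ≈ 1#)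
    E-zero-or-invertible {x} (D , a , b , e) with norm a b in eq
    ... | zero  = inj₁ (ι-cancel D (trans e (let (a≡0 , b≡0) = norm-zero a b eq in
          trans (+-cong (reflexive (≡.cong ι a≡0)) (*-congʳ (reflexive (≡.cong ι b≡0)))) (trans (+-identityˡ _) (zeroˡ s)))))
    ... | suc k = inj₂ (y , E-* (E-* (E-reciprocal k) (E-ℤ (+ suc D))) (E-+ (E-ℤ a) (E-neg (E-* (E-ℤ b) E-s))) , (begin
          x * (r * ι (+ suc D) * (ι a - ι b * s))
            ≈⟨ solve 4 (λ x r d z → x :* (r :* d :* z) := r :* ((d :* x) :* z)) refl x r (ι (+ suc D)) (ι a - ι b * s) ⟩
          r * ((ι (+ suc D) * x) * (ι a - ι b * s)) ≈⟨ *-congˡ (trans (*-congʳ e) (norm-conjugate a b)) ⟩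
          r * fromℕ K (norm a b)                   ≡⟨ ≡.cong (λ k → r * fromℕ K k) eq ⟩
          r * ι (+ suc k)                          ≈⟨ proj₂ (reciprocal k) ⟩
          1#                                       ∎))
      where
      r : Carrier
      r = proj₁ (reciprocal k)
      y : Carrier
      y = r * ι (+ suc D) * (ι a - ι b * s)

    -- ℚ(s, t)
    F : Carrier → Set (c ⊔ ℓ₁)
    F x = ∃[ A ] ∃[ B ] E A × E B × x ≈ A + B * t

    F-resp : ∀ {x y} → x ≈ y → F x → F y
    F-resp x≈y (A , B , a , b , e) = A , B , a , b , trans (sym x≈y) e

    E⊆F : ∀ {x} → E x → F x
    E⊆F {x} a = x , ι 0ℤ , a , E-ℤ 0ℤ , solve 2 (λ x t → x := x :+ con 0ℤ :* t) refl x t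

    F-t : F t
    F-t = ι 0ℤ , ι (+ 1) , E-ℤ 0ℤ , E-ℤ (+ 1) , solve 1 (λ t → t := con 0ℤ :+ con (+ 1) :* t) refl t

    F-+ : ∀ {x y} → F x → F y → F (x + y)
    F-+ (A , B , a , b , e) (A′ , B′ , a′ , b′ , e′) = A + A′ , B + B′ , E-+ a a′ , E-+ b b′ ,
      trans (+-cong e e′) (solve 5 (λ A B A′ B′ t → (A :+ B :* t) :+ (A′ :+ B′ :* t) := (A :+ A′) :+ (B :+ B′) :* t) refl A B A′ B′ t)

    F-* : ∀ {x y} → F x → F y → F (x * y)
    F-* (A , B , a , b , e) (A′ , B′ , a′ , b′ , e′) = A * A′ + ι (+ n) * (B * B′) , A * B′ + B * A′ ,
      E-+ (E-* a a′) (E-* (E-ℤ (+ n)) (E-* b b′)) , E-+ (E-* a b′) (E-* b a′) ,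
      trans (*-cong e e′) (trans (solve 5 (λ A B A′ B′ t → (A :+ B :* t) :* (A′ :+ B′ :* t) := (A :* A′ :+ (t :* t) :* (B :* B′)) :+ (A :* B′ :+ B :* A′) :* t) refl A B A′ B′ t)
        (+-congʳ (+-congˡ (*-congʳ t²≈))))

    F-neg : ∀ {x} → F x → F (- x)
    F-neg {x} p = F-resp (solve 1 (λ x → con -[1+ 0 ] :* x := :- x) refl x) (F-* (E⊆F (E-ℤ -[1+ 0 ])) p)

    -- The norm is (A + B t)(A - B t) and the first factor is invertible, so A = B t.
    norm-zero⇒2A : ∀ {x y A B} → x * y ≈ 1# → x ≈ A + B * t → A * A - ι (+ n) * (B * B) ≈ 0# → x ≈ ι (+ 2) * A
    norm-zero⇒2A {x} {y} {A} {B} xy≈1 e N≈0 = begin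
      x                          ≈⟨ e ⟩
      A + B * t                  ≈⟨ solve 2 (λ A z → A :+ z := con (+ 2) :* A :- (A :- z)) refl A (B * t) ⟩
      ι (+ 2) * A - (A - B * t)  ≈⟨ +-congˡ (trans (-‿cong A-Bt≈0) -0#≈0#) ⟩
      ι (+ 2) * A + 0#           ≈⟨ +-identityʳ _ ⟩
      ι (+ 2) * A                ∎
      where
      A-Bt≈0 : A - B * t ≈ 0#
      A-Bt≈0 = begin
        A - B * t                        ≈⟨ *-identityˡ _ ⟨
        1# * (A - B * t)                 ≈⟨ *-congʳ (trans (*-congʳ (sym e)) xy≈1) ⟨
        ((A + B * t) * y) * (A - B * t)
          ≈⟨ solve 4 (λ A B t y → ((A :+ B :* t) :* y) :* (A :- B :* t) :=
               y :* (A :* A :- (t :* t) :* (B :* B))) refl A B t y ⟩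
        y * (A * A - (t * t) * (B * B))  ≈⟨ *-congˡ (trans (+-congˡ (-‿cong (*-congʳ t²≈))) N≈0) ⟩
        y * 0#                           ≈⟨ zeroʳ y ⟩
        0#                               ∎

    -- The norm A² - n B² to ℚ(s) may vanish (e.g. when n = 1); then x = A + B t = 2 A.
    F-inverse : ∀ {x y} → x * y ≈ 1# → F x → F y
    F-inverse {x} {y} xy≈1 (A , B , a , b , e) =
      cases (E-zero-or-invertible (E-+ (E-* a a) (E-neg (E-* (E-ℤ (+ n)) (E-* b b))))) (E-zero-or-invertible a)
      where
      cases : (A * A - ι (+ n) * (B * B) ≈ 0# ⊎ ∃[ N′ ] E N′ × (A * A - ι (+ n) * (B * B)) * N′ ≈ 1#) →
              (A ≈ 0# ⊎ ∃[ A′ ] E A′ × A * A′ ≈ 1#) → F y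
      cases (inj₂ (N′ , n′ , NN′≈1)) _ = A * N′ , - B * N′ , E-* a n′ , E-* (E-neg b) n′ , (begin
        y                                            ≈⟨ *-identityʳ y ⟨
        y * 1#                                       ≈⟨ *-congˡ NN′≈1 ⟨
        y * ((A * A - ι (+ n) * (B * B)) * N′)       ≈⟨ *-congˡ (*-congʳ (+-congˡ (-‿cong (*-congʳ t²≈)))) ⟨
        y * ((A * A - (t * t) * (B * B)) * N′)
          ≈⟨ solve 5 (λ A B t N y → y :* ((A :* A :- (t :* t) :* (B :* B)) :* N) :=
               ((A :+ B :* t) :* y) :* (A :* N :+ (:- B) :* N :* t)) refl A B t N′ y ⟩
        ((A + B * t) * y) * (A * N′ + - B * N′ * t)  ≈⟨ *-congʳ (trans (*-congʳ (sym e)) xy≈1) ⟩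
        1# * (A * N′ + - B * N′ * t)                 ≈⟨ *-identityˡ _ ⟩
        A * N′ + - B * N′ * t                        ∎)
      cases (inj₁ N≈0) (inj₁ A≈0) = contradiction (begin
        1#                ≈⟨ xy≈1 ⟨
        x * y             ≈⟨ *-congʳ (norm-zero⇒2A xy≈1 e N≈0) ⟩
        ι (+ 2) * A * y   ≈⟨ *-congʳ (trans (*-congˡ A≈0) (zeroʳ _)) ⟩
        0# * y            ≈⟨ zeroˡ y ⟩
        0#                ∎) 1≉0
      cases (inj₁ N≈0) (inj₂ (A′ , a′ , AA′≈1)) = E⊆F (E-resp (sym y≈) (E-* (E-reciprocal 1) a′))
        where
        y≈ : y ≈ half * A′
        y≈ = begin
          y
            ≈⟨ trans (*-congʳ (trans (*-cong half-2 AA′≈1) (*-identityʳ 1#))) (*-identityˡ y) ⟨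
          (half * ι (+ 2)) * (A * A′) * y
            ≈⟨ solve 5 (λ h k A A′ y → (h :* k) :* (A :* A′) :* y := h :* A′ :* (k :* A :* y)) refl half (ι (+ 2)) A A′ y ⟩
          half * A′ * (ι (+ 2) * A * y)    ≈⟨ *-congˡ (trans (*-congʳ (sym (norm-zero⇒2A xy≈1 e N≈0))) xy≈1) ⟩
          half * A′ * 1#                   ≈⟨ *-identityʳ _ ⟩
          half * A′                        ∎

    Adjoin⊆F : ∀ {x} → Adjoin K (λ y → y ≈ s ⊎ y ≈ t) x → F x
    Adjoin⊆F (gen (inj₁ e)) = F-resp (sym e) (E⊆F E-s)
    Adjoin⊆F (gen (inj₂ e)) = F-resp (sym e) F-t
    Adjoin⊆F one            = F-resp ι-1 (E⊆F (E-ℤ (+ 1)))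
    Adjoin⊆F (add p q)      = F-+ (Adjoin⊆F p) (Adjoin⊆F q)
    Adjoin⊆F (neg p)        = F-neg (Adjoin⊆F p)
    Adjoin⊆F (mul p q)      = F-* (Adjoin⊆F p) (Adjoin⊆F q)
    Adjoin⊆F (inv e p)      = F-inverse e (Adjoin⊆F p)
    Adjoin⊆F (resp e p)     = F-resp e (Adjoin⊆F p)

  -- Sums of two and of three squares in 𝒪

  module Biquadratic {c ℓ₁ ℓ₂ : Level} (K : HeytingField c ℓ₁ ℓ₂) (j l : ℕ)
    (isK : Isℚ⟨√-_,√_⟩ K (3 ℕ.+ 8 ℕ.* j) (1 ℕ.+ 4 ℕ.* l)) where

    open Integers K
    open Isℚ⟨√-_,√_⟩ isK renaming (√-m to s; √n to t; √-m-square to s²≈; √n-square to t²≈)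
    open CharacteristicZeroField K characteristicZero using (half; half-2; ι-cancel-≈)
    open Fractions K characteristicZero (2 ℕ.+ 8 ℕ.* j) (1 ℕ.+ 4 ℕ.* l) s t s²≈ t²≈ using (E; F; Adjoin⊆F)

    m n : ℕ
    m = 3 ℕ.+ 8 ℕ.* j
    n = 1 ℕ.+ 4 ℕ.* l

    double-half : ∀ r → ι (+ 2) * (half * (1# + r)) ≈ ι 1ℤ + r
    double-half r = begin
      ι (+ 2) * (half * (1# + r))  ≈⟨ solve 3 (λ k h r → k :* (h :* r) := (h :* k) :* r) refl (ι (+ 2)) half (1# + r) ⟩
      (half * ι (+ 2)) * (1# + r)  ≈⟨ *-congʳ half-2 ⟩
      1# * (1# + r)                ≈⟨ *-identityˡ _ ⟩
      1# + r                       ≈⟨ +-congʳ ι-1 ⟨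
      ι 1ℤ + r                     ∎

    half-quadratic : ∀ {r} z k → r * r ≈ ι z → z ≡ 1ℤ ℤ.+ + 4 ℤ.* k →
      (half * (1# + r)) * (half * (1# + r)) ≈ half * (1# + r) + ι k
    half-quadratic {r} z k r²≈z z≡1+4k = ι-cancel-≈ 3 (begin
      ι (+ 4) * (x * x)
        ≈⟨ solve 1 (λ x → con (+ 4) :* (x :* x) := (con (+ 2) :* x) :* (con (+ 2) :* x)) refl x ⟩
      (ι (+ 2) * x) * (ι (+ 2) * x)    ≈⟨ *-cong (double-half r) (double-half r) ⟩
      (ι 1ℤ + r) * (ι 1ℤ + r)
        ≈⟨ solve 1 (λ r → (con 1ℤ :+ r) :* (con 1ℤ :+ r) := con 1ℤ :+ con (+ 2) :* r :+ r :* r) refl r ⟩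
      ι 1ℤ + ι (+ 2) * r + r * r
        ≈⟨ +-congˡ (trans r²≈z (trans (reflexive (≡.cong ι z≡1+4k)) (trans (ι-+ 1ℤ (+ 4 ℤ.* k)) (+-congˡ (ι-* (+ 4) k))))) ⟩
      ι 1ℤ + ι (+ 2) * r + (ι 1ℤ + ι (+ 4) * ι k)
        ≈⟨ solve 2 (λ r k → con 1ℤ :+ con (+ 2) :* r :+ (con 1ℤ :+ con (+ 4) :* k) :=
             con (+ 2) :* (con 1ℤ :+ r) :+ con (+ 4) :* k) refl r (ι k) ⟩
      ι (+ 2) * (ι 1ℤ + r) + ι (+ 4) * ι k ≈⟨ +-congʳ (*-congˡ (double-half r)) ⟨
      ι (+ 2) * (ι (+ 2) * x) + ι (+ 4) * ι k
        ≈⟨ solve 2 (λ x k → con (+ 2) :* (con (+ 2) :* x) :+ con (+ 4) :* k := con (+ 4) :* (x :+ k)) refl x (ι k) ⟩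
      ι (+ 4) * (x + ι k)              ∎)
      where
      x : Carrier
      x = half * (1# + r)

    α β : Carrier
    α = half * (1# + s)
    β = half * (1# + t)

    -- κ = (m + 1) / 4 is the norm of α from ℚ(√-m). It is odd since m ≡ 3 modulo 8, and this
    -- oddness is what defeats two squares.
    -κ : ℤ
    -κ = ℤ.- (1ℤ ℤ.+ + 2 ℤ.* + j)

    -m≡1-4κ : ℤ.- + m ≡ 1ℤ ℤ.+ + 4 ℤ.* -κ
    -m≡1-4κ = ≡.trans (≡.cong (λ k → ℤ.- (+ 3 ℤ.+ k)) (ℤ.pos-* 8 j)) (shift (+ j))
      where
      shift : ∀ j → ℤ.- (+ 3 ℤ.+ + 8 ℤ.* j) ≡ 1ℤ ℤ.+ + 4 ℤ.* ℤ.- (1ℤ ℤ.+ + 2 ℤ.* j)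
      shift = solve-∀

    α-eq : α * α ≈ α + ι -κ
    α-eq = half-quadratic (ℤ.- + m) -κ s²≈ -m≡1-4κ

    β-eq : β * β ≈ β + ι (+ l)
    β-eq = half-quadratic (+ n) (+ l) t²≈ (≡.cong (λ k → 1ℤ ℤ.+ k) (ℤ.pos-* 4 l))

    open Order K characteristicZero α β -κ (+ l) α-eq β-eq hiding (half; half-2; ι-cancel-≈)

    R-s : R s
    R-s = R-resp (trans (+-congʳ (double-half s)) (solve 1 (λ s → con 1ℤ :+ s :- con 1ℤ := s) refl s)) (R-+ (R-* (R-ℤ (+ 2)) R-α) (R-neg (R-ℤ 1ℤ)))

    R-t : R t
    R-t = R-resp (trans (+-congʳ (double-half t)) (solve 1 (λ s → con 1ℤ :+ s :- con 1ℤ := s) refl t)) (R-+ (R-* (R-ℤ (+ 2)) R-β) (R-neg (R-ℤ 1ℤ)))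

    F-denominator : ∀ {x} → F x → ∃[ D ] 0 ℕ.< D × R (fromℕ K D * x)
    F-denominator {x} (A , B , (D , a , b , e) , (D′ , a′ , b′ , e′) , f) = suc D ℕ.* suc D′ , ℕ.z<s , R-resp (begin
      d′ * (ι a + ι b * s) + d * ((ι a′ + ι b′ * s) * t)  ≈⟨ +-cong (*-congˡ e) (*-congˡ (*-congʳ e′)) ⟨
      d′ * (d * A) + d * ((d′ * B) * t)
        ≈⟨ solve 5 (λ d d′ A B t → d′ :* (d :* A) :+ d :* ((d′ :* B) :* t) := d :* d′ :* (A :+ B :* t)) refl d d′ A B t ⟩
      d * d′ * (A + B * t)                ≈⟨ *-cong (ι-* (+ suc D) (+ suc D′)) f ⟨
      ι (+ suc D ℤ.* + suc D′) * x        ∎)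
      (R-+ (R-* (R-ℕ (suc D′)) (R-+ (R-ℤ a) (R-* (R-ℤ b) R-s))) (R-* (R-ℕ (suc D)) (R-* (R-+ (R-ℤ a′) (R-* (R-ℤ b′) R-s)) R-t)))
      where
      d d′ : Carrier
      d  = ι (+ suc D)
      d′ = ι (+ suc D′)

    fourth-power : ∀ {x} → 𝒪 K x → ∃[ w ] 𝒪 K w × (x * x) * (x * x) ≈ x + ι (+ 2) * w
    fourth-power = 𝒪-fourth-power (λ x → F-denominator (Adjoin⊆F (generates x)))

    α∈𝒪 : 𝒪 K α
    α∈𝒪 = R⊆𝒪 R-α

    𝒪-minus : ∀ {x y} → 𝒪 K x → 𝒪 K y → 𝒪 K (x - y)
    𝒪-minus p q = 𝒪-+ p (𝒪-neg q)

    module _ (a b : ℤ) (ab-eq : (1ℤ ℤ.+ + 2 ℤ.* a) ℤ.* (1ℤ ℤ.+ + 2 ℤ.* a) ℤ.+ + 2 ≡ + m ℤ.* ((1ℤ ℤ.+ + 2 ℤ.* b) ℤ.* (1ℤ ℤ.+ + 2 ℤ.* b))) where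

      B : Carrier
      B = ι 1ℤ + ι (+ 2) * ι b

      -- These are ((1 + 2 a) ± (1 + 2 b) √-m) / 2, rewritten through α so that integrality is
      -- visible.
      u v : Carrier
      u = ι a - ι b + B * α
      v = ι a + ι b + ι 1ℤ - B * α

      u∈𝒪 : 𝒪 K u
      u∈𝒪 = 𝒪-+ (𝒪-minus (𝒪-ℤ a) (𝒪-ℤ b)) (𝒪-* (𝒪-+ (𝒪-ℤ 1ℤ) (𝒪-* (𝒪-ℤ (+ 2)) (𝒪-ℤ b))) α∈𝒪)

      v∈𝒪 : 𝒪 K v
      v∈𝒪 = 𝒪-minus (𝒪-+ (𝒪-+ (𝒪-ℤ a) (𝒪-ℤ b)) (𝒪-ℤ 1ℤ)) (𝒪-* (𝒪-+ (𝒪-ℤ 1ℤ) (𝒪-* (𝒪-ℤ (+ 2)) (𝒪-ℤ b))) α∈𝒪)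

      ι-odd : ∀ a → ι (1ℤ ℤ.+ + 2 ℤ.* a) ≈ ι 1ℤ + ι (+ 2) * ι a
      ι-odd a = trans (ι-+ 1ℤ (+ 2 ℤ.* a)) (+-congˡ (ι-* (+ 2) a))

      u²+v²≈-1 : u * u + v * v ≈ ι -[1+ 0 ]
      u²+v²≈-1 = ι-cancel-≈ 3 (begin
        ι (+ 4) * (u * u + v * v)
          ≈⟨ solve 3 (λ a b α → let B = con 1ℤ :+ con (+ 2) :* b ; u = a :- b :+ B :* α ; v = a :+ b :+ con 1ℤ :- B :* α ; s = con (+ 2) :* α :- con 1ℤ in
               con (+ 4) :* (u :* u :+ v :* v) := con (+ 2) :* ((con 1ℤ :+ con (+ 2) :* a) :* (con 1ℤ :+ con (+ 2) :* a) :+ (B :* B) :* (s :* s))) refl (ι a) (ι b) α ⟩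
        ι (+ 2) * (A * A + (B * B) * ((ι (+ 2) * α - ι 1ℤ) * (ι (+ 2) * α - ι 1ℤ)))
          ≈⟨ *-congˡ (+-congˡ (*-congˡ (trans (*-cong s≈ s≈) s²≈))) ⟩
        ι (+ 2) * (A * A + (B * B) * - ι (+ m))
          ≈⟨ solve 3 (λ A B m → con (+ 2) :* (A :* A :+ (B :* B) :* (:- m)) :=
               con (+ 2) :* ((A :* A :+ con (+ 2)) :- m :* (B :* B)) :- con (+ 4)) refl A B (ι (+ m)) ⟩
        ι (+ 2) * ((A * A + ι (+ 2)) - ι (+ m) * (B * B)) - ι (+ 4)
          ≈⟨ +-congʳ (*-congˡ (trans (+-congʳ A²+2≈mB²) (-‿inverseʳ _))) ⟩
        ι (+ 2) * 0# - ι (+ 4)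
          ≈⟨ solve 0 (con (+ 2) :* con 0ℤ :- con (+ 4) := con (+ 4) :* con -[1+ 0 ]) refl ⟩
        ι (+ 4) * ι -[1+ 0 ] ∎)
        where
        A : Carrier
        A = ι 1ℤ + ι (+ 2) * ι a
        s≈ : ι (+ 2) * α - ι 1ℤ ≈ s
        s≈ = trans (+-congʳ (double-half s)) (solve 1 (λ s → con 1ℤ :+ s :- con 1ℤ := s) refl s)
        a′ b′ : ℤ
        a′ = 1ℤ ℤ.+ + 2 ℤ.* a
        b′ = 1ℤ ℤ.+ + 2 ℤ.* b
        A²+2≈mB² : A * A + ι (+ 2) ≈ ι (+ m) * (B * B)
        A²+2≈mB² = begin
          A * A + ι (+ 2)             ≈⟨ +-congʳ (*-cong (ι-odd a) (ι-odd a)) ⟨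
          ι a′ * ι a′ + ι (+ 2)       ≈⟨ +-congʳ (ι-* a′ a′) ⟨
          ι (a′ ℤ.* a′) + ι (+ 2)     ≈⟨ ι-+ (a′ ℤ.* a′) (+ 2) ⟨
          ι (a′ ℤ.* a′ ℤ.+ + 2)       ≡⟨ ≡.cong ι ab-eq ⟩
          ι (+ m ℤ.* (b′ ℤ.* b′))     ≈⟨ ι-* (+ m) (b′ ℤ.* b′) ⟩
          ι (+ m) * ι (b′ ℤ.* b′)     ≈⟨ *-congˡ (ι-* b′ b′) ⟩
          ι (+ m) * (ι b′ * ι b′)     ≈⟨ *-congˡ (*-cong (ι-odd b) (ι-odd b)) ⟩
          ι (+ m) * (B * B)           ∎

      -- With c = (x + 1)², x + c² is odd, hence a difference of two consecutive
      -- squares, and -1 = u² + v² turns x = (y + 1)² - (y² + c²) into a sum.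
      three-squares : AllSumsOfSquares𝒪 K 3
      three-squares x x∈𝒪 =
        let x+1∈𝒪 = 𝒪-+ x∈𝒪 (𝒪-ℤ 1ℤ)
            (w , w∈𝒪 , e) = fourth-power x+1∈𝒪
            -- (x + 1)⁴ = x + 1 + 2 w gives x + c² = 2 y + 1 = (y + 1)² - y².
            y = x + w
            c = (x + ι 1ℤ) * (x + ι 1ℤ)
            y∈𝒪 = 𝒪-+ x∈𝒪 w∈𝒪
            c∈𝒪 = 𝒪-* x+1∈𝒪 x+1∈𝒪
        -- The last two entries come from the two-square identity for (u² + v²)(y² + c²).
        in (y + ι 1ℤ) ∷ (u * y - v * c) ∷ (u * c + v * y) ∷ [] ,
          (λ { zero → 𝒪-+ y∈𝒪 (𝒪-ℤ 1ℤ)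
             ; (suc zero) → 𝒪-minus (𝒪-* u∈𝒪 y∈𝒪) (𝒪-* v∈𝒪 c∈𝒪)
             ; (suc (suc zero)) → 𝒪-+ (𝒪-* u∈𝒪 c∈𝒪) (𝒪-* v∈𝒪 y∈𝒪) }) , (begin
          x
            ≈⟨ solve 2 (λ x w → let y = x :+ w in x :=
                 (y :+ con 1ℤ) :* (y :+ con 1ℤ) :+ con -[1+ 0 ] :* (y :* y :+ (x :+ con 1ℤ :+ con (+ 2) :* w))) refl x w ⟩
          (y + ι 1ℤ) * (y + ι 1ℤ) + ι -[1+ 0 ] * (y * y + (x + ι 1ℤ + ι (+ 2) * w))
            ≈⟨ +-congˡ (*-cong u²+v²≈-1 (+-congˡ e)) ⟨
          (y + ι 1ℤ) * (y + ι 1ℤ) + (u * u + v * v) * (y * y + c * c)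
            ≈⟨ solve 4 (λ y c u v → (y :+ con 1ℤ) :* (y :+ con 1ℤ) :+ (u :* u :+ v :* v) :* (y :* y :+ c :* c) :=
                 (y :+ con 1ℤ) :* (y :+ con 1ℤ) :+ ((u :* y :- v :* c) :* (u :* y :- v :* c) :+ ((u :* c :+ v :* y) :* (u :* c :+ v :* y) :+ con 0ℤ))) refl y c u v ⟩
          (y + ι 1ℤ) * (y + ι 1ℤ) + ((u * y - v * c) * (u * y - v * c) + ((u * c + v * y) * (u * c + v * y) + 0#)) ∎)

    -- If 1 + 2 α = y² + z² then y + z ≡ 1, hence α ≡ z² - z and α² + α ≡ z⁴ - z ≡ 0
    -- modulo 2, whereas α² + α ≡ κ ≡ 1.
    module _ {y z w w′ : Carrier} (y∈𝒪 : 𝒪 K y) (z∈𝒪 : 𝒪 K z) (w∈𝒪 : 𝒪 K w) (w′∈𝒪 : 𝒪 K w′)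
      (eq : ι 1ℤ + ι (+ 2) * α ≈ y * y + z * z)
      (e : ((y + z) * (y + z)) * ((y + z) * (y + z)) ≈ (y + z) + ι (+ 2) * w)
      (e′ : (z * z) * (z * z) ≈ z + ι (+ 2) * w′) where

      private
        g : Carrier
        g = α + y * z
        g∈𝒪 : 𝒪 K g
        g∈𝒪 = 𝒪-+ α∈𝒪 (𝒪-* y∈𝒪 z∈𝒪)
        d : Carrier
        d = ι (+ 2) * (g + g * g) - w
        d∈𝒪 : 𝒪 K d
        d∈𝒪 = 𝒪-minus (𝒪-* (𝒪-ℤ (+ 2)) (𝒪-+ g∈𝒪 (𝒪-* g∈𝒪 g∈𝒪))) w∈𝒪
        f : Carrier
        f = d + d * d - d * z
        f∈𝒪 : 𝒪 K f
        f∈𝒪 = 𝒪-minus (𝒪-+ d∈𝒪 (𝒪-* d∈𝒪 d∈𝒪)) (𝒪-* d∈𝒪 z∈𝒪)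
        q²≈ : (y + z) * (y + z) ≈ ι 1ℤ + ι (+ 2) * g
        q²≈ = begin
          (y + z) * (y + z)
            ≈⟨ solve 2 (λ y z → (y :+ z) :* (y :+ z) := (y :* y :+ z :* z) :+ con (+ 2) :* (y :* z)) refl y z ⟩
          (y * y + z * z) + ι (+ 2) * (y * z)      ≈⟨ +-congʳ eq ⟨
          (ι 1ℤ + ι (+ 2) * α) + ι (+ 2) * (y * z)
            ≈⟨ solve 2 (λ α p → (con 1ℤ :+ con (+ 2) :* α) :+ con (+ 2) :* p :=
                 con 1ℤ :+ con (+ 2) :* (α :+ p)) refl α (y * z) ⟩
          ι 1ℤ + ι (+ 2) * g                       ∎
        -- y + z ≡ (y + z)⁴ = (1 + 2 g)² ≡ 1 modulo 2, with `d` the explicit quotient.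
        y≈ : y ≈ ι 1ℤ + ι (+ 2) * d - z
        y≈ = begin
          y
            ≈⟨ solve 3 (λ y z w → y := ((y :+ z) :+ con (+ 2) :* w) :- con (+ 2) :* w :- z) refl y z w ⟩
          ((y + z) + ι (+ 2) * w) - ι (+ 2) * w - z ≈⟨ +-congʳ (+-congʳ e) ⟨
          ((y + z) * (y + z)) * ((y + z) * (y + z)) - ι (+ 2) * w - z ≈⟨ +-congʳ (+-congʳ (*-cong q²≈ q²≈)) ⟩
          (ι 1ℤ + ι (+ 2) * g) * (ι 1ℤ + ι (+ 2) * g) - ι (+ 2) * w - z
            ≈⟨ solve 3 (λ g w z → (con 1ℤ :+ con (+ 2) :* g) :* (con 1ℤ :+ con (+ 2) :* g) :- con (+ 2) :* w :- z :=
                 con 1ℤ :+ con (+ 2) :* (con (+ 2) :* (g :+ g :* g) :- w) :- z) refl g w z ⟩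
          ι 1ℤ + ι (+ 2) * d - z                   ∎
        -- Substituting `y≈` into 2 α = y² + z² - 1 gives a congruence modulo 4, so one modulo 2 is
        -- left after halving.
        α≈ : α ≈ z * z - z + ι (+ 2) * f
        α≈ = ι-cancel-≈ 1 (begin
          ι (+ 2) * α
            ≈⟨ solve 1 (λ α → con (+ 2) :* α := (con 1ℤ :+ con (+ 2) :* α) :- con 1ℤ) refl α ⟩
          (ι 1ℤ + ι (+ 2) * α) - ι 1ℤ              ≈⟨ +-congʳ eq ⟩
          y * y + z * z - ι 1ℤ                     ≈⟨ +-congʳ (+-congʳ (*-cong y≈ y≈)) ⟩
          (ι 1ℤ + ι (+ 2) * d - z) * (ι 1ℤ + ι (+ 2) * d - z) + z * z - ι 1ℤ
            ≈⟨ solve 2 (λ d z → (con 1ℤ :+ con (+ 2) :* d :- z) :* (con 1ℤ :+ con (+ 2) :* d :- z) :+ z :* z :- con 1ℤ :=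
                 con (+ 2) :* (z :* z :- z :+ con (+ 2) :* (d :+ d :* d :- d :* z))) refl d z ⟩
          ι (+ 2) * (z * z - z + ι (+ 2) * f)      ∎)
        h : Carrier
        h = f + ι (+ 2) * (f * f) + ι (+ 2) * (f * (z * z - z)) + z * z - z * (z * z)
        h∈𝒪 : 𝒪 K h
        h∈𝒪 = 𝒪-minus (𝒪-+ (𝒪-+ (𝒪-+ f∈𝒪 (𝒪-* (𝒪-ℤ (+ 2)) (𝒪-* f∈𝒪 f∈𝒪))) (𝒪-* (𝒪-ℤ (+ 2)) (𝒪-* f∈𝒪 (𝒪-minus (𝒪-* z∈𝒪 z∈𝒪) z∈𝒪)))) (𝒪-* z∈𝒪 z∈𝒪)) (𝒪-* z∈𝒪 (𝒪-* z∈𝒪 z∈𝒪))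
        J : Carrier
        J = ι (+ j)
        α²+α≈ : α * α + α ≈ ι (+ 2) * (w′ + h)
        α²+α≈ = begin
          α * α + α  ≈⟨ +-cong (*-cong α≈ α≈) α≈ ⟩
          (z * z - z + ι (+ 2) * f) * (z * z - z + ι (+ 2) * f) + (z * z - z + ι (+ 2) * f)
            ≈⟨ solve 2 (λ z f → let a = z :* z :- z :+ con (+ 2) :* f in a :* a :+ a :=
                 (z :* z) :* (z :* z) :- z :+ con (+ 2) :* (f :+ con (+ 2) :* (f :* f) :+ con (+ 2) :* (f :* (z :* z :- z)) :+ z :* z :- z :* (z :* z))) refl z f ⟩
          (z * z) * (z * z) - z + ι (+ 2) * h  ≈⟨ +-congʳ (+-congʳ e′) ⟩
          z + ι (+ 2) * w′ - z + ι (+ 2) * h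
            ≈⟨ solve 3 (λ z w h → z :+ con (+ 2) :* w :- z :+ con (+ 2) :* h := con (+ 2) :* (w :+ h)) refl z w′ h ⟩
          ι (+ 2) * (w′ + h)                   ∎
        ι-κ≈ : ι -κ ≈ - (ι 1ℤ + ι (+ 2) * J)
        ι-κ≈ = trans (ι-neg (1ℤ ℤ.+ + 2 ℤ.* + j)) (-‿cong (trans (ι-+ 1ℤ (+ 2 ℤ.* + j)) (+-congˡ (ι-* (+ 2) (+ j)))))

      -- Since α² + α = 2 α - 1 - 2 j is also 2 (w′ + h), an integral element would be one half.
      not-two-squares′ : ⊥
      not-two-squares′ = ½∉𝒪 (𝒪-minus (𝒪-minus α∈𝒪 (𝒪-ℤ (+ j))) (𝒪-+ w′∈𝒪 h∈𝒪)) (begin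
        ι (+ 2) * (α - J - (w′ + h))
          ≈⟨ solve 3 (λ α J x → con (+ 2) :* (α :- J :- x) := con (+ 2) :* (α :- J) :- con (+ 2) :* x) refl α J (w′ + h) ⟩
        ι (+ 2) * (α - J) - ι (+ 2) * (w′ + h) ≈⟨ +-congˡ (-‿cong α²+α≈) ⟨
        ι (+ 2) * (α - J) - (α * α + α)        ≈⟨ +-congˡ (-‿cong (+-congʳ (trans α-eq (+-congˡ ι-κ≈)))) ⟩
        ι (+ 2) * (α - J) - ((α + - (ι 1ℤ + ι (+ 2) * J)) + α)
          ≈⟨ solve 2 (λ α J → con (+ 2) :* (α :- J) :- ((α :+ (:- (con 1ℤ :+ con (+ 2) :* J))) :+ α) := con 1ℤ) refl α J ⟩
        ι 1ℤ                                   ≈⟨ ι-1 ⟩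
        1#                                     ∎)

    not-two-squares : ∀ {y z} → 𝒪 K y → 𝒪 K z → ¬ ι 1ℤ + ι (+ 2) * α ≈ y * y + z * z
    not-two-squares y∈𝒪 z∈𝒪 eq =
      let (_ , w∈𝒪 , e)   = fourth-power (𝒪-+ y∈𝒪 z∈𝒪)
          (_ , w′∈𝒪 , e′) = fourth-power z∈𝒪
      in not-two-squares′ y∈𝒪 z∈𝒪 w∈𝒪 w′∈𝒪 eq e e′

    -- The element is 2 + √-m.
    1+2α∈𝒪 : 𝒪 K (ι 1ℤ + ι (+ 2) * α)
    1+2α∈𝒪 = 𝒪-+ (𝒪-ℤ 1ℤ) (𝒪-* (𝒪-ℤ (+ 2)) α∈𝒪)

    three≤ : ∀ k → 0 ℕ.< k → AllSumsOfSquares𝒪 K k → 3 ℕ.≤ k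
    three≤ (suc zero) _ all =
      let (y , y∈𝒪 , e) = all _ 1+2α∈𝒪
      in contradiction (trans e (+-congˡ (sym (zeroˡ 0#)))) (not-two-squares (y∈𝒪 zero) (𝒪-ℤ 0ℤ))
    three≤ (suc (suc zero)) _ all =
      let (y , y∈𝒪 , e) = all _ 1+2α∈𝒪
      in contradiction (trans e (+-congˡ (+-identityʳ _))) (not-two-squares (y∈𝒪 zero) (y∈𝒪 (suc zero)))
    three≤ (suc (suc (suc k))) _ _ = ℕ.s≤s (ℕ.s≤s (ℕ.s≤s ℕ.z≤n))

    g≡3 : ∀ a b → (1ℤ ℤ.+ + 2 ℤ.* a) ℤ.* (1ℤ ℤ.+ + 2 ℤ.* a) ℤ.+ + 2 ≡ + m ℤ.* ((1ℤ ℤ.+ + 2 ℤ.* b) ℤ.* (1ℤ ℤ.+ + 2 ℤ.* b)) → g𝒪-is K 3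
    g≡3 a b e = ℕ.z<s , three-squares a b e , three≤

open import Data.Integer.Base using (1ℤ)
import Data.Integer.Base as ℤ
import Data.Integer.Properties as ℤ
open import Data.Nat.Base using (ℕ; _+_; _*_; _<_)
open import Data.Nat.DivMod using (_/_; m≡m%n+[m/n]*n)
import Data.Nat.Base as ℕ
import Data.Nat.Properties as ℕ
open import Data.Nat.Primality using (prime⇒nonZero)
open import Data.Product.Base using (_,_; ∃-syntax)
open import Relation.Binary.PropositionalEquality using (refl; sym; trans; cong; cong₂)
open Arithmetic using (Equation; odd-solution; *-%8; legendre⇒¬QR; case-I; case-II; case-III)

-- From the integer equation to the number of squares

module _ {c ℓ₁ ℓ₂ : Level} (K : HeytingField c ℓ₁ ℓ₂) where

  odd-square-ℤ : ∀ a → + ((1 + 2 * a) * (1 + 2 * a)) ≡ (1ℤ ℤ.+ + 2 ℤ.* + a) ℤ.* (1ℤ ℤ.+ + 2 ℤ.* + a)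
  odd-square-ℤ a = trans (ℤ.pos-* (1 + 2 * a) (1 + 2 * a)) (cong (λ z → (1ℤ ℤ.+ z) ℤ.* (1ℤ ℤ.+ z)) (ℤ.pos-* 2 a))

  Equation⇒g≡3 : ∀ {m n} → m % 8 ≡ 3 → n % 4 ≡ 1 → Isℚ⟨√-_,√_⟩ K m n → Equation 1 m 2 → g𝒪-is K 3
  Equation⇒g≡3 {m} {n} m%8≡3 n%4≡1 isK eqn = go (m / 8) (n / 4)
    (trans (m≡m%n+[m/n]*n m 8) (cong₂ _+_ m%8≡3 (ℕ.*-comm (m / 8) 8)))
    (trans (m≡m%n+[m/n]*n n 4) (cong₂ _+_ n%4≡1 (ℕ.*-comm (n / 4) 4))) isK (odd-solution {m} m%8≡3 eqn)
    where
    -- `m` and `n` are generalized so that matching on the equations rewrites them inside the type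
    -- of `isK`.
    go : ∀ {m n} j l → m ≡ 3 + 8 * j → n ≡ 1 + 4 * l → Isℚ⟨√-_,√_⟩ K m n →
      ∃[ a ] ∃[ b ] (1 + 2 * a) * (1 + 2 * a) + 2 ≡ m * ((1 + 2 * b) * (1 + 2 * b)) → g𝒪-is K 3
    go j l refl refl isK (a , b , eq) = NumberFields.Biquadratic.g≡3 K j l isK (+ a) (+ b)
      (trans (cong (ℤ._+ + 2) (sym (odd-square-ℤ a))) (trans (cong +_ eq)
        (trans (ℤ.pos-* (3 + 8 * j) ((1 + 2 * b) * (1 + 2 * b))) (cong (+ (3 + 8 * j) ℤ.*_) (odd-square-ℤ b)))))

prime>0 : ∀ {p} → Prime p → 0 < p
prime>0 {p} p-prime = ℕ.>-nonZero⁻¹ p ⦃ prime⇒nonZero p-prime ⦄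

theorem1p3 : ∀ {c ℓ₁ ℓ₂ : Level} (m n : ℕ) →
    0 < m → 0 < n → m ≢ n →
    SquareFree m → SquareFree n →
    m % 4 ≡ 3 → n % 4 ≡ 1 →
    (K : HeytingField c ℓ₁ ℓ₂) → Isℚ⟨√-_,√_⟩ K m n →
    (∀ (p : ℕ) → Prime p →
    m ≡ p → p % 8 ≡ 3 →
    g𝒪-is K 3)
    ×
    (∀ (p q : ℕ) → Prime p → Prime q → p ≢ q →
    m ≡ p * q → p % 8 ≡ 3 → q % 8 ≡ 1 →
    legendre (+ p) q ≡ -[1+ 0 ] →
    g𝒪-is K 3)
    ×
    (∀ (p q r : ℕ) → Prime p → Prime q → Prime r → p ≢ q → q ≢ r → r ≢ p →
    m ≡ p * q * r → p % 8 ≡ 3 → q % 8 ≡ 3 → r % 8 ≡ 3 →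
    legendre (+ p) q ≡ -[1+ 0 ] → legendre (+ q) r ≡ -[1+ 0 ] → legendre (+ r) p ≡ -[1+ 0 ] →
    g𝒪-is K 3)
theorem1p3 m n _ _ _ _ _ _ n%4≡1 K isK =
  (λ { p p-prime refl p%8≡3 → Equation⇒g≡3 K p%8≡3 n%4≡1 isK (case-I p-prime p%8≡3) }) ,
  (λ { p q p-prime q-prime p≢q refl p%8≡3 q%8≡1 [p/q] →
    Equation⇒g≡3 K (*-%8 p q p%8≡3 q%8≡1) n%4≡1 isK
      (case-II p-prime q-prime p≢q p%8≡3 q%8≡1 (legendre⇒¬QR (+ p) q (prime>0 q-prime) [p/q])) }) ,
  (λ { p q r p-prime q-prime r-prime p≢q q≢r r≢p refl p%8≡3 q%8≡3 r%8≡3 [p/q] [q/r] [r/p] →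
    Equation⇒g≡3 K (*-%8 (p * q) r (*-%8 p q p%8≡3 q%8≡3) r%8≡3) n%4≡1 isK
      (case-III p-prime q-prime r-prime p≢q q≢r r≢p p%8≡3 q%8≡3 r%8≡3
        (legendre⇒¬QR (+ p) q (prime>0 q-prime) [p/q])
        (legendre⇒¬QR (+ q) r (prime>0 r-prime) [q/r])
        (legendre⇒¬QR (+ r) p (prime>0 p-prime) [r/p])) })
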